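{- Let $r \geq 1$. Every connected non-negative unit form $q:\mathbb{Z}^n\to\mathbb{Z}$ of Dynkin type $\mathbb{A}_r$ is strongly Gram congruent to a unique standard extension of the unit form $q_{\mathbb{A}_r}$, i.e. to $q_{\vec{\mathbb{A}}^{\mathrm{d}}_{r+1}[\pi]}$ for a unique pair $(\pi,\mathrm{d})$ with $\pi$ a partition of $r+1$ and $\mathrm{d}\ge 0$ an integer.
   Context: An integral quadratic form $q:\mathbb{Z}^n\to\mathbb{Z}$, $q(x)=\sum_{i\le j}q_{ij}x_ix_j$, is a unit form if $q(\mathbf{e}_i)=1$ for all $i$; it is non-negative if $q(x)\ge 0$ for all $x$; it is connected if the graph on $\{1,\dots,n\}$ with an edge $i$–$j$ whenever $q_{ij}\neq 0$ ($i<j$) is connected. $G_q$ denotes the symmetric Gram matrix of the polarization $\mathbb{b}_q(x,y)=q(x+y)-q(x)-q(y)$, and $\check{G}_q$ the unique upper triangular integer matrix with $q(x)=x^{\mathrm{tr}}\check{G}_qx$ (so $G_q=\check{G}_q+\check{G}_q^{\mathrm{tr}}$, and $\check G_q$ has ones on the diagonal for a unit form). Two unit forms $q,q'$ in $n$ variables are weakly Gram congruent if $G_{q'}=B^{\mathrm{tr}}G_qB$ for some $\mathbb{Z}$-invertible $B$, and strongly Gram congruent if $\check{G}_{q'}=B^{\mathrm{tr}}\check{G}_qB$ for some $\mathbb{Z}$-invertible $B$. The Dynkin type of a connected non-negative unit form $q$ is the unique simply-laced Dynkin diagram $\Delta$ such that the form induced by $q$ on $\mathbb{Z}^n/\mathrm{rad}(q)$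 (where $\mathrm{rad}(q)=\ker G_q$) is equivalent to $q_\Delta$, the form with $G_{q_\Delta}=2\mathrm{Id}-\mathrm{Adj}(\Delta)$. Quivers: a quiver $Q$ has vertices $\{1,\dots,m\}$, arrows $\{1,\dots,n\}$ and source/target maps $s,t$. Its incidence matrix $I(Q)$ is the $m\times n$ matrix whose $i$-th column is $\mathbf{e}_{s(i)}-\mathbf{e}_{t(i)}$, and $q_Q(x)=\frac12\|I(Q)x\|^2$. Standard quivers: let $m\ge 2$, $\pi=(\pi_1\ge\dots\ge\pi_\ell>0)$ a partition of $m$, $\mathrm{d}\ge0$, and $v_t=m-(\pi_1+\dots+\pi_t)$ for $t=0,\dots,\ell$. The quiver $\vec{\mathbb{A}}^{\mathrm{d}}_m[\pi]$ has vertices $1,\dots,m$ and $n=m+\ell+2(\mathrm{d}-1)$ arrows, ordered $i_1<\dots<i_{m-1}<j_1<\dots<j_{\ell-1}<k_1<\dots<k_{2\mathrm{d}}$ (numbered $1,\dots,n$ in this order), where $s(i_t)=t$, $t(i_t)=t+1$; $s(j_t)=v_{t-1}$, $t(j_t)=v_t$ ($1\le t\le \ell-1$); and, with $\alpha=i_{m-1}$ if $\ell=1$ and $\alpha=j_{\ell-1}$ if $\ell>1$, the arrow $k_t$ goes from $s(\alpha)$ to $t(\alpha)$ when $t$ is even and from $t(\alpha)$ to $s(\alpha)$ when $t$ is odd. The form $q_{\vec{\mathbb{A}}^{\mathrm{d}}_m[\pi]}$ is called the standard $(\pi,\mathrm{d})$-extension of $q_{\mathbb{A}_{m-1}}$.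 -}

module Defs where

open import Data.Bool using (Bool; true; false; if_then_else_; _∧_)
open import Data.Nat as ℕ using (ℕ; zero; suc; _≡ᵇ_; _<ᵇ_; _∸_)
open import Data.Integer as ℤ using (ℤ; +_; _+_; _-_; _*_; -_; 0ℤ; 1ℤ; _≤_)
open import Data.Integer.DivMod using (_/ℕ_)
open import Data.Fin using (Fin; toℕ) renaming (zero to fzero; suc to fsuc)
open import Data.List using (List; []; _∷_; length; take)
open import Data.Nat.ListAction using (sum)
open import Data.List.Relation.Unary.All using (All)
open import Data.List.Relation.Unary.Linked using (Linked)
open import Data.Product using (Σ; ∃; _×_)
open import Data.Sum using (_⊎_)
open import Relation.Binary.PropositionalEquality using (_≡_; _≢_)
open import Relation.Binary.Construct.Closure.ReflexiveTransitive using (Star)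

Vect : ℕ → Set
Vect n = Fin n → ℤ

Mat : ℕ → ℕ → Set
Mat a b = Fin a → Fin b → ℤ

∑ : ∀ {n} → (Fin n → ℤ) → ℤ
∑ {zero}  f = 0ℤ
∑ {suc n} f = f fzero + ∑ (λ i → f (fsuc i))

infixl 7 _·ₘ_
_·ₘ_ : ∀ {a b c} → Mat a b → Mat b c → Mat a c
(A ·ₘ B) i j = ∑ (λ k → A i k * B k j)

_ᵀ : ∀ {a b} → Mat a b → Mat b a
(A ᵀ) i j = A j i

_·ᵥ_ : ∀ {a b} → Mat a b → Vect b → Vect a
(A ·ᵥ x) i = ∑ (λ k → A i k * x k)

δ : ∀ {n} → Fin n → Fin n → ℤ
δ i j = if toℕ i ≡ᵇ toℕ j then 1ℤ else 0ℤ

Idₘ : ∀ {n} → Mat n n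
Idₘ = δ

𝐞 : ∀ {n} → Fin n → Vect n
𝐞 i j = δ i j

_+ᵥ_ : ∀ {n} → Vect n → Vect n → Vect n
(x +ᵥ y) i = x i + y i

Invertible : ∀ {n} → Mat n n → Set
Invertible {n} B = Σ (Mat n n) λ B' →
  (∀ i j → (B ·ₘ B') i j ≡ Idₘ i j) × (∀ i j → (B' ·ₘ B) i j ≡ Idₘ i j)

-- Integral quadratic forms, given by their coefficients q_ij (i ≤ j).
-- Only the entries with i ≤ j of the coefficient array are used.

Ǧ : ∀ {n} → Mat n n → Mat n n
Ǧ C i j = if toℕ j ℕ.<ᵇ toℕ i then 0ℤ else C i j

eval : ∀ {n} → Mat n n → Vect n → ℤ
eval C x = ∑ (λ i → ∑ (λ j → x i * Ǧ C i j * x j))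

Gram : ∀ {n} → Mat n n → Mat n n
Gram C i j = Ǧ C i j + Ǧ C j i

IsUnitForm : ∀ {n} → Mat n n → Set
IsUnitForm {n} C = ∀ (i : Fin n) → eval C (𝐞 i) ≡ 1ℤ

IsNonNegative : ∀ {n} → Mat n n → Set
IsNonNegative {n} C = ∀ (x : Vect n) → 0ℤ ≤ eval C x

Edge : ∀ {n} → Mat n n → Fin n → Fin n → Set
Edge C i j = (toℕ i ℕ.< toℕ j × C i j ≢ 0ℤ) ⊎ (toℕ j ℕ.< toℕ i × C j i ≢ 0ℤ)

IsConnected : ∀ {n} → Mat n n → Set
IsConnected {n} C = ∀ (i j : Fin n) → Star (Edge C) i j

InRad : ∀ {n} → Mat n n → Vect n → Set
InRad {n} C x = ∀ (i : Fin n) → (Gram C ·ᵥ x) i ≡ 0ℤ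

-- q_{A_r}: G = 2 Id − Adj(A_r), A_r the path 1 – 2 – … – r
qA : (r : ℕ) → Mat r r
qA r i j = if toℕ i ≡ᵇ toℕ j then 1ℤ
           else if suc (toℕ i) ≡ᵇ toℕ j then - 1ℤ else 0ℤ

-- Dynkin type A_r (for q connected non-negative unit form): the form
-- induced by q on ℤⁿ/rad(q) is equivalent to q_{A_r}.  Written out: there is a
-- surjective ℤ-linear map P : ℤⁿ → ℤʳ with kernel exactly rad(q)
-- (so P induces an iso ℤⁿ/rad(q) ≅ ℤʳ) and q(x) = q_{A_r}(P x).
HasDynkinTypeA : ∀ {n} → Mat n n → ℕ → Set
HasDynkinTypeA {n} C r = Σ (Mat r n) λ P →
    (∀ (y : Vect r) → Σ (Vect n) λ x → ∀ i → (P ·ᵥ x) i ≡ y i)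
  × (∀ (x : Vect n) → (∀ i → (P ·ᵥ x) i ≡ 0ℤ) → InRad C x)
  × (∀ (x : Vect n) → InRad C x → ∀ i → (P ·ᵥ x) i ≡ 0ℤ)
  × (∀ (x : Vect n) → eval C x ≡ eval (qA r) (P ·ᵥ x))

StronglyGramCongruent : ∀ {n} → Mat n n → Mat n n → Set
StronglyGramCongruent {n} Gq Gq' = Σ (Mat n n) λ B →
  Invertible B × (∀ i j → Gq' i j ≡ ((B ᵀ) ·ₘ Gq ·ₘ B) i j)

ǦOf : ∀ {n} → (Vect n → ℤ) → Mat n n
ǦOf q i j = if toℕ i ≡ᵇ toℕ j then q (𝐞 i)
            else if toℕ i ℕ.<ᵇ toℕ j then q (𝐞 i +ᵥ 𝐞 j) - q (𝐞 i) - q (𝐞 j)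
            else 0ℤ

-- Quivers: vertices 1..m, arrows numbered 0..n-1 here (arrow a ↔ arrow a+1
-- of the paper), source/target given as vertex labels in ℕ.

-- incidence matrix I(Q): column a is e_{s(a)} − e_{t(a)}; vertex v ∈ Fin m has label toℕ v + 1
incidence : (m n : ℕ) → (s t : ℕ → ℕ) → Mat m n
incidence m n s t v a =
  (if suc (toℕ v) ≡ᵇ s (toℕ a) then 1ℤ else 0ℤ)
  - (if suc (toℕ v) ≡ᵇ t (toℕ a) then 1ℤ else 0ℤ)

-- q_Q(x) = ½ ‖I(Q) x‖²  (the squared norm is always even)
quiverForm : (m n : ℕ) → (s t : ℕ → ℕ) → Vect n → ℤ
quiverForm m n s t x = (∑ (λ v → y v * y v)) /ℕ 2
  where y = incidence m n s t ·ᵥ x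

IsPartition : ℕ → List ℕ → Set
IsPartition m π = Linked ℕ._≥_ π × All (λ p → 0 ℕ.< p) π × sum π ≡ m

vtx : ℕ → List ℕ → ℕ → ℕ
vtx m π t = m ∸ sum (take t π)

-- standard quiver A⃗^d_m[π] : number of arrows m + ℓ + 2(d − 1) = (m−1) + (ℓ−1) + 2d
stdArrows : ℕ → List ℕ → ℕ → ℕ
stdArrows m π d = (m ∸ 1) ℕ.+ (length π ∸ 1) ℕ.+ 2 ℕ.* d

-- endpoints (s(α), t(α)) of α = i_{m−1} if ℓ = 1, α = j_{ℓ−1} if ℓ > 1
αSrc αTgt : ℕ → List ℕ → ℕ
αSrc m π = if length π ≡ᵇ 1 then m ∸ 1 else vtx m π (length π ∸ 2)
αTgt m π = if length π ≡ᵇ 1 then m else vtx m π (length π ∸ 1)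

even? : ℕ → Bool
even? zero = true
even? (suc zero) = false
even? (suc (suc k)) = even? k

-- source and target of arrow number a (0-based); arrows are ordered
-- i_1 … i_{m−1}, j_1 … j_{ℓ−1}, k_1 … k_{2d}
stdSrc stdTgt : ℕ → List ℕ → ℕ → ℕ
stdSrc m π a =
  if a ℕ.<ᵇ (m ∸ 1) then suc a                                        -- i_{a+1}
  else if a ℕ.<ᵇ (m ∸ 1) ℕ.+ (length π ∸ 1)
    then vtx m π (a ∸ (m ∸ 1))                                      -- j_t, t = a−(m−1)+1 : s = v_{t−1}
  else (if even? (suc (a ∸ ((m ∸ 1) ℕ.+ (length π ∸ 1))))            -- k_u, u = a−(m−1)−(ℓ−1)+1
          then αSrc m π else αTgt m π)
stdTgt m π a =
  if a ℕ.<ᵇ (m ∸ 1) then suc (suc a)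
  else if a ℕ.<ᵇ (m ∸ 1) ℕ.+ (length π ∸ 1)
    then vtx m π (suc (a ∸ (m ∸ 1)))
  else (if even? (suc (a ∸ ((m ∸ 1) ℕ.+ (length π ∸ 1))))
          then αTgt m π else αSrc m π)

-- Ǧ of q_{A⃗^d_m[π]}, regarded as a form in n variables (meaningful when
-- n = stdArrows m π d)
ǦStd : (m : ℕ) → List ℕ → ℕ → (n : ℕ) → Mat n n
ǦStd m π d n = ǦOf (quiverForm m n (stdSrc m π) (stdTgt m π))

CongToStd : ∀ {n} → Mat n n → ℕ → List ℕ → ℕ → Set
CongToStd {n} C m π d =
  n ≡ stdArrows m π d × StronglyGramCongruent (Ǧ C) (ǦStd m π d n)

{-# OPTIONS --safe #-}
module Submission where

-- A form of type A_r is realised by a word of n arrows (roots e_a − e_b of A_r) whose underlying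
-- graph on r + 1 vertices is connected, and its upper triangular Gram matrix is that of the word.
-- Reversing an arrow, and the Hurwitz move x y ↦ y s_y(x) on adjacent letters, change this matrix
-- by a strong congruence. As in Clebsch's theorem on factorisations into transpositions, such moves
-- first bring every arrow to a common root ρ, and then bring the star word to a normal form: one
-- cycle A through ρ, blocks (ρ y) Y (ρ y) for the other cycles of the product, and d doubled arrows.
-- Blocks commute, the cycle of ρ is exchanged with another one by changing the root, and doubled
-- arrows can be conjugated arbitrarily, so only the cycle lengths and d matter; the standard quiver
-- has the same normal form.
--
-- Conversely the Coxeter transformation Φ = − A⁻¹ Aᵀ of the upper triangular matrix A acts on
-- ℤⁿ / rad as the product of the transpositions and on rad as the identity. Hence tr Φʲ = n − (r + 1) + #Fix(pʲ),
-- where p permutes the vertices with cycle type π, and these numbers determine π.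

open import Defs
open import Data.Bool using (true; false; if_then_else_; T)
open import Data.Empty using (⊥; ⊥-elim)
open import Data.Fin using (Fin; toℕ; fromℕ<) renaming (zero to fzero; suc to fsuc)
import Data.Fin.Properties as Finₚ
open import Data.Integer as ℤ using (ℤ; -[1+_]; _+_; _-_; _*_; -_; 0ℤ; 1ℤ)
open import Data.Integer.DivMod using (_/ℕ_; _%ℕ_; n%ℕd<d; a≡a%ℕn+[a/ℕn]*n)
import Data.Integer.Properties as ℤₚ
open import Data.Integer.Tactic.RingSolver using (solve-∀)
open import Data.List using (List; []; _∷_; [_]; length; _++_; map; tabulate; applyUpTo; replicate; take; reverse)
open import Data.List.Membership.Propositional using (_∈_; find)
import Data.List.Membership.Propositional.Properties as Memₚ
import Data.List.Properties as Lₚ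
open import Data.List.Relation.Binary.Permutation.Propositional using (_↭_; ↭-sym; ↭-refl; ↭-trans; ↭⇒↭ₛ) renaming (refl to ↭refl; prep to ↭prep; swap to ↭swap; trans to ↭trans)
import Data.List.Relation.Binary.Permutation.Propositional.Properties as ↭ₚ
import Data.List.Relation.Binary.Permutation.Setoid.Properties as ↭Setoidₚ
open import Data.List.Relation.Binary.Pointwise using (Pointwise-≡⇒≡)
open import Data.List.Relation.Unary.All as All using (All; []; _∷_)
import Data.List.Relation.Unary.All.Properties as Allₚ
open import Data.List.Relation.Unary.AllPairs using (AllPairs; []; _∷_)
open import Data.List.Relation.Unary.Any as Any using (here; there)
open import Data.List.Relation.Unary.Linked using (Linked)
open import Data.List.Relation.Unary.Linked.Properties using (Linked⇒AllPairs)
open import Data.List.Relation.Unary.Sorted.TotalOrder.Properties using (↗↭↗⇒≋)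
open import Data.List.Relation.Unary.Unique.Propositional using (Unique)
import Data.List.Sort as Sort
open import Data.Nat as ℕ using (ℕ; zero; suc; _≡ᵇ_; _<ᵇ_; _∸_; _≥_)
open import Data.List.Membership.DecPropositional ℕ._≟_ using (_∈?_)
open import Data.Nat.DivMod using (_%_; _/_; m≡m%n+[m/n]*n; m%n<n; m<n⇒m%n≡m; n%n≡0; [m+kn]%n≡m%n; m≤n⇒[n∸m]%m≡n%m)
open import Data.Nat.ListAction using (sum)
open import Data.Nat.ListAction.Properties using (sum-↭)
import Data.Nat.Properties as ℕₚ
import Data.Nat.Tactic.RingSolver as ℕRing
open import Data.Product using (Σ; _×_; _,_; proj₁; proj₂)
open import Data.Sum using (_⊎_; inj₁; inj₂; reduce)
open import Data.Unit using (⊤; tt)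
open import Function using (_∘_; id)
open import Relation.Binary.Bundles using (DecTotalOrder)
import Relation.Binary.Construct.Flip.EqAndOrd as Flip
open import Relation.Binary.Definitions using (tri<; tri≈; tri>)
open import Relation.Binary.PropositionalEquality using (_≡_; _≢_; refl; sym; trans; cong; cong₂; subst; setoid; module ≡-Reasoning)
open import Relation.Nullary using (¬_; Dec; yes; no; contradiction)
open import Relation.Nullary.Decidable using (_⊎-dec_)


open ≡-Reasoning

-- Each basis vector of a unit form of type A_r becomes a vector of norm 2 in the sum-zero lattice
-- of ℤʳ⁺¹, hence some e_a - e_b; this is where the arrows come from. The lengths of related words
-- agree only propositionally, so strong congruence is carried as an isometry `_≅_` between forms on
-- possibly different index sets and becomes a matrix only at the ends. The letters in front of a
-- move pair with the vector `V w x` of the remaining word; hence the inductions on words show that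
-- `V` is preserved along with `M`. The normal form follows the cycles of the product: a new star
-- letter lengthens the cycle of the root, splits it, or merges it with another one, and only a
-- merge leaves a doubled arrow behind. The traces are invariant because A is unitriangular: Φ is
-- the only map with M z (Φ x) = - M x z, so isometries intertwine it. They yield π, and d then
-- follows from n = r + (ℓ - 1) + 2d.

∑-cong : ∀ {n} {f g : Vect n} → (∀ i → f i ≡ g i) → ∑ f ≡ ∑ g
∑-cong {zero}  h = refl
∑-cong {suc n} h = cong₂ _+_ (h fzero) (∑-cong (h ∘ fsuc))

∑-0 : ∀ {n} → ∑ {n} (λ _ → 0ℤ) ≡ 0ℤ
∑-0 {zero}  = refl
∑-0 {suc n} = trans (ℤₚ.+-identityˡ _) (∑-0 {n})

∑-zero : ∀ {n} {f : Vect n} → (∀ i → f i ≡ 0ℤ) → ∑ f ≡ 0ℤ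
∑-zero {n} h = trans (∑-cong h) (∑-0 {n})

+-interchange : ∀ a b c d → (a + b) + (c + d) ≡ (a + c) + (b + d)
+-interchange = solve-∀

∑-+ : ∀ {n} (f g : Vect n) → ∑ (λ i → f i + g i) ≡ ∑ f + ∑ g
∑-+ {zero}  f g = refl
∑-+ {suc n} f g = trans (cong (λ z → f fzero + g fzero + z) (∑-+ (f ∘ fsuc) (g ∘ fsuc))) (+-interchange (f fzero) (g fzero) _ _)

∑-*ˡ : ∀ {n} c (f : Vect n) → ∑ (λ i → c * f i) ≡ c * ∑ f
∑-*ˡ {zero}  c f = sym (ℤₚ.*-zeroʳ c)
∑-*ˡ {suc n} c f = trans (cong (λ z → c * f fzero + z) (∑-*ˡ c (f ∘ fsuc))) (sym (ℤₚ.*-distribˡ-+ c (f fzero) _))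

∑-*ʳ : ∀ {n} c (f : Vect n) → ∑ (λ i → f i * c) ≡ ∑ f * c
∑-*ʳ c f = trans (∑-cong (λ i → ℤₚ.*-comm (f i) c)) (trans (∑-*ˡ c f) (ℤₚ.*-comm c _))

∑-neg : ∀ {n} (f : Vect n) → ∑ (λ i → - f i) ≡ - ∑ f
∑-neg {zero}  f = refl
∑-neg {suc n} f = trans (cong (λ z → - f fzero + z) (∑-neg (f ∘ fsuc))) (sym (ℤₚ.neg-distrib-+ (f fzero) _))

∑-- : ∀ {n} (f g : Vect n) → ∑ (λ i → f i - g i) ≡ ∑ f - ∑ g
∑-- f g = trans (∑-+ f (λ i → - g i)) (cong (∑ f +_) (∑-neg g))

∑-swap : ∀ {m n} (f : Fin m → Fin n → ℤ) → ∑ (λ i → ∑ (λ j → f i j)) ≡ ∑ (λ j → ∑ (λ i → f i j))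
∑-swap {zero}  {n} f = sym (∑-0 {n})
∑-swap {suc m} {n} f = trans (cong (λ z → ∑ (f fzero) + z) (∑-swap (f ∘ fsuc)))
  (sym (∑-+ (f fzero) (λ j → ∑ (λ i → f (fsuc i) j))))

-- The Kronecker symbol on ℕ; δ i j and 𝐞 i j unfold to it.
dl : ℕ → ℕ → ℤ
dl a b = if a ≡ᵇ b then 1ℤ else 0ℤ

dl-refl : ∀ a → dl a a ≡ 1ℤ
dl-refl zero    = refl
dl-refl (suc a) = dl-refl a

dl-≢ : ∀ {a b} → a ≢ b → dl a b ≡ 0ℤ
dl-≢ {zero}  {zero}  p = ⊥-elim (p refl)
dl-≢ {zero}  {suc b} p = refl
dl-≢ {suc a} {zero}  p = refl
dl-≢ {suc a} {suc b} p = dl-≢ (p ∘ cong suc)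

dl-sym : ∀ a b → dl a b ≡ dl b a
dl-sym zero    zero    = refl
dl-sym zero    (suc b) = refl
dl-sym (suc a) zero    = refl
dl-sym (suc a) (suc b) = dl-sym a b

∑-δˡ : ∀ {n} (k : Fin n) (f : Vect n) → ∑ (λ i → δ k i * f i) ≡ f k
∑-δˡ fzero    f = trans (cong₂ _+_ (ℤₚ.*-identityˡ (f fzero)) (∑-zero (λ i → ℤₚ.*-zeroˡ (f (fsuc i))))) (ℤₚ.+-identityʳ _)
∑-δˡ (fsuc k) f = trans (cong₂ _+_ (ℤₚ.*-zeroˡ (f fzero)) (∑-δˡ k (f ∘ fsuc))) (ℤₚ.+-identityˡ _)

∑-δʳ : ∀ {n} (k : Fin n) (f : Vect n) → ∑ (λ i → f i * δ i k) ≡ f k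
∑-δʳ k f = trans (∑-cong (λ i → trans (ℤₚ.*-comm (f i) _) (cong (_* f i) (dl-sym (toℕ i) (toℕ k))))) (∑-δˡ k f)

∑-ones : ∀ {m} (a : Fin m) → ∑ (λ v → δ v a) ≡ 1ℤ
∑-ones a = trans (∑-cong λ v → sym (ℤₚ.*-identityˡ (δ v a))) (∑-δʳ a (λ _ → 1ℤ))

∑-const1 : ∀ n → ∑ {n} (λ _ → 1ℤ) ≡ ℤ.+ n
∑-const1 zero    = refl
∑-const1 (suc n) = trans (cong (1ℤ +_) (∑-const1 n)) refl

-- Linear maps, bilinear forms and isometries

infixl 7 _·ˢ_
_·ˢ_ : ∀ {n} → ℤ → Vect n → Vect n
(c ·ˢ x) i = c * x i

infix 4 _≗ᵥ_
_≗ᵥ_ : ∀ {n} → Vect n → Vect n → Set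
x ≗ᵥ y = ∀ i → x i ≡ y i

-- Vectors are functions, so respecting pointwise equality is made part of linearity; `ext` stands
-- in for function extensionality.
record Lin {a b} (T : Vect a → Vect b) : Set where
  field
    ext   : ∀ {x y} → x ≗ᵥ y → T x ≗ᵥ T y
    add   : ∀ x y → T (x +ᵥ y) ≗ᵥ (T x +ᵥ T y)
    scale : ∀ c x → T (c ·ˢ x) ≗ᵥ (c ·ˢ T x)
open Lin

id-lin : ∀ {a} → Lin {a} id
id-lin = record { ext = id ; add = λ _ _ _ → refl ; scale = λ _ _ _ → refl }

∘-lin : ∀ {a b c} {T : Vect b → Vect c} {S : Vect a → Vect b} → Lin T → Lin S → Lin (T ∘ S)
∘-lin t s = record
  { ext   = ext t ∘ ext s
  ; add   = λ x y i → trans (ext t (add s x y) i) (add t _ _ i)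
  ; scale = λ c x i → trans (ext t (scale s c x) i) (scale t c _ i) }

vcons : ∀ {n} → ℤ → Vect n → Vect (suc n)
vcons c x fzero    = c
vcons c x (fsuc i) = x i

vtl : ∀ {n} → Vect (suc n) → Vect n
vtl x i = x (fsuc i)

lin-expand : ∀ {a b} {T : Vect a → Vect b} → Lin T → ∀ x j → T x j ≡ ∑ (λ i → x i * T (𝐞 i) j)
lin-expand {zero} {T = T} t x j = begin
  -- Over ℤ⁰ every vector equals its own multiple by 0, so homogeneity alone gives T x = 0.
  T x j               ≡⟨ ext t (λ ()) j ⟩
  T (0ℤ ·ˢ x) j       ≡⟨ scale t 0ℤ x j ⟩
  0ℤ * T x j          ≡⟨ ℤₚ.*-zeroˡ (T x j) ⟩
  0ℤ                  ∎
lin-expand {suc a} {T = T} t x j = begin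
  T x j                                                ≡⟨ ext t split j ⟩
  T ((x fzero ·ˢ 𝐞 fzero) +ᵥ vcons 0ℤ (vtl x)) j       ≡⟨ add t _ _ j ⟩
  T (x fzero ·ˢ 𝐞 fzero) j + T (vcons 0ℤ (vtl x)) j    ≡⟨ cong₂ _+_ (scale t (x fzero) (𝐞 fzero) j) (lin-expand t′ (vtl x) j) ⟩
  x fzero * T (𝐞 fzero) j + ∑ (λ i → x (fsuc i) * T (vcons 0ℤ (𝐞 i)) j)
    ≡⟨ cong (λ z → x fzero * T (𝐞 fzero) j + z) (∑-cong λ i → cong (x (fsuc i) *_) (ext t {vcons 0ℤ (𝐞 i)} {𝐞 (fsuc i)} (λ { fzero → refl ; (fsuc k) → refl }) j)) ⟩
  ∑ (λ i → x i * T (𝐞 i) j)                            ∎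
  where
  split : x ≗ᵥ ((x fzero ·ˢ 𝐞 fzero) +ᵥ vcons 0ℤ (vtl x))
  split fzero    = sym (trans (ℤₚ.+-identityʳ _) (ℤₚ.*-identityʳ _))
  split (fsuc i) = sym (trans (cong (_+ x (fsuc i)) (ℤₚ.*-zeroʳ (x fzero))) (ℤₚ.+-identityˡ _))
  t′ : Lin (λ y → T (vcons 0ℤ y))
  t′ = ∘-lin t record
    { ext   = λ { e fzero → refl ; e (fsuc i) → e i }
    ; add   = λ { _ _ fzero → refl ; _ _ (fsuc i) → refl }
    ; scale = λ { c _ fzero → sym (ℤₚ.*-zeroʳ c) ; _ _ (fsuc i) → refl } }

·ᵥ-lin : ∀ {a b} (B : Mat a b) → Lin (B ·ᵥ_)
·ᵥ-lin B = record
  { ext   = λ e i → ∑-cong λ k → cong (B i k *_) (e k)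
  ; add   = λ x y i → trans (∑-cong λ k → ℤₚ.*-distribˡ-+ (B i k) (x k) (y k)) (∑-+ (λ k → B i k * x k) (λ k → B i k * y k))
  ; scale = λ c x i → trans (∑-cong λ k → comm (B i k) c (x k)) (∑-*ˡ c (λ k → B i k * x k)) }
  where
  comm : ∀ a b c → a * (b * c) ≡ b * (a * c)
  comm = solve-∀

matOf : ∀ {a b} → (Vect a → Vect b) → Mat b a
matOf T i j = T (𝐞 j) i

matOf-·ᵥ : ∀ {a b} {T : Vect a → Vect b} → Lin T → ∀ x i → (matOf T ·ᵥ x) i ≡ T x i
matOf-·ᵥ {T = T} t x i = trans (∑-cong λ k → ℤₚ.*-comm (T (𝐞 k) i) (x k)) (sym (lin-expand t x i))

β : ∀ {n} → Mat n n → Vect n → Vect n → ℤ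
β C x y = ∑ (λ i → ∑ (λ j → x i * C i j * y j))

β-𝐞 : ∀ {n} (C : Mat n n) i j → β C (𝐞 i) (𝐞 j) ≡ C i j
β-𝐞 C i j = begin
  ∑ (λ k → ∑ (λ l → δ i k * C k l * δ j l))   ≡⟨ (∑-cong λ k → ∑-cong λ l → re (δ i k) (C k l) (δ j l)) ⟩
  ∑ (λ k → ∑ (λ l → δ i k * (δ j l * C k l))) ≡⟨ (∑-cong λ k → ∑-*ˡ (δ i k) (λ l → δ j l * C k l)) ⟩
  ∑ (λ k → δ i k * ∑ (λ l → δ j l * C k l))   ≡⟨ ∑-δˡ i _ ⟩
  ∑ (λ l → δ j l * C i l)                     ≡⟨ ∑-δˡ j _ ⟩
  C i j                                       ∎
  where
  re : ∀ a b c → a * b * c ≡ a * (c * b)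
  re = solve-∀

Form : ℕ → Set
Form n = Vect n → Vect n → ℤ

Ext : ∀ {n} → Form n → Set
Ext f = ∀ {x x′ y y′} → x ≗ᵥ x′ → y ≗ᵥ y′ → f x y ≡ f x′ y′

β-ext : ∀ {n} (C : Mat n n) → Ext (β C)
β-ext C ex ey = ∑-cong λ i → ∑-cong λ j → cong₂ _*_ (cong (_* C i j) (ex i)) (ey j)

-- The map `to` runs from the variables of `g` to those of `f`, like the matrix B in G' = Bᵗ G B.
-- Allowing `a` and `b` to differ avoids transporting vectors along equalities of word lengths.
record _≅_ {a b} (f : Form a) (g : Form b) : Set where
  field
    to      : Vect b → Vect a
    from    : Vect a → Vect b
    to-lin  : Lin to
    from-lin : Lin from
    to-from : ∀ x → to (from x) ≗ᵥ x
    from-to : ∀ x → from (to x) ≗ᵥ x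
    isom    : ∀ x y → g x y ≡ f (to x) (to y)
open _≅_

≅-refl : ∀ {a} {f g : Form a} → (∀ x y → f x y ≡ g x y) → f ≅ g
≅-refl e = record { to = id ; from = id ; to-lin = id-lin ; from-lin = id-lin
  ; to-from = λ _ _ → refl ; from-to = λ _ _ → refl ; isom = λ x y → sym (e x y) }

≅-sym : ∀ {a b} {f : Form a} {g : Form b} → Ext f → f ≅ g → g ≅ f
≅-sym e p = record { to = from p ; from = to p ; to-lin = from-lin p ; from-lin = to-lin p
  ; to-from = from-to p ; from-to = to-from p
  ; isom = λ x y → trans (e (λ i → sym (to-from p x i)) (λ i → sym (to-from p y i))) (sym (isom p _ _)) }

≅-trans : ∀ {a b c} {f : Form a} {g : Form b} {h : Form c} → f ≅ g → g ≅ h → f ≅ h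
≅-trans p q = record
  { to = to p ∘ to q ; from = from q ∘ from p
  ; to-lin = ∘-lin (to-lin p) (to-lin q) ; from-lin = ∘-lin (from-lin q) (from-lin p)
  ; to-from = λ x i → trans (ext (to-lin p) (to-from q (from p x)) i) (to-from p x i)
  ; from-to = λ x i → trans (ext (from-lin q) (from-to p (to q x)) i) (from-to q x i)
  ; isom = λ x y → trans (isom q x y) (isom p _ _) }

matOf-inverse : ∀ {a b} {T : Vect b → Vect a} {S : Vect a → Vect b} → Lin T →
  (∀ x → T (S x) ≗ᵥ x) → ∀ i j → (matOf T ·ₘ matOf S) i j ≡ Idₘ i j
matOf-inverse {T = T} {S} t e i j = begin
  (matOf T ·ᵥ S (𝐞 j)) i   ≡⟨ matOf-·ᵥ t (S (𝐞 j)) i ⟩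
  T (S (𝐞 j)) i            ≡⟨ e (𝐞 j) i ⟩
  δ j i                    ≡⟨ dl-sym (toℕ j) (toℕ i) ⟩
  δ i j                    ∎

congruence-entry : ∀ {a b} (C : Mat a a) (B : Mat a b) i j →
  ((B ᵀ) ·ₘ C ·ₘ B) i j ≡ β C (λ k → B k i) (λ k → B k j)
congruence-entry C B i j = begin
  ∑ (λ l → ∑ (λ k → B k i * C k l) * B l j)   ≡⟨ (∑-cong λ l → sym (∑-*ʳ (B l j) (λ k → B k i * C k l))) ⟩
  ∑ (λ l → ∑ (λ k → B k i * C k l * B l j))   ≡⟨ ∑-swap (λ l k → B k i * C k l * B l j) ⟩
  ∑ (λ k → ∑ (λ l → B k i * C k l * B l j))   ∎

≅⇒SGC : ∀ {n} {C D : Mat n n} → β C ≅ β D → StronglyGramCongruent C D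
≅⇒SGC {C = C} {D} p = matOf (to p)
  , (matOf (from p) , matOf-inverse (to-lin p) (to-from p) , matOf-inverse (from-lin p) (from-to p))
  , λ i j → begin
      D i j                             ≡⟨ sym (β-𝐞 D i j) ⟩
      β D (𝐞 i) (𝐞 j)                   ≡⟨ isom p (𝐞 i) (𝐞 j) ⟩
      β C (to p (𝐞 i)) (to p (𝐞 j))     ≡⟨ sym (congruence-entry C (matOf (to p)) i j) ⟩
      ((matOf (to p) ᵀ) ·ₘ C ·ₘ matOf (to p)) i j ∎

record Bilin {n} (f : Form n) : Set where
  field
    ext₂   : Ext f
    addˡ   : ∀ x y z → f (x +ᵥ y) z ≡ f x z + f y z
    scaleˡ : ∀ c x z → f (c ·ˢ x) z ≡ c * f x z
    addʳ   : ∀ x y z → f x (y +ᵥ z) ≡ f x y + f x z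
    scaleʳ : ∀ c x z → f x (c ·ˢ z) ≡ c * f x z
open Bilin

bilin-expand : ∀ {n} {f : Form n} → Bilin f → ∀ x y → f x y ≡ ∑ (λ i → ∑ (λ j → x i * f (𝐞 i) (𝐞 j) * y j))
bilin-expand {n} {f} b x y = begin
  f x y                                               ≡⟨ lin-expand linˡ x fzero ⟩
  ∑ (λ i → x i * f (𝐞 i) y)                           ≡⟨ (∑-cong λ i → cong (x i *_) (lin-expand (linʳ (𝐞 i)) y fzero)) ⟩
  ∑ (λ i → x i * ∑ (λ j → y j * f (𝐞 i) (𝐞 j)))       ≡⟨ (∑-cong λ i → sym (∑-*ˡ (x i) (λ j → y j * f (𝐞 i) (𝐞 j)))) ⟩
  ∑ (λ i → ∑ (λ j → x i * (y j * f (𝐞 i) (𝐞 j))))     ≡⟨ (∑-cong λ i → ∑-cong λ j → re (x i) (y j) _) ⟩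
  ∑ (λ i → ∑ (λ j → x i * f (𝐞 i) (𝐞 j) * y j))       ∎
  where
  linˡ : Lin {n} {1} (λ x _ → f x y)
  linˡ = record { ext = λ e _ → ext₂ b e (λ _ → refl) ; add = λ x z _ → addˡ b x z y ; scale = λ c x _ → scaleˡ b c x y }
  linʳ : ∀ z → Lin {n} {1} (λ y _ → f z y)
  linʳ z = record { ext = λ e _ → ext₂ b (λ _ → refl) e ; add = λ x y _ → addʳ b z x y ; scale = λ c x _ → scaleʳ b c z x }
  re : ∀ a b c → a * (b * c) ≡ a * c * b
  re = solve-∀

β-bilin : ∀ {n} (C : Mat n n) → Bilin (β C)
β-bilin C = record
    { ext₂ = β-ext C
    ; addˡ = λ x y z → trans (∑-cong λ i → trans (∑-cong λ j → l1 (x i) (y i) (C i j) (z j)) (∑-+ (λ j → x i * C i j * z j) (λ j → y i * C i j * z j)))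
        (∑-+ (λ i → ∑ (λ j → x i * C i j * z j)) (λ i → ∑ (λ j → y i * C i j * z j)))
    ; scaleˡ = λ c x z → trans (∑-cong λ i → trans (∑-cong λ j → l2 c (x i) (C i j) (z j)) (∑-*ˡ c (λ j → x i * C i j * z j)))
        (∑-*ˡ c (λ i → ∑ (λ j → x i * C i j * z j)))
    ; addʳ = λ x y z → trans (∑-cong λ i → trans (∑-cong λ j → l3 (x i) (C i j) (y j) (z j)) (∑-+ (λ j → x i * C i j * y j) (λ j → x i * C i j * z j)))
        (∑-+ (λ i → ∑ (λ j → x i * C i j * y j)) (λ i → ∑ (λ j → x i * C i j * z j)))
    ; scaleʳ = λ c x z → trans (∑-cong λ i → trans (∑-cong λ j → l4 (x i) (C i j) c (z j)) (∑-*ˡ c (λ j → x i * C i j * z j)))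
        (∑-*ˡ c (λ i → ∑ (λ j → x i * C i j * z j))) }
  where
  l1 : ∀ a b c d → (a + b) * c * d ≡ a * c * d + b * c * d
  l1 = solve-∀
  l2 : ∀ a b c d → a * b * c * d ≡ a * (b * c * d)
  l2 = solve-∀
  l3 : ∀ a b c d → a * b * (c + d) ≡ a * b * c + a * b * d
  l3 = solve-∀
  l4 : ∀ a b c d → a * b * (c * d) ≡ c * (a * b * d)
  l4 = solve-∀

-- The congruence is given for matrix entries only; it spreads to all vectors because both sides are
-- bilinear, the right-hand one being the pullback `pulled`.
SGC⇒≅ : ∀ {n} {C D : Mat n n} → StronglyGramCongruent C D → β C ≅ β D
SGC⇒≅ {n} {C} {D} (B , (B′ , BB′ , B′B) , e) = record
  { to = B ·ᵥ_ ; from = B′ ·ᵥ_ ; to-lin = ·ᵥ-lin B ; from-lin = ·ᵥ-lin B′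
  ; to-from = inverse B B′ BB′ ; from-to = inverse B′ B B′B
  ; isom = λ x y → begin
      ∑ (λ i → ∑ (λ j → x i * D i j * y j))
        ≡⟨ (∑-cong λ i → ∑-cong λ j → cong (λ d → x i * d * y j) (trans (e i j) (trans (congruence-entry C B i j)
             (β-ext C (λ k → col i k) (λ k → col j k))))) ⟩
      ∑ (λ i → ∑ (λ j → x i * β C (B ·ᵥ 𝐞 i) (B ·ᵥ 𝐞 j) * y j))
        ≡⟨ sym (bilin-expand pulled x y) ⟩
      β C (B ·ᵥ x) (B ·ᵥ y) ∎ }
  where
  col : ∀ i k → B k i ≡ (B ·ᵥ 𝐞 i) k
  col i k = sym (trans (∑-cong λ l → cong (B k l *_) (dl-sym (toℕ i) (toℕ l))) (∑-δʳ i (B k)))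
  inverse : ∀ (X Y : Mat n n) → (∀ i j → (X ·ₘ Y) i j ≡ Idₘ i j) → ∀ x → X ·ᵥ (Y ·ᵥ x) ≗ᵥ x
  inverse X Y h x i = begin
    ∑ (λ k → X i k * ∑ (λ l → Y k l * x l))   ≡⟨ (∑-cong λ k → sym (∑-*ˡ (X i k) (λ l → Y k l * x l))) ⟩
    ∑ (λ k → ∑ (λ l → X i k * (Y k l * x l))) ≡⟨ ∑-swap (λ k l → X i k * (Y k l * x l)) ⟩
    ∑ (λ l → ∑ (λ k → X i k * (Y k l * x l))) ≡⟨ (∑-cong λ l → trans (∑-cong λ k → sym (ℤₚ.*-assoc (X i k) (Y k l) (x l))) (∑-*ʳ (x l) (λ k → X i k * Y k l))) ⟩
    ∑ (λ l → (X ·ₘ Y) i l * x l)              ≡⟨ (∑-cong λ l → cong (_* x l) (h i l)) ⟩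
    ∑ (λ l → δ i l * x l)                     ≡⟨ ∑-δˡ i x ⟩
    x i ∎
  βC = β-bilin C
  b = ·ᵥ-lin B
  pulled : Bilin (λ x y → β C (B ·ᵥ x) (B ·ᵥ y))
  pulled = record
    { ext₂ = λ ex ey → β-ext C (ext b ex) (ext b ey)
    ; addˡ = λ x y z → trans (β-ext C (add b x y) (λ _ → refl)) (addˡ βC (B ·ᵥ x) (B ·ᵥ y) (B ·ᵥ z))
    ; scaleˡ = λ c x z → trans (β-ext C (scale b c x) (λ _ → refl)) (scaleˡ βC c (B ·ᵥ x) (B ·ᵥ z))
    ; addʳ = λ x y z → trans (β-ext C {x = B ·ᵥ x} (λ _ → refl) (add b y z)) (addʳ βC (B ·ᵥ x) (B ·ᵥ y) (B ·ᵥ z))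
    ; scaleʳ = λ c x z → trans (β-ext C {x = B ·ᵥ x} (λ _ → refl) (scale b c z)) (scaleʳ βC c (B ·ᵥ x) (B ·ᵥ z)) }

-- Words of arrows and Hurwitz moves

Arrow : Set
Arrow = ℕ × ℕ

Word : Set
Word = List Arrow

ar : Arrow → ℕ → ℤ
ar (a , b) c = dl c a - dl c b

br : Arrow → (ℕ → ℤ) → ℤ
br (a , b) h = h a - h b

-- V w x is the value at x of the incidence matrix of the quiver with arrow list w, and
-- M w the bilinear form of the upper triangular Gram matrix of that quiver.
V : (w : Word) → Vect (length w) → ℕ → ℤ
V []      x c = 0ℤ
V (v ∷ w) x c = x fzero * ar v c + V w (vtl x) c

M : (w : Word) → Form (length w)
M []      x y = 0ℤ
M (v ∷ w) x y = x fzero * y fzero + x fzero * br v (V w (vtl y)) + M w (vtl x) (vtl y)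

br-cong : ∀ v {h h′} → (∀ c → h c ≡ h′ c) → br v h ≡ br v h′
br-cong (a , b) e = cong₂ _-_ (e a) (e b)

V-ext : ∀ w {x y} → x ≗ᵥ y → ∀ c → V w x c ≡ V w y c
V-ext []      e c = refl
V-ext (v ∷ w) e c = cong₂ _+_ (cong (_* ar v c) (e fzero)) (V-ext w (e ∘ fsuc) c)

M-ext : ∀ w → Ext (M w)
M-ext []      ex ey = refl
M-ext (v ∷ w) ex ey = cong₂ _+_ (cong₂ _+_ (cong₂ _*_ (ex fzero) (ey fzero))
  (cong₂ _*_ (ex fzero) (br-cong v (V-ext w (ey ∘ fsuc))))) (M-ext w (ex ∘ fsuc) (ey ∘ fsuc))

τ : ℕ → ℕ → ℕ → ℕ
τ c d a with a ℕ.≟ c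
... | yes _ = d
... | no  _ with a ℕ.≟ d
...   | yes _ = c
...   | no  _ = a

τ-l : ∀ c d → τ c d c ≡ d
τ-l c d with c ℕ.≟ c
... | yes _ = refl
... | no  p = ⊥-elim (p refl)

τ-r : ∀ c d → τ c d d ≡ c
τ-r c d with d ℕ.≟ c
... | yes p = p
... | no  _ with d ℕ.≟ d
...   | yes _ = refl
...   | no  p = ⊥-elim (p refl)

τ-o : ∀ {c d a} → a ≢ c → a ≢ d → τ c d a ≡ a
τ-o {c} {d} {a} p q with a ℕ.≟ c
... | yes r = ⊥-elim (p r)
... | no  _ with a ℕ.≟ d
...   | yes r = ⊥-elim (q r)
...   | no  _ = refl

τ-invol : ∀ c d a → τ c d (τ c d a) ≡ a
τ-invol c d a with a ℕ.≟ c
... | yes refl = τ-r a d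
... | no  p with a ℕ.≟ d
...   | yes refl = τ-l c a
...   | no  q = τ-o p q

-- The root e_c - e_d has norm 2, so its reflection exchanges the coordinates c and d. This is the
-- bridge between roots and permutations.
τ-reflection : ∀ {c d} → c ≢ d → ∀ (h : ℕ → ℤ) a → h (τ c d a) ≡ h a - ar (c , d) a * (h c - h d)
τ-reflection {c} {d} c≢d h a with a ℕ.≟ c
... | yes refl = sym (trans (cong (λ z → h a - z * (h a - h d)) (cong₂ _-_ (dl-refl a) (dl-≢ c≢d))) (lem (h a) (h d)))
  where
  lem : ∀ p q → p - (1ℤ - 0ℤ) * (p - q) ≡ q
  lem = solve-∀
... | no a≢c with a ℕ.≟ d
...   | yes refl = sym (trans (cong (λ z → h a - z * (h c - h a)) (cong₂ _-_ (dl-≢ a≢c) (dl-refl a))) (lem (h a) (h c)))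
  where
  lem : ∀ p q → p - (0ℤ - 1ℤ) * (q - p) ≡ q
  lem = solve-∀
...   | no a≢d = sym (trans (cong (λ z → h a - z * (h c - h d)) (cong₂ _-_ (dl-≢ a≢c) (dl-≢ a≢d))) (lem (h a) (h c - h d)))
  where
  lem : ∀ p q → p - (0ℤ - 0ℤ) * q ≡ p
  lem = solve-∀

act : Arrow → Arrow → Arrow
act (c , d) (a , b) = τ c d a , τ c d b

act-invol : ∀ y x → act y (act y x) ≡ x
act-invol (c , d) (a , b) = cong₂ _,_ (τ-invol c d a) (τ-invol c d b)

Proper : Arrow → Set
Proper (c , d) = c ≢ d

br-act : ∀ y → Proper y → ∀ x h → br (act y x) h ≡ br x h - br x (ar y) * br y h
br-act (c , d) p (a , b) h =
  trans (cong₂ _-_ (τ-reflection p h a) (τ-reflection p h b)) (lem (h a) (h b) (ar (c , d) a) (ar (c , d) b) (h c - h d))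
  where
  lem : ∀ p q r s k → (p - r * k) - (q - s * k) ≡ (p - q) - (r - s) * k
  lem = solve-∀

br-ar-sym : ∀ x y → br x (ar y) ≡ br y (ar x)
br-ar-sym (a , b) (c , d) = trans (cong₂ _-_ (cong₂ _-_ (dl-sym a c) (dl-sym a d)) (cong₂ _-_ (dl-sym b c) (dl-sym b d)))
  (lem (dl c a) (dl d a) (dl c b) (dl d b))
  where
  lem : ∀ p q r s → (p - q) - (r - s) ≡ (p - r) - (q - s)
  lem = solve-∀

br-self : ∀ y → Proper y → br y (ar y) ≡ ℤ.+ 2
br-self (c , d) p = cong₂ _-_ (cong₂ _-_ (dl-refl c) (dl-≢ p)) (cong₂ _-_ (dl-≢ (p ∘ sym)) (dl-refl d))

ar-act : ∀ y → Proper y → ∀ x c → ar (act y x) c ≡ ar x c - br x (ar y) * ar y c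
ar-act y p x c = br-act y p x (dl c)

infix 4 _∼_
-- Moves act at the head and `∼cons` carries them to every position. Only one direction of the braid
-- move is a generator; the other comes from `∼sym`.
data _∼_ : Word → Word → Set where
  ∼refl  : ∀ {w} → w ∼ w
  ∼sym   : ∀ {w w′} → w ∼ w′ → w′ ∼ w
  ∼trans : ∀ {w w′ w″} → w ∼ w′ → w′ ∼ w″ → w ∼ w″
  ∼cons  : ∀ v {w w′} → w ∼ w′ → v ∷ w ∼ v ∷ w′
  ∼flip  : ∀ a b {w} → (a , b) ∷ w ∼ (b , a) ∷ w
  ∼braid : ∀ x y {w} → Proper y → x ∷ y ∷ w ∼ y ∷ act y x ∷ w

∼-length : ∀ {w w′} → w ∼ w′ → length w ≡ length w′
∼-length ∼refl         = refl
∼-length (∼sym p)      = sym (∼-length p)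
∼-length (∼trans p q)  = trans (∼-length p) (∼-length q)
∼-length (∼cons v p)   = cong suc (∼-length p)
∼-length (∼flip a b)   = refl
∼-length (∼braid _ _ _) = refl

lift : ∀ {a b} → (Vect a → Vect b) → Vect (suc a) → Vect (suc b)
lift T x = vcons (x fzero) (T (vtl x))

lift-lin : ∀ {a b} {T : Vect a → Vect b} → Lin T → Lin (lift T)
lift-lin t = record
  { ext   = λ { e fzero → e fzero ; e (fsuc i) → ext t (e ∘ fsuc) i }
  ; add   = λ { x y fzero → refl ; x y (fsuc i) → add t (vtl x) (vtl y) i }
  ; scale = λ { c x fzero → refl ; c x (fsuc i) → scale t c (vtl x) i } }

lift-inverse : ∀ {a b} {T : Vect a → Vect b} {S : Vect b → Vect a} → (∀ x → T (S x) ≗ᵥ x) → ∀ x → lift T (lift S x) ≗ᵥ x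
lift-inverse e x fzero    = refl
lift-inverse e x (fsuc i) = e (vtl x) i

-- `V-to` strengthens the induction: in `v ∷ w` the first coordinate is paired with `br v (V w y)`,
-- so the case `∼cons` needs the isometry of the tails to preserve `V` as well as `M`.
record Realised (w w′ : Word) : Set where
  field
    iso  : M w ≅ M w′
    V-to : ∀ x c → V w′ x c ≡ V w (to iso x) c
open Realised

realise-flip : ∀ a b w → Realised ((a , b) ∷ w) ((b , a) ∷ w)
realise-flip a b w = record
  { iso = record
    { to = neg ; from = neg ; to-lin = neg-lin ; from-lin = neg-lin ; to-from = neg-neg ; from-to = neg-neg
    ; isom = λ x y → cong (_+ M w (vtl x) (vtl y)) (lem₁ (x fzero) (y fzero) (V w (vtl y) a) (V w (vtl y) b)) }
  ; V-to = λ x c → cong (_+ V w (vtl x) c) (lem₂ (x fzero) (dl c a) (dl c b)) }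
  where
  neg : ∀ {n} → Vect (suc n) → Vect (suc n)
  neg x = vcons (- x fzero) (vtl x)
  neg-lin : ∀ {n} → Lin (neg {n})
  neg-lin = record
    { ext   = λ { e fzero → cong -_ (e fzero) ; e (fsuc i) → e (fsuc i) }
    ; add   = λ { x y fzero → ℤₚ.neg-distrib-+ (x fzero) (y fzero) ; _ _ (fsuc i) → refl }
    ; scale = λ { c x fzero → ℤₚ.neg-distribʳ-* c (x fzero) ; _ _ (fsuc i) → refl } }
  neg-neg : ∀ {n} (x : Vect (suc n)) → neg (neg x) ≗ᵥ x
  neg-neg x fzero    = ℤₚ.neg-involutive (x fzero)
  neg-neg x (fsuc i) = refl
  lem₁ : ∀ x y p q → x * y + x * (q - p) ≡ (- x) * (- y) + (- x) * (p - q)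
  lem₁ = solve-∀
  lem₂ : ∀ x p q → x * (q - p) ≡ (- x) * (p - q)
  lem₂ = solve-∀

realise-braid : ∀ x y w → Proper y → Realised (x ∷ y ∷ w) (y ∷ act y x ∷ w)
realise-braid x y w p = record
  { iso = record
    { to = fwd ; from = bwd ; to-lin = fwd-lin ; from-lin = bwd-lin
    ; to-from = λ { z fzero → refl ; z (fsuc fzero) → lem₁ k (z fzero) (z (fsuc fzero)) ; z (fsuc (fsuc i)) → refl }
    ; from-to = λ { z fzero → lem₂ k (z fzero) (z (fsuc fzero)) ; z (fsuc fzero) → refl ; z (fsuc (fsuc i)) → refl }
    ; isom = isom′ }
  ; V-to = λ z c → trans (cong (λ q → z fzero * ar y c + (z (fsuc fzero) * q + V w (vtl (vtl z)) c)) (ar-act y p x c))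
      (lem₃ (z fzero) (z (fsuc fzero)) k (ar y c) (ar x c) (V w (vtl (vtl z)) c)) }
  where
  k = br x (ar y)
  -- The new letter is x - k y, and z₀ y + z₁ (x - k y) = z₁ x + (z₀ - k z₁) y; these coefficients
  -- define `fwd`.
  fwd bwd : ∀ {n} → Vect (suc (suc n)) → Vect (suc (suc n))
  fwd z = vcons (z (fsuc fzero)) (vcons (z fzero - k * z (fsuc fzero)) (vtl (vtl z)))
  bwd z = vcons (z (fsuc fzero) + k * z fzero) (vcons (z fzero) (vtl (vtl z)))
  a₁ : ∀ k a b c d → (a + c) - k * (b + d) ≡ (a - k * b) + (c - k * d)
  a₁ = solve-∀
  a₂ : ∀ k c a b → c * a - k * (c * b) ≡ c * (a - k * b)
  a₂ = solve-∀
  a₃ : ∀ k a b c d → (a + c) + k * (b + d) ≡ (a + k * b) + (c + k * d)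
  a₃ = solve-∀
  a₄ : ∀ k c a b → c * a + k * (c * b) ≡ c * (a + k * b)
  a₄ = solve-∀
  fwd-lin : ∀ {n} → Lin (fwd {n})
  fwd-lin = record
    { ext   = λ { e fzero → e (fsuc fzero) ; e (fsuc fzero) → cong₂ (λ a b → a - k * b) (e fzero) (e (fsuc fzero)) ; e (fsuc (fsuc i)) → e (fsuc (fsuc i)) }
    ; add   = λ { x y fzero → refl ; x y (fsuc fzero) → a₁ k (x fzero) (x (fsuc fzero)) (y fzero) (y (fsuc fzero)) ; x y (fsuc (fsuc i)) → refl }
    ; scale = λ { c x fzero → refl ; c x (fsuc fzero) → a₂ k c (x fzero) (x (fsuc fzero)) ; c x (fsuc (fsuc i)) → refl } }
  bwd-lin : ∀ {n} → Lin (bwd {n})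
  bwd-lin = record
    { ext   = λ { e fzero → cong₂ (λ a b → a + k * b) (e (fsuc fzero)) (e fzero) ; e (fsuc fzero) → e fzero ; e (fsuc (fsuc i)) → e (fsuc (fsuc i)) }
    ; add   = λ { x y fzero → a₃ k (x (fsuc fzero)) (x fzero) (y (fsuc fzero)) (y fzero) ; x y (fsuc fzero) → refl ; x y (fsuc (fsuc i)) → refl }
    ; scale = λ { c x fzero → a₄ k c (x (fsuc fzero)) (x fzero) ; c x (fsuc fzero) → refl ; c x (fsuc (fsuc i)) → refl } }
  lem₁ : ∀ k a b → b + k * a - k * a ≡ b
  lem₁ = solve-∀
  lem₂ : ∀ k a b → a - k * b + k * b ≡ a
  lem₂ = solve-∀
  lem₃ : ∀ z₀ z₁ k p q v → z₀ * p + (z₁ * (q - k * p) + v) ≡ z₁ * q + ((z₀ - k * z₁) * p + v)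
  lem₃ = solve-∀
  lem₄ : ∀ z₀ z₁ u₀ u₁ k f g m →
    z₀ * u₀ + z₀ * (u₁ * (- k) + g) + (z₁ * u₁ + z₁ * (f - k * g) + m) ≡
    z₁ * u₁ + z₁ * ((u₀ - k * u₁) * k + f) + ((z₀ - k * z₁) * (u₀ - k * u₁) + (z₀ - k * z₁) * g + m)
  lem₄ = solve-∀
  lem₅ : ∀ k → k - k * (ℤ.+ 2) ≡ - k
  lem₅ = solve-∀
  br-V : ∀ v q (u : Vect (suc (length w))) → br v (V (q ∷ w) u) ≡ u fzero * br v (ar q) + br v (V w (vtl u))
  br-V (a , b) q u = lem (u fzero) (ar q a) (ar q b) (V w (vtl u) a) (V w (vtl u) b)
    where
    lem : ∀ u p q r s → (u * p + r) - (u * q + s) ≡ u * (p - q) + (r - s)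
    lem = solve-∀
  -- The reflection in y is an isometry that sends y to - y, so the entry above the diagonal changes
  -- sign.
  crossing : br y (ar (act y x)) ≡ - k
  crossing = begin
    br y (ar (act y x))                 ≡⟨ br-ar-sym y (act y x) ⟩
    br (act y x) (ar y)                 ≡⟨ br-act y p x (ar y) ⟩
    k - k * br y (ar y)                 ≡⟨ cong (λ z → k - k * z) (br-self y p) ⟩
    k - k * (ℤ.+ 2)                     ≡⟨ lem₅ k ⟩
    - k                                 ∎
  isom′ : ∀ z u → M (y ∷ act y x ∷ w) z u ≡ M (x ∷ y ∷ w) (fwd z) (fwd u)
  isom′ z u = begin
    z₀ * u₀ + z₀ * br y (V (act y x ∷ w) (vtl u)) + (z₁ * u₁ + z₁ * br (act y x) W + m)
      ≡⟨ cong₂ (λ p q → z₀ * u₀ + z₀ * p + (z₁ * u₁ + z₁ * q + m))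
           (trans (br-V y (act y x) (vtl u)) (cong (λ q → u₁ * q + br y W) crossing)) (br-act y p x W) ⟩
    z₀ * u₀ + z₀ * (u₁ * (- k) + br y W) + (z₁ * u₁ + z₁ * (br x W - k * br y W) + m)
      ≡⟨ lem₄ z₀ z₁ u₀ u₁ k (br x W) (br y W) m ⟩
    z₁ * u₁ + z₁ * ((u₀ - k * u₁) * k + br x W) + ((z₀ - k * z₁) * (u₀ - k * u₁) + (z₀ - k * z₁) * br y W + m)
      ≡⟨ cong (λ q → z₁ * u₁ + z₁ * q + ((z₀ - k * z₁) * (u₀ - k * u₁) + (z₀ - k * z₁) * br y W + m))
           (sym (br-V x y (vtl (fwd u)))) ⟩
    M (x ∷ y ∷ w) (fwd z) (fwd u) ∎
    where
    z₀ = z fzero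
    z₁ = z (fsuc fzero)
    u₀ = u fzero
    u₁ = u (fsuc fzero)
    W = V w (vtl (vtl u))
    m = M w (vtl (vtl z)) (vtl (vtl u))

realise : ∀ {w w′} → w ∼ w′ → Realised w w′
realise ∼refl = record { iso = ≅-refl (λ _ _ → refl) ; V-to = λ _ _ → refl }
realise (∼sym {w} {w′} p) = record
  { iso = ≅-sym (M-ext w) (iso r)
  ; V-to = λ x c → trans (V-ext w (λ i → sym (to-from (iso r) x i)) c) (sym (V-to r _ c)) }
  where r = realise p
realise (∼trans p q) = record
  { iso = ≅-trans (iso (realise p)) (iso (realise q))
  ; V-to = λ x c → trans (V-to (realise q) x c) (V-to (realise p) _ c) }
realise (∼cons v {w} {w′} p) = record
  { iso = record
    { to = lift (to i) ; from = lift (from i) ; to-lin = lift-lin (to-lin i) ; from-lin = lift-lin (from-lin i)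
    ; to-from = lift-inverse {T = to i} {from i} (to-from i) ; from-to = lift-inverse {T = from i} {to i} (from-to i)
    ; isom = λ x y → cong₂ _+_ (cong (λ z → x fzero * y fzero + x fzero * z) (br-cong v (V-to r (vtl y)))) (isom i (vtl x) (vtl y)) }
  ; V-to = λ x c → cong (x fzero * ar v c +_) (V-to r (vtl x) c) }
  where
  r = realise p
  i = iso r
realise (∼flip a b)    = realise-flip a b _
realise (∼braid x y p) = realise-braid x y _ p

∼⇒≅ : ∀ {w w′} → w ∼ w′ → M w ≅ M w′
∼⇒≅ p = iso (realise p)

-- Relabelling vertices

rename : (ℕ → ℕ) → Arrow → Arrow
rename f (a , b) = f a , f b

Ends : (ℕ → Set) → Arrow → Set
Ends P (a , b) = P a × P b

InjectiveOn : (ℕ → Set) → (ℕ → ℕ) → Set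
InjectiveOn P f = ∀ {a b} → P a → P b → f a ≡ f b → a ≡ b

dl-inj : ∀ {P f} → InjectiveOn P f → ∀ {a b} → P a → P b → dl (f a) (f b) ≡ dl a b
dl-inj {f = f} inj {a} {b} pa pb with a ℕ.≟ b
... | yes refl = trans (dl-refl (f a)) (sym (dl-refl a))
... | no  a≢b  = trans (dl-≢ (a≢b ∘ inj pa pb)) (sym (dl-≢ a≢b))

-- `M` is built from Kronecker symbols of ends, so a relabelling that is injective on the ends
-- preserves it. The predicate `P` confines the claim to these vertices because the relabelling used
-- later, `idx`, is not injective elsewhere.
record Renamed (P : ℕ → Set) (f : ℕ → ℕ) (w w′ : Word) : Set where
  field
    riso  : M w ≅ M w′
    rV-to : ∀ x {c} → P c → V w′ x (f c) ≡ V w (to riso x) c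
open Renamed

rename-≅ : ∀ {P f} → InjectiveOn P f → ∀ {w} → All (Ends P) w → Renamed P f w (map (rename f) w)
rename-≅ inj [] = record { riso = ≅-refl (λ _ _ → refl) ; rV-to = λ _ _ → refl }
rename-≅ {P} {f} inj {(a , b) ∷ w} ((pa , pb) ∷ ps) = record
  { riso = record
    { to = lift (to i) ; from = lift (from i) ; to-lin = lift-lin (to-lin i) ; from-lin = lift-lin (from-lin i)
    ; to-from = lift-inverse {T = to i} {from i} (to-from i) ; from-to = lift-inverse {T = from i} {to i} (from-to i)
    ; isom = λ x y → cong₂ _+_ (cong (λ z → x fzero * y fzero + x fzero * z) (cong₂ _-_ (rV-to r (vtl y) pa) (rV-to r (vtl y) pb))) (isom i (vtl x) (vtl y)) }
  ; rV-to = λ x {c} pc → cong₂ _+_ (cong (x fzero *_) (cong₂ _-_ (dl-inj inj pc pa) (dl-inj inj pc pb))) (rV-to r (vtl x) pc) }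
  where
  r = rename-≅ inj ps
  i = riso r

-- Words and triangular matrices

entry : ∀ {n} → (Fin n → Arrow) → Mat n n
entry f i j = if toℕ i ≡ᵇ toℕ j then 1ℤ else if toℕ i <ᵇ toℕ j then br (f i) (ar (f j)) else 0ℤ

-- `length (tabulate f)` is not definitionally `n`, so matrix and word are compared by an isometry;
-- `tV-to` has the same role in the induction as `V-to`.
record Tabulated {n} (f : Fin n → Arrow) : Set where
  field
    tiso  : β (entry f) ≅ M (tabulate f)
    tV-to : ∀ x c → V (tabulate f) x c ≡ ∑ (λ j → to tiso x j * ar (f j) c)
open Tabulated

tabulated : ∀ {n} (f : Fin n → Arrow) → Tabulated f
tabulated {zero} f = record { tiso = ≅-refl (λ _ _ → refl) ; tV-to = λ _ _ → refl }
tabulated {suc n} f = record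
  { tiso = record
    { to = lift (to i) ; from = lift (from i) ; to-lin = lift-lin (to-lin i) ; from-lin = lift-lin (from-lin i)
    ; to-from = lift-inverse {T = to i} {from i} (to-from i) ; from-to = lift-inverse {T = from i} {to i} (from-to i)
    ; isom = isom′ }
  ; tV-to = λ x c → cong (x fzero * ar (f fzero) c +_) (tV-to r (vtl x) c) }
  where
  g : Fin n → Arrow
  g = f ∘ fsuc
  r : Tabulated g
  r = tabulated g
  i = tiso r
  v = f fzero
  distrib : ∀ a p q → a * p - a * q ≡ a * (p - q)
  distrib = solve-∀
  br-V : ∀ v y → br v (V (tabulate g) y) ≡ ∑ (λ j → to i y j * br v (ar (g j)))
  br-V (a , b) y = trans (cong₂ _-_ (tV-to r y a) (tV-to r y b))
    (trans (sym (∑-- (λ j → to i y j * ar (g j) a) (λ j → to i y j * ar (g j) b)))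
           (∑-cong λ j → distrib (to i y j) (ar (g j) a) (ar (g j) b)))
  re : ∀ a b c → a * (b * c) ≡ a * c * b
  re = solve-∀
  isom′ : ∀ x y → M (tabulate f) x y ≡ β (entry f) (lift (to i) x) (lift (to i) y)
  isom′ x y = cong₂ _+_
    (cong₂ _+_ (cong (_* y fzero) (sym (ℤₚ.*-identityʳ (x fzero))))
      (trans (cong (x fzero *_) (br-V v (vtl y)))
        (trans (sym (∑-*ˡ (x fzero) (λ j → to i (vtl y) j * br v (ar (g j)))))
          (∑-cong λ j → re (x fzero) (to i (vtl y) j) (br v (ar (g j)))))))
    (trans (isom i (vtl x) (vtl y))
      (∑-cong λ k → sym (trans (cong (_+ ∑ (λ j → X k * entry g k j * Y j)) (zeroed (X k) (y fzero))) (ℤₚ.+-identityˡ _))))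
    where
    X = to i (vtl x)
    Y = to i (vtl y)
    zeroed : ∀ a b → a * 0ℤ * b ≡ 0ℤ
    zeroed = solve-∀

β-cong : ∀ {n} {C D : Mat n n} → (∀ i j → C i j ≡ D i j) → β C ≅ β D
β-cong e = ≅-refl λ x y → ∑-cong λ i → ∑-cong λ j → cong (λ z → x i * z * y j) (e i j)

entry⇒≅ : ∀ {n} {C : Mat n n} (f : Fin n → Arrow) → (∀ i j → C i j ≡ entry f i j) → β C ≅ M (tabulate f)
entry⇒≅ f e = ≅-trans (β-cong e) (tiso (tabulated f))

-- Incidence matrices and quiver forms

Vertex : ℕ → ℕ → Set
Vertex m a = Σ (Fin m) λ v → a ≡ suc (toℕ v)

-- Labels start from 1 in quivers and in the words that realise a form, but from 0 in the canonical
-- words, whose root is 0.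
Vertex₀ : ℕ → ℕ → Set
Vertex₀ m a = Σ (Fin m) λ v → a ≡ toℕ v

∑-ar₀ : ∀ {m} x → Ends (Vertex₀ m) x → ∀ (h : ℕ → ℤ) → ∑ {m} (λ v → ar x (toℕ v) * h (toℕ v)) ≡ br x h
∑-ar₀ (_ , _) ((a , refl) , (b , refl)) h = begin
  ∑ (λ v → (δ v a - δ v b) * H v)          ≡⟨ (∑-cong λ v → lem (δ v a) (δ v b) (H v)) ⟩
  ∑ (λ v → H v * δ v a - H v * δ v b)      ≡⟨ ∑-- (λ v → H v * δ v a) (λ v → H v * δ v b) ⟩
  ∑ (λ v → H v * δ v a) - ∑ (λ v → H v * δ v b) ≡⟨ cong₂ _-_ (∑-δʳ a H) (∑-δʳ b H) ⟩
  H a - H b ∎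
  where
  H = λ v → h (toℕ v)
  lem : ∀ p q r → (p - q) * r ≡ r * p - r * q
  lem = solve-∀

∑-ar : ∀ {m} x → Ends (Vertex m) x → ∀ (h : ℕ → ℤ) → ∑ {m} (λ v → ar x (suc (toℕ v)) * h (suc (toℕ v))) ≡ br x h
∑-ar (_ , _) ((a , refl) , (b , refl)) h = ∑-ar₀ (toℕ a , toℕ b) ((a , refl) , (b , refl)) (h ∘ suc)

·ᵥ-𝐞 : ∀ {a b} (B : Mat a b) i k → (B ·ᵥ 𝐞 i) k ≡ B k i
·ᵥ-𝐞 B i k = trans (∑-cong λ l → cong (B k l *_) (dl-sym (toℕ i) (toℕ l))) (∑-δʳ i (B k))

norm² : ∀ {m} → Vect m → ℤ
norm² y = ∑ (λ v → y v * y v)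

norm²-cong : ∀ {m} {x y : Vect m} → x ≗ᵥ y → norm² x ≡ norm² y
norm²-cong e = ∑-cong λ v → cong₂ _*_ (e v) (e v)

norm²-+ : ∀ {m} (x y : Vect m) → norm² (x +ᵥ y) ≡ norm² x + norm² y + (ℤ.+ 2) * ∑ (λ v → x v * y v)
norm²-+ x y = begin
  ∑ (λ v → (x v + y v) * (x v + y v))   ≡⟨ (∑-cong λ v → lem (x v) (y v)) ⟩
  ∑ (λ v → x v * x v + y v * y v + (ℤ.+ 2) * (x v * y v))   ≡⟨ ∑-+ (λ v → x v * x v + y v * y v) (λ v → (ℤ.+ 2) * (x v * y v)) ⟩
  ∑ (λ v → x v * x v + y v * y v) + ∑ (λ v → (ℤ.+ 2) * (x v * y v))
    ≡⟨ cong₂ _+_ (∑-+ (λ v → x v * x v) (λ v → y v * y v)) (∑-*ˡ (ℤ.+ 2) (λ v → x v * y v)) ⟩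
  norm² x + norm² y + (ℤ.+ 2) * ∑ (λ v → x v * y v) ∎
  where
  lem : ∀ a b → (a + b) * (a + b) ≡ a * a + b * b + (ℤ.+ 2) * (a * b)
  lem = solve-∀

-- `_/ℕ_` divides with remainder; of the two possible remainders, 1 would be a difference of two
-- even integers.
double/2 : ∀ z → ((ℤ.+ 2) * z) /ℕ 2 ≡ z
double/2 z = go (((ℤ.+ 2) * z) %ℕ 2) (n%ℕd<d ((ℤ.+ 2) * z) 2) (a≡a%ℕn+[a/ℕn]*n ((ℤ.+ 2) * z) 2)
  where
  q = ((ℤ.+ 2) * z) /ℕ 2
  odd : ∀ a → (ℤ.+ 2) * a ≢ 1ℤ
  odd a e = contradiction (ℕₚ.m*n≡1⇒m≡1 2 ℤ.∣ a ∣ (trans (sym (ℤₚ.abs-* (ℤ.+ 2) a)) (cong ℤ.∣_∣ e))) λ ()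
  lem : ∀ z q → (ℤ.+ 2) * (z - q) ≡ (ℤ.+ 2) * z - q * (ℤ.+ 2)
  lem = solve-∀
  lem′ : ∀ q → (1ℤ + q * (ℤ.+ 2)) - q * (ℤ.+ 2) ≡ 1ℤ
  lem′ = solve-∀
  go : ∀ r → r ℕ.< 2 → (ℤ.+ 2) * z ≡ ℤ.+ r + q * (ℤ.+ 2) → q ≡ z
  go 0 _ e = ℤₚ.*-cancelʳ-≡ q z (ℤ.+ 2) (trans (sym (ℤₚ.+-identityˡ _)) (trans (sym e) (ℤₚ.*-comm (ℤ.+ 2) z)))
  go 1 _ e = ⊥-elim (odd (z - q) (trans (lem z q) (trans (cong (_- q * (ℤ.+ 2)) e) (lem′ q))))
  go (suc (suc r)) (ℕ.s≤s (ℕ.s≤s ())) _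

module QuiverEntries {m n} (s t : ℕ → ℕ)
  (ends : ∀ (i : Fin n) → Ends (Vertex m) (s (toℕ i) , t (toℕ i)))
  (noloop : ∀ (i : Fin n) → Proper (s (toℕ i) , t (toℕ i))) where

  arrows : Fin n → Arrow
  arrows i = s (toℕ i) , t (toℕ i)

  q : Vect n → ℤ
  q = quiverForm m n s t

  I : Mat m n
  I = incidence m n s t

  norm-column : ∀ i → norm² (I ·ᵥ 𝐞 i) ≡ ℤ.+ 2
  norm-column i = trans (norm²-cong (·ᵥ-𝐞 I i)) (trans (∑-ar (arrows i) (ends i) (ar (arrows i))) (br-self (arrows i) (noloop i)))

  quiver-unit : ∀ i → q (𝐞 i) ≡ 1ℤ
  quiver-unit i = cong (_/ℕ 2) (norm-column i)

  -- The polarization of half the squared norm is the inner product of the columns: with k this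
  -- product, (2 + 2 + 2k) / 2 - 1 - 1 = k.
  quiver-pair : ∀ i j → q (𝐞 i +ᵥ 𝐞 j) - q (𝐞 i) - q (𝐞 j) ≡ br (arrows i) (ar (arrows j))
  quiver-pair i j = trans (cong₂ _-_ (cong₂ _-_ sum-val (quiver-unit i)) (quiver-unit j)) (lem₂ k)
    where
    k = br (arrows i) (ar (arrows j))
    lem₁ : ∀ k → (ℤ.+ 2) + (ℤ.+ 2) + (ℤ.+ 2) * k ≡ (ℤ.+ 2) * ((ℤ.+ 2) + k)
    lem₁ = solve-∀
    lem₂ : ∀ k → ((ℤ.+ 2) + k) - 1ℤ - 1ℤ ≡ k
    lem₂ = solve-∀
    dot : ∑ (λ v → (I ·ᵥ 𝐞 i) v * (I ·ᵥ 𝐞 j) v) ≡ k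
    dot = trans (∑-cong λ v → cong₂ _*_ (·ᵥ-𝐞 I i v) (·ᵥ-𝐞 I j v)) (∑-ar (arrows i) (ends i) (ar (arrows j)))
    sum-val : q (𝐞 i +ᵥ 𝐞 j) ≡ (ℤ.+ 2) + k
    sum-val = trans (cong (_/ℕ 2) (begin
      norm² (I ·ᵥ (𝐞 i +ᵥ 𝐞 j))                ≡⟨ norm²-cong (add (·ᵥ-lin I) (𝐞 i) (𝐞 j)) ⟩
      norm² ((I ·ᵥ 𝐞 i) +ᵥ (I ·ᵥ 𝐞 j))         ≡⟨ norm²-+ (I ·ᵥ 𝐞 i) (I ·ᵥ 𝐞 j) ⟩
      norm² (I ·ᵥ 𝐞 i) + norm² (I ·ᵥ 𝐞 j) + (ℤ.+ 2) * ∑ (λ v → (I ·ᵥ 𝐞 i) v * (I ·ᵥ 𝐞 j) v)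
        ≡⟨ cong₂ (λ p r → p + (ℤ.+ 2) * r) (cong₂ _+_ (norm-column i) (norm-column j)) dot ⟩
      (ℤ.+ 2) + (ℤ.+ 2) + (ℤ.+ 2) * k          ≡⟨ lem₁ k ⟩
      (ℤ.+ 2) * ((ℤ.+ 2) + k)                  ∎)) (double/2 ((ℤ.+ 2) + k))

  quiver-entry : ∀ i j → ǦOf q i j ≡ entry arrows i j
  quiver-entry i j with toℕ i ≡ᵇ toℕ j | toℕ i <ᵇ toℕ j
  ... | true  | _     = quiver-unit i
  ... | false | true  = quiver-pair i j
  ... | false | false = refl

-- Forms of type A_r as words of arrows

hd : ∀ {r} → Vect r → ℤ
hd {zero}  y = 0ℤ
hd {suc r} y = y fzero

-- diff 0 embeds ℤʳ, with the form of A_r, as the sum-zero vectors of ℤʳ⁺¹; the first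
-- argument is the entry that precedes the vector.
diff : ∀ {r} → ℤ → Vect r → Vect (suc r)
diff {zero}  c y _        = 0ℤ - c
diff {suc r} c y fzero    = y fzero - c
diff {suc r} c y (fsuc i) = diff (y fzero) (vtl y) i

qA-suc : ∀ r (y : Vect (suc r)) → eval (qA (suc r)) y ≡ y fzero * y fzero - y fzero * hd (vtl y) + eval (qA r) (vtl y)
qA-suc r y = cong₂ _+_ (cong₂ _+_ (lem₁ (y fzero)) (row r y))
    (∑-cong λ i → trans (cong (_+ ∑ (λ j → y (fsuc i) * Ǧ (qA r) i j * y (fsuc j))) (lem₂ (y (fsuc i)) (y fzero))) (ℤₚ.+-identityˡ _))
  where
  lem₁ : ∀ a → a * 1ℤ * a ≡ a * a
  lem₁ = solve-∀
  lem₂ : ∀ a b → a * 0ℤ * b ≡ 0ℤ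
  lem₂ = solve-∀
  lem₃ : ∀ a b → a * (- 1ℤ) * b + 0ℤ ≡ - (a * b)
  lem₃ = solve-∀
  row : ∀ r (y : Vect (suc r)) → ∑ (λ j → y fzero * Ǧ (qA (suc r)) fzero (fsuc j) * y (fsuc j)) ≡ - (y fzero * hd (vtl y))
  row zero    y = sym (cong -_ (ℤₚ.*-zeroʳ (y fzero)))
  row (suc r) y = trans (cong (λ z → y fzero * (- 1ℤ) * y (fsuc fzero) + z) (∑-zero {f = λ j → y fzero * 0ℤ * y (fsuc (fsuc j))} λ j → lem₂ (y fzero) (y (fsuc (fsuc j)))))
    (lem₃ (y fzero) (y (fsuc fzero)))

-- The preceding entry `c` is kept general because the induction passes from c followed by y to y₀
-- followed by the tail. At c = 0 only twice the form of A_r remains.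
norm²-diff : ∀ {r} c (y : Vect r) → norm² (diff c y) ≡ c * c - (ℤ.+ 2) * (c * hd y) + (ℤ.+ 2) * eval (qA r) y
norm²-diff {zero} c y = lem c
  where
  lem : ∀ c → (0ℤ - c) * (0ℤ - c) + 0ℤ ≡ c * c - (ℤ.+ 2) * (c * 0ℤ) + (ℤ.+ 2) * 0ℤ
  lem = solve-∀
norm²-diff {suc r} c y = trans (cong ((y fzero - c) * (y fzero - c) +_) (norm²-diff (y fzero) (vtl y)))
  (trans (lem c (y fzero) (hd (vtl y)) (eval (qA r) (vtl y)))
         (cong (λ z → c * c - (ℤ.+ 2) * (c * y fzero) + (ℤ.+ 2) * z) (sym (qA-suc r y))))
  where
  lem : ∀ c y h e → (y - c) * (y - c) + (y * y - (ℤ.+ 2) * (y * h) + (ℤ.+ 2) * e) ≡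
                    c * c - (ℤ.+ 2) * (c * y) + (ℤ.+ 2) * (y * y - y * h + e)
  lem = solve-∀

norm²-diff₀ : ∀ {r} (y : Vect r) → norm² (diff 0ℤ y) ≡ (ℤ.+ 2) * eval (qA r) y
norm²-diff₀ {r} y = trans (norm²-diff 0ℤ y) (lem (hd y) (eval (qA r) y))
  where
  lem : ∀ h e → 0ℤ * 0ℤ - (ℤ.+ 2) * (0ℤ * h) + (ℤ.+ 2) * e ≡ (ℤ.+ 2) * e
  lem = solve-∀

-- Summation by parts. A constant χ gives the sum-zero property of difference vectors, a general χ
-- the connectedness of the realising quiver.
∑-diff : ∀ {r} (χ : ℕ → ℤ) c (y : Vect r) →
  ∑ (λ v → χ (toℕ v) * diff c y v) ≡ ∑ (λ k → y k * (χ (toℕ k) - χ (suc (toℕ k)))) - c * χ 0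
∑-diff {zero} χ c y = lem (χ 0) c
  where
  lem : ∀ a c → a * (0ℤ - c) + 0ℤ ≡ 0ℤ - c * a
  lem = solve-∀
∑-diff {suc r} χ c y = trans (cong (χ 0 * (y fzero - c) +_) (∑-diff (χ ∘ suc) (y fzero) (vtl y)))
  (lem (χ 0) (χ 1) (y fzero) c (∑ (λ k → y (fsuc k) * (χ (suc (toℕ k)) - χ (suc (suc (toℕ k)))))))
  where
  lem : ∀ a b y c s → a * (y - c) + (s - y * b) ≡ y * (a - b) + s - c * a
  lem = solve-∀

diff-ext : ∀ {r} {c d} {x y : Vect r} → c ≡ d → x ≗ᵥ y → diff c x ≗ᵥ diff d y
diff-ext {zero}  e h i        = cong (λ z → 0ℤ - z) e
diff-ext {suc r} e h fzero    = cong₂ _-_ (h fzero) e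
diff-ext {suc r} e h (fsuc i) = diff-ext (h fzero) (h ∘ fsuc) i

diff-add : ∀ {r} c d (x y : Vect r) → diff (c + d) (x +ᵥ y) ≗ᵥ (diff c x +ᵥ diff d y)
diff-add {zero}  c d x y i        = lem c d
  where
  lem : ∀ c d → 0ℤ - (c + d) ≡ (0ℤ - c) + (0ℤ - d)
  lem = solve-∀
diff-add {suc r} c d x y fzero    = lem (x fzero) (y fzero) c d
  where
  lem : ∀ a b c d → (a + b) - (c + d) ≡ (a - c) + (b - d)
  lem = solve-∀
diff-add {suc r} c d x y (fsuc i) = diff-add (x fzero) (y fzero) (vtl x) (vtl y) i

diff-scale : ∀ {r} k c (x : Vect r) → diff (k * c) (k ·ˢ x) ≗ᵥ (k ·ˢ diff c x)
diff-scale {zero} k c x i = lem k c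
  where
  lem : ∀ k c → 0ℤ - k * c ≡ k * (0ℤ - c)
  lem = solve-∀
diff-scale {suc r} k c x fzero = lem k (x fzero) c
  where
  lem : ∀ k x c → k * x - k * c ≡ k * (x - c)
  lem = solve-∀
diff-scale {suc r} k c x (fsuc i) = diff-scale k (x fzero) (vtl x) i

diff-lin : ∀ {r} → Lin (diff {r} 0ℤ)
diff-lin = record
  { ext   = diff-ext refl
  ; add   = diff-add 0ℤ 0ℤ
  ; scale = λ c x i → trans (diff-ext (sym (ℤₚ.*-zeroʳ c)) (λ _ → refl) i) (diff-scale c 0ℤ x i) }

-- The norm recast in ℕ, so that small values are settled by pattern matching on the entries.
nsq : ∀ {m} → Vect m → ℕ
nsq {zero}  u = 0
nsq {suc m} u = ℤ.∣ u fzero ∣ ℕ.* ℤ.∣ u fzero ∣ ℕ.+ nsq (vtl u)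

nsq-norm² : ∀ {m} (u : Vect m) → norm² u ≡ ℤ.+ nsq u
nsq-norm² {zero}  u = refl
nsq-norm² {suc m} u = cong₂ _+_ (square (u fzero)) (nsq-norm² (vtl u))
  where
  square : ∀ z → z * z ≡ ℤ.+ (ℤ.∣ z ∣ ℕ.* ℤ.∣ z ∣)
  square (ℤ.+ n)  = sym (ℤₚ.pos-* n n)
  square -[1+ n ] = refl

square-large : ∀ k s {t} → t ℕ.< 4 → suc (suc k) ℕ.* suc (suc k) ℕ.+ s ≢ t
square-large k s t<4 e = ℕₚ.<⇒≱ t<4 (subst (4 ℕ.≤_) e
  (ℕₚ.≤-trans (ℕₚ.*-mono-≤ {2} {suc (suc k)} {2} {suc (suc k)} (ℕ.s≤s (ℕ.s≤s ℕ.z≤n)) (ℕ.s≤s (ℕ.s≤s ℕ.z≤n))) (ℕₚ.m≤m+n _ s)))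

Sign± : ℤ → Set
Sign± s = s ≡ 1ℤ ⊎ s ≡ - 1ℤ

nsq-0 : ∀ {m} (u : Vect m) → nsq u ≡ 0 → ∀ v → u v ≡ 0ℤ
nsq-0 {suc m} u e fzero    = ℤₚ.∣i∣≡0⇒i≡0 (reduce (ℕₚ.m*n≡0⇒m≡0∨n≡0 ℤ.∣ u fzero ∣ (ℕₚ.m+n≡0⇒m≡0 _ e)))
nsq-0 {suc m} u e (fsuc v) = nsq-0 (vtl u) (ℕₚ.m+n≡0⇒n≡0 (ℤ.∣ u fzero ∣ ℕ.* ℤ.∣ u fzero ∣) e) v

nsq-1 : ∀ {m} (u : Vect m) → nsq u ≡ 1 → Σ (Fin m) λ a → Σ ℤ λ s → Sign± s × (∀ v → u v ≡ s * δ v a)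
nsq-1 {suc m} u e with u fzero in eq
... | ℤ.+ 0 = let a , s , ± , h = nsq-1 (vtl u) e in
  fsuc a , s , ± , λ { fzero → trans eq (sym (ℤₚ.*-zeroʳ s)) ; (fsuc v) → h v }
... | ℤ.+ 1 = fzero , 1ℤ , inj₁ refl , λ { fzero → eq ; (fsuc v) → nsq-0 (vtl u) (ℕₚ.suc-injective e) v }
... | ℤ.+ (suc (suc k)) = ⊥-elim (square-large k (nsq (vtl u)) (ℕ.s≤s (ℕ.s≤s ℕ.z≤n)) e)
... | -[1+ 0 ] = fzero , - 1ℤ , inj₂ refl , λ { fzero → eq ; (fsuc v) → nsq-0 (vtl u) (ℕₚ.suc-injective e) v }
... | -[1+ suc k ] = ⊥-elim (square-large k (nsq (vtl u)) (ℕ.s≤s (ℕ.s≤s ℕ.z≤n)) e)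

-- An entry of absolute value at least 2 already contributes 4, so 2 has to come from two entries ±1
-- in different places.
nsq-2 : ∀ {m} (u : Vect m) → nsq u ≡ 2 → Σ (Fin m) λ a → Σ (Fin m) λ b → Σ ℤ λ s → Σ ℤ λ t →
  toℕ a ≢ toℕ b × Sign± s × Sign± t × (∀ v → u v ≡ s * δ v a + t * δ v b)
nsq-2 {suc m} u e with u fzero in eq
... | ℤ.+ 0 = let a , b , s , t , ne , p , q , h = nsq-2 (vtl u) e in
  fsuc a , fsuc b , s , t , (λ z → ne (ℕₚ.suc-injective z)) , p , q ,
  λ { fzero → trans eq (sym (cong₂ _+_ (ℤₚ.*-zeroʳ s) (ℤₚ.*-zeroʳ t))) ; (fsuc v) → h v }
... | ℤ.+ (suc (suc k)) = ⊥-elim (square-large k (nsq (vtl u)) (ℕ.s≤s (ℕ.s≤s (ℕ.s≤s ℕ.z≤n))) e)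
... | -[1+ suc k ] = ⊥-elim (square-large k (nsq (vtl u)) (ℕ.s≤s (ℕ.s≤s (ℕ.s≤s ℕ.z≤n))) e)
... | ℤ.+ 1 = let b , t , q , h = nsq-1 (vtl u) (ℕₚ.suc-injective e) in
  fzero , fsuc b , 1ℤ , t , (λ ()) , inj₁ refl , q ,
  λ { fzero → trans eq (sym (cong (λ z → 1ℤ * 1ℤ + z) (ℤₚ.*-zeroʳ t))) ; (fsuc v) → trans (h v) (sym (ℤₚ.+-identityˡ _)) }
... | -[1+ 0 ] = let b , t , q , h = nsq-1 (vtl u) (ℕₚ.suc-injective e) in
  fzero , fsuc b , - 1ℤ , t , (λ ()) , inj₂ refl , q ,
  λ { fzero → trans eq (sym (cong (λ z → (- 1ℤ) * 1ℤ + z) (ℤₚ.*-zeroʳ t))) ; (fsuc v) → trans (h v) (sym (ℤₚ.+-identityˡ _)) }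

-- Norm 2 gives ±e_a ± e_b, and the vanishing sum forces opposite signs.
root⇒arrow : ∀ {m} (u : Vect m) → norm² u ≡ ℤ.+ 2 → ∑ u ≡ 0ℤ →
  Σ Arrow λ x → Ends (Vertex m) x × Proper x × (∀ v → u v ≡ ar x (suc (toℕ v)))
root⇒arrow {m} u n2 s0 with nsq-2 u (ℤₚ.+-injective (trans (sym (nsq-norm² u)) n2))
... | a , b , s , t , a≢b , p , q , h = go p q
  where
  s+t : s + t ≡ 0ℤ
  s+t = begin
    s + t                                               ≡⟨ sym (cong₂ _+_ (trans (cong (s *_) (∑-ones a)) (ℤₚ.*-identityʳ s)) (trans (cong (t *_) (∑-ones b)) (ℤₚ.*-identityʳ t))) ⟩
    s * ∑ (λ v → δ v a) + t * ∑ (λ v → δ v b)           ≡⟨ sym (cong₂ _+_ (∑-*ˡ s (λ v → δ v a)) (∑-*ˡ t (λ v → δ v b))) ⟩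
    ∑ (λ v → s * δ v a) + ∑ (λ v → t * δ v b)           ≡⟨ sym (∑-+ (λ v → s * δ v a) (λ v → t * δ v b)) ⟩
    ∑ (λ v → s * δ v a + t * δ v b)                     ≡⟨ sym (∑-cong h) ⟩
    ∑ u                                                 ≡⟨ s0 ⟩
    0ℤ                                                  ∎
  lem₁ : ∀ x y → 1ℤ * x + (- 1ℤ) * y ≡ x - y
  lem₁ = solve-∀
  lem₂ : ∀ x y → (- 1ℤ) * x + 1ℤ * y ≡ y - x
  lem₂ = solve-∀
  go : Sign± s → Sign± t → Σ Arrow λ x → Ends (Vertex m) x × Proper x × (∀ v → u v ≡ ar x (suc (toℕ v)))
  go (inj₁ refl) (inj₂ refl) = (suc (toℕ a) , suc (toℕ b)) , ((a , refl) , (b , refl)) , (λ e → a≢b (ℕₚ.suc-injective e)) , λ v → trans (h v) (lem₁ (δ v a) (δ v b))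
  go (inj₂ refl) (inj₁ refl) = (suc (toℕ b) , suc (toℕ a)) , ((b , refl) , (a , refl)) , (λ e → a≢b (ℕₚ.suc-injective (sym e))) , λ v → trans (h v) (lem₂ (δ v a) (δ v b))
  go (inj₁ refl) (inj₁ refl) = contradiction s+t λ ()
  go (inj₂ refl) (inj₂ refl) = contradiction s+t λ ()

-- Connectedness is stated through functions constant along arrows rather than through walks. In
-- this form it passes through Hurwitz moves letter by letter and is tested on indicators of vertex
-- sets.
Connected : ℕ → Word → Set
Connected m w = ∀ (χ : ℕ → ℤ) → All (λ (a , b) → χ a ≡ χ b) w → ∀ {a b} → Vertex m a → Vertex m b → χ a ≡ χ b

record Realisation {n} (C : Mat n n) (m : ℕ) : Set where
  field
    arrow   : Fin n → Arrow
    ends    : ∀ i → Ends (Vertex m) (arrow i)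
    proper  : ∀ i → Proper (arrow i)
    entries : ∀ i j → Ǧ C i j ≡ entry arrow i j
    conn    : Connected m (tabulate arrow)

entry-unique : ∀ {n} {G : Mat n n} (f : Fin n → Arrow) → (∀ i → G i i ≡ 1ℤ) →
  (∀ i j → (toℕ i <ᵇ toℕ j) ≡ true → G i j ≡ br (f i) (ar (f j))) →
  (∀ i j → (toℕ j <ᵇ toℕ i) ≡ true → G i j ≡ 0ℤ) → ∀ i j → G i j ≡ entry f i j
entry-unique f diagonal upper lower i j with toℕ i ≡ᵇ toℕ j in e₁ | toℕ i <ᵇ toℕ j in e₂
... | true  | _ with Finₚ.toℕ-injective (ℕₚ.≡ᵇ⇒≡ (toℕ i) (toℕ j) (subst T (sym e₁) _))
...   | refl = diagonal i
entry-unique f diagonal upper lower i j | false | true  = upper i j e₂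
entry-unique f diagonal upper lower i j | false | false = lower i j (<ᵇ-total (toℕ i) (toℕ j) e₁ e₂)
  where
  <ᵇ-total : ∀ a b → (a ≡ᵇ b) ≡ false → (a <ᵇ b) ≡ false → (b <ᵇ a) ≡ true
  <ᵇ-total (suc a) zero    e f = refl
  <ᵇ-total (suc a) (suc b) e f = <ᵇ-total a b e f

+-cancelˡ : ∀ a b c → a + b ≡ a + c → b ≡ c
+-cancelˡ a b c e = trans (sym (lem a b)) (trans (cong (λ z → z - a) e) (lem a c))
  where
  lem : ∀ a b → a + b - a ≡ b
  lem = solve-∀

-- The map `D` satisfies ‖D x‖² = 2 q(x). Basis vectors therefore go to roots, and polarization
-- recovers the entries off the diagonal.
realisation : ∀ {n} (C : Mat n n) r → IsUnitForm C → HasDynkinTypeA C r → Realisation C (suc r)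
realisation {n} C r unit (P , surj , _ , _ , evalP) = record
  { arrow = arrow ; ends = λ i → proj₁ (proj₂ (root i)) ; proper = λ i → proj₁ (proj₂ (proj₂ (root i)))
  ; entries = entries ; conn = conn }
  where
  D : Vect n → Vect (suc r)
  D x = diff 0ℤ (P ·ᵥ x)
  D-lin : Lin D
  D-lin = ∘-lin diff-lin (·ᵥ-lin P)
  normD : ∀ x → norm² (D x) ≡ (ℤ.+ 2) * eval C x
  normD x = trans (norm²-diff₀ (P ·ᵥ x)) (cong ((ℤ.+ 2) *_) (sym (evalP x)))
  sumD : ∀ x → ∑ (D x) ≡ 0ℤ
  sumD x = begin
    ∑ (D x)                     ≡⟨ (∑-cong λ v → sym (ℤₚ.*-identityˡ (D x v))) ⟩
    ∑ (λ v → 1ℤ * D x v)        ≡⟨ ∑-diff (λ _ → 1ℤ) 0ℤ (P ·ᵥ x) ⟩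
    ∑ (λ k → (P ·ᵥ x) k * 0ℤ) - 0ℤ ≡⟨ cong (_- 0ℤ) (∑-zero {f = λ k → (P ·ᵥ x) k * 0ℤ} λ k → ℤₚ.*-zeroʳ ((P ·ᵥ x) k)) ⟩
    0ℤ                          ∎
  root : ∀ i → Σ Arrow λ x → Ends (Vertex (suc r)) x × Proper x × (∀ v → D (𝐞 i) v ≡ ar x (suc (toℕ v)))
  root i = root⇒arrow (D (𝐞 i)) (trans (normD (𝐞 i)) (cong ((ℤ.+ 2) *_) (unit i))) (sumD (𝐞 i))
  arrow : Fin n → Arrow
  arrow i = proj₁ (root i)
  D-𝐞 : ∀ i v → D (𝐞 i) v ≡ ar (arrow i) (suc (toℕ v))
  D-𝐞 i = proj₂ (proj₂ (proj₂ (root i)))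
  G = Ǧ C
  diagonal : ∀ i → G i i ≡ 1ℤ
  diagonal i = trans (sym (β-𝐞 G i i)) (unit i)
  dot : ∀ i j → ∑ (λ v → D (𝐞 i) v * D (𝐞 j) v) ≡ br (arrow i) (ar (arrow j))
  dot i j = trans (∑-cong λ v → cong₂ _*_ (D-𝐞 i v) (D-𝐞 j v)) (∑-ar (arrow i) (proj₁ (proj₂ (root i))) (ar (arrow j)))
  -- The norm of D (e_i + e_j) is expanded in two ways; the diagonal terms cancel, then the factor
  -- 2.
  polar : ∀ i j → G i j + G j i ≡ br (arrow i) (ar (arrow j))
  polar i j = ℤₚ.*-cancelˡ-≡ (ℤ.+ 2) (G i j + G j i) (br (arrow i) (ar (arrow j))) (+-cancelˡ ((ℤ.+ 2) * 1ℤ + (ℤ.+ 2) * 1ℤ) ((ℤ.+ 2) * (G i j + G j i)) ((ℤ.+ 2) * br (arrow i) (ar (arrow j))) (begin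
    (ℤ.+ 2) * 1ℤ + (ℤ.+ 2) * 1ℤ + (ℤ.+ 2) * (G i j + G j i)   ≡⟨ lem (G i j) (G j i) ⟩
    (ℤ.+ 2) * (1ℤ + G i j + (G j i + 1ℤ))                      ≡⟨ cong ((ℤ.+ 2) *_) (sym expand) ⟩
    (ℤ.+ 2) * eval C (𝐞 i +ᵥ 𝐞 j)                              ≡⟨ sym (normD (𝐞 i +ᵥ 𝐞 j)) ⟩
    norm² (D (𝐞 i +ᵥ 𝐞 j))                                     ≡⟨ norm²-cong (add D-lin (𝐞 i) (𝐞 j)) ⟩
    norm² (D (𝐞 i) +ᵥ D (𝐞 j))                                 ≡⟨ norm²-+ (D (𝐞 i)) (D (𝐞 j)) ⟩
    norm² (D (𝐞 i)) + norm² (D (𝐞 j)) + (ℤ.+ 2) * ∑ (λ v → D (𝐞 i) v * D (𝐞 j) v)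
      ≡⟨ cong₂ (λ p q → p + (ℤ.+ 2) * q) (cong₂ _+_ (trans (normD (𝐞 i)) (cong ((ℤ.+ 2) *_) (unit i))) (trans (normD (𝐞 j)) (cong ((ℤ.+ 2) *_) (unit j)))) (dot i j) ⟩
    (ℤ.+ 2) * 1ℤ + (ℤ.+ 2) * 1ℤ + (ℤ.+ 2) * br (arrow i) (ar (arrow j)) ∎))
    where
    lem : ∀ p q → (ℤ.+ 2) * 1ℤ + (ℤ.+ 2) * 1ℤ + (ℤ.+ 2) * (p + q) ≡ (ℤ.+ 2) * (1ℤ + p + (q + 1ℤ))
    lem = solve-∀
    bil : Bilin (β G)
    bil = β-bilin G
    expand : eval C (𝐞 i +ᵥ 𝐞 j) ≡ 1ℤ + G i j + (G j i + 1ℤ)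
    expand = begin
      β G (𝐞 i +ᵥ 𝐞 j) (𝐞 i +ᵥ 𝐞 j)                         ≡⟨ Bilin.addˡ bil (𝐞 i) (𝐞 j) (𝐞 i +ᵥ 𝐞 j) ⟩
      β G (𝐞 i) (𝐞 i +ᵥ 𝐞 j) + β G (𝐞 j) (𝐞 i +ᵥ 𝐞 j)       ≡⟨ cong₂ _+_ (Bilin.addʳ bil (𝐞 i) (𝐞 i) (𝐞 j)) (Bilin.addʳ bil (𝐞 j) (𝐞 i) (𝐞 j)) ⟩
      (β G (𝐞 i) (𝐞 i) + β G (𝐞 i) (𝐞 j)) + (β G (𝐞 j) (𝐞 i) + β G (𝐞 j) (𝐞 j))
        ≡⟨ cong₂ _+_ (cong₂ _+_ (unit i) (β-𝐞 G i j)) (cong₂ _+_ (β-𝐞 G j i) (unit j)) ⟩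
      1ℤ + G i j + (G j i + 1ℤ) ∎
  lower : ∀ i j → (toℕ j <ᵇ toℕ i) ≡ true → G i j ≡ 0ℤ
  lower i j e rewrite e = refl
  entries : ∀ i j → G i j ≡ entry arrow i j
  entries = entry-unique arrow diagonal
    (λ i j e → trans (sym (trans (cong (G i j +_) (lower j i e)) (ℤₚ.+-identityʳ _))) (polar i j)) lower
  -- A function constant along the arrows is orthogonal to every D x. As P is surjective, P x can be
  -- any e_k, and summation by parts turns orthogonality into equality at consecutive vertices.
  conn : Connected (suc r) (tabulate arrow)
  conn χ const {a} {b} (a′ , refl) (b′ , refl) = trans (all a′) (sym (all b′))
    where
    X : ℕ → ℤ
    X = χ ∘ suc
    kills : ∀ i → ∑ (λ v → X (toℕ v) * D (𝐞 i) v) ≡ 0ℤ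
    kills i = trans (∑-cong λ v → trans (ℤₚ.*-comm (X (toℕ v)) (D (𝐞 i) v)) (cong (_* X (toℕ v)) (D-𝐞 i v)))
      (trans (∑-ar (arrow i) (proj₁ (proj₂ (root i))) χ) (ℤₚ.i≡j⇒i-j≡0 {χ (proj₁ (arrow i))} {χ (proj₂ (arrow i))} (Allₚ.tabulate⁻ const i)))
    pairing-lin : Lin {n} {1} (λ x _ → ∑ (λ v → X (toℕ v) * D x v))
    pairing-lin = record
      { ext = λ e _ → ∑-cong λ v → cong (X (toℕ v) *_) (ext D-lin e v)
      ; add = λ x y _ → trans (∑-cong λ v → trans (cong (X (toℕ v) *_) (add D-lin x y v)) (ℤₚ.*-distribˡ-+ (X (toℕ v)) (D x v) (D y v)))
          (∑-+ (λ v → X (toℕ v) * D x v) (λ v → X (toℕ v) * D y v))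
      ; scale = λ c x _ → trans (∑-cong λ v → trans (cong (X (toℕ v) *_) (scale D-lin c x v)) (comm (X (toℕ v)) c (D x v)))
          (∑-*ˡ c (λ v → X (toℕ v) * D x v)) }
      where
      comm : ∀ a b c → a * (b * c) ≡ b * (a * c)
      comm = solve-∀
    kills-all : ∀ x → ∑ (λ v → X (toℕ v) * D x v) ≡ 0ℤ
    kills-all x = trans (lin-expand pairing-lin x fzero) (∑-zero λ i → trans (cong (x i *_) (kills i)) (ℤₚ.*-zeroʳ (x i)))
    step : ∀ (k : Fin r) → X (toℕ k) ≡ X (suc (toℕ k))
    step k = let x , e = surj (𝐞 k) in ℤₚ.i-j≡0⇒i≡j _ _ (begin
      X (toℕ k) - X (suc (toℕ k))                                          ≡⟨ sym (∑-δˡ k (λ k → X (toℕ k) - X (suc (toℕ k)))) ⟩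
      ∑ (λ l → δ k l * (X (toℕ l) - X (suc (toℕ l))))                      ≡⟨ (∑-cong λ l → cong (_* (X (toℕ l) - X (suc (toℕ l)))) (sym (e l))) ⟩
      ∑ (λ l → (P ·ᵥ x) l * (X (toℕ l) - X (suc (toℕ l))))                 ≡⟨ sym (ℤₚ.+-identityʳ _) ⟩
      ∑ (λ l → (P ·ᵥ x) l * (X (toℕ l) - X (suc (toℕ l)))) - 0ℤ * X 0      ≡⟨ sym (∑-diff X 0ℤ (P ·ᵥ x)) ⟩
      ∑ (λ v → X (toℕ v) * D x v)                                          ≡⟨ kills-all x ⟩
      0ℤ ∎)
    chain : ∀ {r} (X : ℕ → ℤ) → (∀ (k : Fin r) → X (toℕ k) ≡ X (suc (toℕ k))) → ∀ (v : Fin (suc r)) → X (toℕ v) ≡ X 0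
    chain X s fzero = refl
    chain {suc r} X s (fsuc v) = trans (chain (X ∘ suc) (s ∘ fsuc) v) (sym (s fzero))
    all : ∀ v → X (toℕ v) ≡ X 0
    all = chain X step

-- The normal form of a star word

infixr 2 _∼⟨_⟩_ _≡∼⟨_⟩_
infix  3 _∎∼

_∼⟨_⟩_ : ∀ w {w′ w″} → w ∼ w′ → w′ ∼ w″ → w ∼ w″
_ ∼⟨ p ⟩ q = ∼trans p q

_≡∼⟨_⟩_ : ∀ w {w′ w″} → w ≡ w′ → w′ ∼ w″ → w ∼ w″
_ ≡∼⟨ refl ⟩ q = q

_∎∼ : ∀ w → w ∼ w
w ∎∼ = ∼refl

∼-++ˡ : ∀ v {w w′} → w ∼ w′ → v ++ w ∼ v ++ w′
∼-++ˡ []      p = p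
∼-++ˡ (x ∷ v) p = ∼cons x (∼-++ˡ v p)

∼-braid : ∀ x y {x′ w} → Proper y → act y x ≡ x′ → x ∷ y ∷ w ∼ y ∷ x′ ∷ w
∼-braid x y p refl = ∼braid x y p

act* : Word → Arrow → Arrow
act* []      x = x
act* (y ∷ v) x = act* v (act y x)

-- A letter moving right is conjugated by the word it crosses; a letter moving left, as in `moveˡ`,
-- stays the same and conjugates the word.
moveʳ : ∀ x v {x′} u → All Proper v → act* v x ≡ x′ → x ∷ v ++ u ∼ v ++ x′ ∷ u
moveʳ x []      u []       refl = ∼refl
moveʳ x (y ∷ v) u (p ∷ ps) e    = ∼trans (∼braid x y p) (∼cons y (moveʳ (act y x) v u ps e))

moveˡ : ∀ v x {v′} u → Proper x → map (act x) v ≡ v′ → v ++ x ∷ u ∼ x ∷ v′ ++ u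
moveˡ []      x u p refl = ∼refl
moveˡ (y ∷ v) x u p refl = ∼trans (∼cons y (moveˡ v x u p refl)) (∼braid y x p)

map-act-invol : ∀ x v → map (act x) (map (act x) v) ≡ v
map-act-invol x []      = refl
map-act-invol x (y ∷ v) = cong₂ _∷_ (act-invol x y) (map-act-invol x v)

-- Whatever crosses two equal letters is conjugated twice by the same transposition, hence not at
-- all.
pair-comm : ∀ t v u → Proper t → v ++ t ∷ t ∷ u ∼ t ∷ t ∷ v ++ u
pair-comm t v u p = ∼trans (moveˡ v t (t ∷ u) p refl) (∼cons t (moveˡ (map (act t) v) t u p (map-act-invol t v)))

-- The pair crosses y unchanged by `pair-comm` and returns one letter at a time by the other kind of
-- crossing, in which each letter is conjugated by y.
pair-conj : ∀ t y u → Proper t → Proper y → y ∷ t ∷ t ∷ u ∼ y ∷ act y t ∷ act y t ∷ u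
pair-conj t y u p q =
  y ∷ t ∷ t ∷ u                  ∼⟨ pair-comm t [ y ] u p ⟩
  t ∷ t ∷ y ∷ u                  ∼⟨ ∼cons t (∼braid t y q) ⟩
  t ∷ y ∷ act y t ∷ u            ∼⟨ ∼braid t y q ⟩
  y ∷ act y t ∷ act y t ∷ u      ∎∼

-- Both implications are proved together because of `∼sym`. The inverse braid needs no further
-- closure property, `act y` being an involution.
∼-All : ∀ {Q : Arrow → Set} → (∀ {a b} → Q (a , b) → Q (b , a)) → (∀ {x y} → Q y → Q x → Q (act y x)) →
  ∀ {w w′} → w ∼ w′ → (All Q w → All Q w′) × (All Q w′ → All Q w)
∼-All f g ∼refl = id , id
∼-All f g (∼sym p) = let a , b = ∼-All f g p in b , a
∼-All f g (∼trans p q) = let a , b = ∼-All f g p ; c , d = ∼-All f g q in c ∘ a , b ∘ d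
∼-All f g (∼cons v p) = let a , b = ∼-All f g p in (λ { (x ∷ xs) → x ∷ a xs }) , λ { (x ∷ xs) → x ∷ b xs }
∼-All f g (∼flip a b) = (λ { (x ∷ xs) → f x ∷ xs }) , λ { (x ∷ xs) → f x ∷ xs }
∼-All {Q} f g (∼braid x y p) = (λ { (qx ∷ qy ∷ qs) → qy ∷ g qy qx ∷ qs }) ,
  λ { (qy ∷ qx ∷ qs) → subst Q (act-invol y x) (g qy qx) ∷ qy ∷ qs }

τ-resp : ∀ {P : ℕ → Set} {c d} a → P c → P d → P a → P (τ c d a)
τ-resp {c = c} {d} a pc pd pa with a ℕ.≟ c
... | yes _ = pd
... | no  _ with a ℕ.≟ d
...   | yes _ = pc
...   | no  _ = pa

act-proper : ∀ y {x} → Proper x → Proper (act y x)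
act-proper (c , d) {a , b} p e = p (trans (sym (τ-invol c d a)) (trans (cong (τ c d) e) (τ-invol c d b)))

∼-Ends : ∀ {P w w′} → w ∼ w′ → All (Ends P) w → All (Ends P) w′
∼-Ends {P} p = proj₁ (∼-All (λ (a , b) → b , a) (λ { {a , b} (pc , pd) (pa , pb) → τ-resp {P} a pc pd pa , τ-resp {P} b pc pd pb }) p)

∼-Proper : ∀ {w w′} → w ∼ w′ → All Proper w → All Proper w′
∼-Proper p = proj₁ (∼-All (λ n e → n (sym e)) (λ {x} {y} _ q → act-proper y q) p)

Constant : (ℕ → ℤ) → Arrow → Set
Constant χ (a , b) = χ a ≡ χ b

∼-Constant : ∀ χ {w w′} → w ∼ w′ → All (Constant χ) w′ → All (Constant χ) w
∼-Constant χ p = proj₂ (∼-All sym (λ { {a , b} {c , d} e f → trans (τ-const e a) (trans f (sym (τ-const e b))) }) p)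
  where
  τ-const : ∀ {c d} → χ c ≡ χ d → ∀ a → χ (τ c d a) ≡ χ a
  τ-const {c} {d} e a with a ℕ.≟ c
  ... | yes refl = sym e
  ... | no  _ with a ℕ.≟ d
  ...   | yes refl = e
  ...   | no  _ = refl

∼-Connected : ∀ {m w w′} → w ∼ w′ → Connected m w → Connected m w′
∼-Connected p c χ h = c χ (∼-Constant χ p h)

-- Star letters and blocks

Fresh : ℕ → List ℕ → Set
Fresh a = All (a ≢_)

stars : ℕ → List ℕ → Word
stars ρ = map (ρ ,_)

stars-++ : ∀ ρ X Y u → stars ρ (X ++ Y) ++ u ≡ stars ρ X ++ stars ρ Y ++ u
stars-++ ρ X Y u = trans (cong (_++ u) (Lₚ.map-++ (ρ ,_) X Y)) (Lₚ.++-assoc (stars ρ X) (stars ρ Y) u)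

stars-proper : ∀ {ρ X} → Fresh ρ X → All Proper (stars ρ X)
stars-proper []       = []
stars-proper (p ∷ ps) = p ∷ stars-proper ps

act*-fresh : ∀ {ρ Y a b} → a ≢ ρ → b ≢ ρ → Fresh a Y → Fresh b Y → act* (stars ρ Y) (a , b) ≡ (a , b)
act*-fresh {Y = []}    a b []       []       = refl
act*-fresh {Y = y ∷ Y} a b (p ∷ ps) (q ∷ qs) = trans (cong (act* (stars _ Y)) (cong₂ _,_ (τ-o a p) (τ-o b q))) (act*-fresh a b ps qs)

-- The word of a block (y , Y) is (ρ y) Y (ρ y): its product is a cycle on y ∷ Y that fixes ρ.
Block : Set
Block = ℕ × List ℕ

block : ℕ → Block → Word → Word
block ρ (y , Y) u = (ρ , y) ∷ stars ρ Y ++ (ρ , y) ∷ u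

block-cong : ∀ ρ B {u u′} → u ∼ u′ → block ρ B u ∼ block ρ B u′
block-cong ρ (y , Y) p = ∼cons _ (∼-++ˡ (stars ρ Y) (∼cons _ p))

blocks : ℕ → List Block → Word → Word
blocks ρ []       u = u
blocks ρ (B ∷ Bs) u = block ρ B (blocks ρ Bs u)

-- The product of a block fixes ρ and z. Accordingly (ρ z) turns into (y z) on crossing the opening
-- (ρ y), is untouched by the letters of Y, and is restored by the closing (ρ y).
letter-block : ∀ {ρ z y Y} u → Unique (ρ ∷ y ∷ Y) → Fresh z (ρ ∷ y ∷ Y) →
  (ρ , z) ∷ block ρ (y , Y) u ∼ block ρ (y , Y) ((ρ , z) ∷ u)
letter-block {ρ} {z} {y} {Y} u ((ρ≢y ∷ ρ≢Y) ∷ (y≢Y ∷ _)) (z≢ρ ∷ z≢y ∷ z≢Y) =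
  (ρ , z) ∷ (ρ , y) ∷ stars ρ Y ++ (ρ , y) ∷ u
    ∼⟨ ∼-braid (ρ , z) (ρ , y) ρ≢y (cong₂ _,_ (τ-l ρ y) (τ-o z≢ρ z≢y)) ⟩
  (ρ , y) ∷ (y , z) ∷ stars ρ Y ++ (ρ , y) ∷ u
    ∼⟨ ∼cons _ (moveʳ (y , z) (stars ρ Y) ((ρ , y) ∷ u) (stars-proper ρ≢Y) (act*-fresh (ρ≢y ∘ sym) z≢ρ y≢Y z≢Y)) ⟩
  (ρ , y) ∷ stars ρ Y ++ (y , z) ∷ (ρ , y) ∷ u
    ∼⟨ ∼cons _ (∼-++ˡ (stars ρ Y) (∼-braid (y , z) (ρ , y) ρ≢y (cong₂ _,_ (τ-r ρ y) (τ-o z≢ρ z≢y)))) ⟩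
  (ρ , y) ∷ stars ρ Y ++ (ρ , y) ∷ (ρ , z) ∷ u ∎∼

letters-block : ∀ {ρ y Y} Z u → Unique (ρ ∷ y ∷ Y) → All (λ z → Fresh z (ρ ∷ y ∷ Y)) Z →
  stars ρ Z ++ block ρ (y , Y) u ∼ block ρ (y , Y) (stars ρ Z ++ u)
letters-block []      u un []       = ∼refl
letters-block (z ∷ Z) u un (p ∷ ps) = ∼trans (∼cons _ (letters-block Z u un ps)) (letter-block _ un p)

block-block : ∀ {ρ z Z y Y} u → Unique (ρ ∷ y ∷ Y) → All (λ z → Fresh z (ρ ∷ y ∷ Y)) (z ∷ Z) →
  block ρ (z , Z) (block ρ (y , Y) u) ∼ block ρ (y , Y) (block ρ (z , Z) u)
block-block {ρ} {z} {Z} {y} {Y} u un (f ∷ fs) =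
  ∼trans (∼cons _ (∼-++ˡ (stars ρ Z) (letter-block u un f)))
  (∼trans (∼cons _ (letters-block Z _ un fs)) (letter-block _ un f))

pair-block : ∀ ρ t B u → Proper t → t ∷ t ∷ block ρ B u ∼ block ρ B (t ∷ t ∷ u)
pair-block ρ t (y , Y) u p =
  t ∷ t ∷ (ρ , y) ∷ stars ρ Y ++ (ρ , y) ∷ u   ∼⟨ ∼sym (pair-comm t [ ρ , y ] (stars ρ Y ++ (ρ , y) ∷ u) p) ⟩
  (ρ , y) ∷ t ∷ t ∷ stars ρ Y ++ (ρ , y) ∷ u   ∼⟨ ∼cons _ (∼sym (pair-comm t (stars ρ Y) ((ρ , y) ∷ u) p)) ⟩
  (ρ , y) ∷ stars ρ Y ++ t ∷ t ∷ (ρ , y) ∷ u   ∼⟨ ∼cons _ (∼-++ˡ (stars ρ Y) (∼sym (pair-comm t [ ρ , y ] u p))) ⟩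
  (ρ , y) ∷ stars ρ Y ++ (ρ , y) ∷ t ∷ t ∷ u   ∎∼

pair-blocks : ∀ ρ t Bs u → Proper t → t ∷ t ∷ blocks ρ Bs u ∼ blocks ρ Bs (t ∷ t ∷ u)
pair-blocks ρ t []       u p = ∼refl
pair-blocks ρ t (B ∷ Bs) u p = ∼trans (pair-block ρ t B _ p) (block-cong ρ B (pair-blocks ρ t Bs u p))

-- The same cycle may be written from y or from x. The opening letter becomes (x y) on crossing (ρ
-- x), crosses Y unchanged, and on crossing the closing (ρ y) turns into the new closing letter (ρ
-- x).
rotate : ∀ {ρ y x Y} u → Unique (ρ ∷ y ∷ x ∷ Y) → block ρ (y , x ∷ Y) u ∼ block ρ (x , Y ++ [ y ]) u
rotate {ρ} {y} {x} {Y} u ((ρ≢y ∷ ρ≢x ∷ ρ≢Y) ∷ (y≢x ∷ y≢Y) ∷ (x≢Y ∷ _)) =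
  (ρ , y) ∷ (ρ , x) ∷ stars ρ Y ++ (ρ , y) ∷ u
    ∼⟨ ∼-braid (ρ , y) (ρ , x) ρ≢x (cong₂ _,_ (τ-l ρ x) (τ-o (ρ≢y ∘ sym) y≢x)) ⟩
  (ρ , x) ∷ (x , y) ∷ stars ρ Y ++ (ρ , y) ∷ u
    ∼⟨ ∼cons _ (moveʳ (x , y) (stars ρ Y) ((ρ , y) ∷ u) (stars-proper ρ≢Y) (act*-fresh (ρ≢x ∘ sym) (ρ≢y ∘ sym) x≢Y y≢Y)) ⟩
  (ρ , x) ∷ stars ρ Y ++ (x , y) ∷ (ρ , y) ∷ u
    ∼⟨ ∼cons _ (∼-++ˡ (stars ρ Y) (∼trans (∼-braid (x , y) (ρ , y) ρ≢y (cong₂ _,_ (τ-o (ρ≢x ∘ sym) (y≢x ∘ sym)) (τ-r ρ y)))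
         (∼cons _ (∼flip x ρ)))) ⟩
  (ρ , x) ∷ stars ρ Y ++ (ρ , y) ∷ (ρ , x) ∷ u
    ≡∼⟨ cong ((ρ , x) ∷_) (sym (stars-++ ρ Y [ y ] ((ρ , x) ∷ u))) ⟩
  block ρ (x , Y ++ [ y ]) u ∎∼

Unique-↭ : ∀ {xs ys : List ℕ} → xs ↭ ys → Unique xs → Unique ys
Unique-↭ p = ↭Setoidₚ.Unique-resp-↭ (setoid ℕ) (↭⇒↭ₛ p)

Unique-++⁻ : ∀ (xs : List ℕ) {ys} → Unique (xs ++ ys) → Unique xs × Unique ys × All (λ x → Fresh x ys) xs
Unique-++⁻ []       u       = [] , u , []
Unique-++⁻ (x ∷ xs) (p ∷ u) = let a , b , c = Unique-++⁻ xs u in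
  (Allₚ.++⁻ˡ xs p ∷ a) , b , (Allₚ.++⁻ʳ xs p ∷ c)

rotate-to : ∀ {ρ} Y₁ {y x Y₂} → Unique (ρ ∷ y ∷ Y₁ ++ x ∷ Y₂) →
  Σ (List ℕ) λ Y → (∀ u → block ρ (y , Y₁ ++ x ∷ Y₂) u ∼ block ρ (x , Y) u) × (y ∷ Y₁ ++ x ∷ Y₂ ↭ x ∷ Y)
rotate-to [] {y} {x} {Y₂} un = Y₂ ++ [ y ] , (λ u → rotate u un) , ↭ₚ.++-comm [ y ] (x ∷ Y₂)
rotate-to {ρ} (y₁ ∷ Y₁) {y} {x} {Y₂} un =
  let Y , e , p = rotate-to Y₁ {y₁} {x} {Y₂ ++ [ y ]} (Unique-↭ (↭prep ρ cyc) un) in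
  Y , (λ u → ∼trans (rotate u un) (∼trans (≡∼ u) (e u))) , ↭-trans cyc p
  where
  assoc : (Y₁ ++ x ∷ Y₂) ++ [ y ] ≡ Y₁ ++ x ∷ Y₂ ++ [ y ]
  assoc = Lₚ.++-assoc Y₁ (x ∷ Y₂) [ y ]
  cyc : y ∷ y₁ ∷ Y₁ ++ x ∷ Y₂ ↭ y₁ ∷ Y₁ ++ x ∷ Y₂ ++ [ y ]
  cyc = subst (λ Z → y ∷ y₁ ∷ Y₁ ++ x ∷ Y₂ ↭ y₁ ∷ Z) assoc (↭ₚ.++-comm [ y ] (y₁ ∷ Y₁ ++ x ∷ Y₂))
  ≡∼ : ∀ u → block ρ (y₁ , (Y₁ ++ x ∷ Y₂) ++ [ y ]) u ∼ block ρ (y₁ , Y₁ ++ x ∷ Y₂ ++ [ y ]) u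
  ≡∼ u = subst (λ Z → block ρ (y₁ , (Y₁ ++ x ∷ Y₂) ++ [ y ]) u ∼ block ρ (y₁ , Z) u) assoc ∼refl

lets : List Block → List ℕ
lets []             = []
lets ((y , Y) ∷ Bs) = (y ∷ Y) ++ lets Bs

-- Prepares the merge in `insert`: the block containing x is rotated until it opens at x, and is
-- brought to the front because blocks commute.
pull-block : ∀ {ρ} Bs {x} → Unique (ρ ∷ lets Bs) → x ∈ lets Bs →
  Σ (List ℕ) λ Y → Σ (List Block) λ Bs′ → (∀ u → blocks ρ Bs u ∼ block ρ (x , Y) (blocks ρ Bs′ u)) × (lets Bs ↭ (x ∷ Y) ++ lets Bs′)
pull-block {ρ} ((y , Y) ∷ Bs) {x} (fρ ∷ un) x∈ with Memₚ.∈-++⁻ (y ∷ Y) x∈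
... | inj₁ (here refl) = Y , Bs , (λ u → ∼refl) , ↭-refl
... | inj₁ (there x∈Y) with Memₚ.∈-∃++ x∈Y
...   | Y₁ , Y₂ , refl =
  let Y′ , e , p = rotate-to Y₁ (Allₚ.++⁻ˡ (y ∷ Y) fρ ∷ proj₁ (Unique-++⁻ (y ∷ Y) un)) in
  Y′ , Bs , (λ u → e (blocks ρ Bs u)) , ↭ₚ.++⁺ʳ (lets Bs) p
pull-block {ρ} ((y , Y) ∷ Bs) {x} (fρ ∷ un) x∈ | inj₂ x∈Bs =
  let uY , uBs , fr = Unique-++⁻ (y ∷ Y) un
      Y′ , Bs′ , e , p = pull-block Bs (Allₚ.++⁻ʳ (y ∷ Y) fρ ∷ uBs) x∈Bs
      un′ = Unique-↭ p uBs
      fρ′ = ↭ₚ.All-resp-↭ p (Allₚ.++⁻ʳ (y ∷ Y) fρ)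
  in
  Y′ , (y , Y) ∷ Bs′ ,
  (λ u → ∼trans (block-cong ρ (y , Y) (e u))
     (block-block (blocks ρ Bs′ u) (Allₚ.++⁻ˡ (x ∷ Y′) fρ′ ∷ proj₁ (Unique-++⁻ (x ∷ Y′) un′))
       (zipFresh (Allₚ.++⁻ˡ (y ∷ Y) fρ) (All.map (λ f → Allₚ.++⁻ˡ (x ∷ Y′) (↭ₚ.All-resp-↭ p f)) fr)))) ,
  ↭-trans (↭ₚ.++⁺ˡ (y ∷ Y) p) (↭ₚ.shifts (y ∷ Y) (x ∷ Y′))
  where
  zipFresh : ∀ {Z W} → Fresh ρ Z → All (λ z → Fresh z W) Z → All (λ z → Fresh z (ρ ∷ W)) Z
  zipFresh []       []       = []
  zipFresh (p ∷ ps) (q ∷ qs) = ((p ∘ sym) ∷ q) ∷ zipFresh ps qs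

dbl : List Arrow → Word
dbl []      = []
dbl (t ∷ D) = t ∷ t ∷ dbl D

nf : ℕ → List ℕ → List Block → List Arrow → Word
nf ρ A Bs D = stars ρ A ++ blocks ρ Bs (dbl D)

-- Where a doubled arrow sits among the vertices is left open at this stage; `pair-any` moves it
-- later.
Good : List ℕ → Arrow → Set
Good L t = Proper t × Ends (_∈ L) t

Good-mono : ∀ {L L′} → (∀ {x} → x ∈ L → x ∈ L′) → ∀ {D} → All (Good L) D → All (Good L′) D
Good-mono f = All.map λ (p , a , b) → p , f a , f b

record NormalForm (w : Word) : Set where
  constructor mkNF
  field
    ρ    : ℕ
    A    : List ℕ
    Bs   : List Block
    D    : List Arrow
    eqv  : w ∼ nf ρ A Bs D
    uniq : Unique (ρ ∷ A ++ lets Bs)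
    good : All (Good (ρ ∷ A ++ lets Bs)) D
open NormalForm

-- The transposition (ρ x) acts on the cycle of ρ in one of three ways. If x lies on it, A = A₁ x A₂
-- and (ρ x) A₁ (ρ x) is a block, so the cycle splits. If x is new, the cycle grows. If x lies in a
-- block, the two cycles merge.
insert : ∀ {w} x (N : NormalForm w) → ρ N ≢ x → Σ (NormalForm ((ρ N , x) ∷ w)) λ N′ → ρ N′ ≡ ρ N
insert {w} x (mkNF ρ A Bs D e (fρ ∷ un) g) ρ≢x with x ∈? A
... | yes x∈A with Memₚ.∈-∃++ x∈A
...   | A₁ , A₂ , refl = mkNF ρ A₂ ((x , A₁) ∷ Bs) D
    (_ ∼⟨ ∼cons _ e ⟩
     _ ≡∼⟨ cong ((ρ , x) ∷_) (stars-++ ρ A₁ (x ∷ A₂) (blocks ρ Bs (dbl D))) ⟩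
     block ρ (x , A₁) (stars ρ A₂ ++ blocks ρ Bs (dbl D))
       ∼⟨ ∼sym (letters-block A₂ (blocks ρ Bs (dbl D)) un₁ fresh₂) ⟩
     nf ρ A₂ ((x , A₁) ∷ Bs) D ∎∼)
    (Unique-↭ perm (fρ ∷ un)) (Good-mono (↭ₚ.∈-resp-↭ perm) g) , refl
  where
  perm : ρ ∷ (A₁ ++ x ∷ A₂) ++ lets Bs ↭ ρ ∷ A₂ ++ (x ∷ A₁) ++ lets Bs
  perm = ↭prep ρ (↭-trans (↭ₚ.++⁺ʳ (lets Bs) (↭-trans (↭ₚ.shift x A₁ A₂) (↭ₚ.++-comm (x ∷ A₁) A₂)))
     (subst (λ Z → (A₂ ++ x ∷ A₁) ++ lets Bs ↭ Z) (Lₚ.++-assoc A₂ (x ∷ A₁) (lets Bs)) ↭-refl))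
  un′ : Unique (A₂ ++ (ρ ∷ x ∷ A₁) ++ lets Bs)
  un′ = Unique-↭ (↭-sym (↭ₚ.shift ρ A₂ ((x ∷ A₁) ++ lets Bs))) (Unique-↭ perm (fρ ∷ un))
  rest : Unique ((ρ ∷ x ∷ A₁) ++ lets Bs) × All (λ z → Fresh z ((ρ ∷ x ∷ A₁) ++ lets Bs)) A₂
  rest = proj₂ (Unique-++⁻ A₂ un′)
  un₁ : Unique (ρ ∷ x ∷ A₁)
  un₁ = proj₁ (Unique-++⁻ (ρ ∷ x ∷ A₁) (proj₁ rest))
  fresh₂ : All (λ z → Fresh z (ρ ∷ x ∷ A₁)) A₂
  fresh₂ = All.map (Allₚ.++⁻ˡ (ρ ∷ x ∷ A₁)) (proj₂ rest)
insert {w} x (mkNF ρ A Bs D e (fρ ∷ un) g) ρ≢x | no x∉A with x ∈? lets Bs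
... | no x∉Bs = mkNF ρ (x ∷ A) Bs D (∼cons _ e)
  ((ρ≢x ∷ fρ) ∷ (Allₚ.¬Any⇒All¬ _ (λ i → x∉ (Memₚ.∈-++⁻ A i)) ∷ un))
  (Good-mono (λ { (here e) → here e ; (there i) → there (there i) }) g) , refl
  where
  x∉ : x ∈ A ⊎ x ∈ lets Bs → ⊥
  x∉ (inj₁ i) = x∉A i
  x∉ (inj₂ i) = x∉Bs i
-- Once A has crossed the block opening at x, the opening letter stands next to the new one and
-- forms the doubled arrow with it; the closing letter joins Y and A into one cycle.
... | yes x∈Bs = mkNF ρ (Y ++ x ∷ A) Bs′ ((ρ , x) ∷ D)
    (_ ∼⟨ ∼cons _ e ⟩
     (ρ , x) ∷ stars ρ A ++ blocks ρ Bs (dbl D)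
       ∼⟨ ∼cons _ (∼-++ˡ (stars ρ A) (moved (dbl D))) ⟩
     (ρ , x) ∷ stars ρ A ++ block ρ (x , Y) (blocks ρ Bs′ (dbl D))
       ∼⟨ ∼cons _ (letters-block A _ un₁ fresh₂) ⟩
     (ρ , x) ∷ (ρ , x) ∷ stars ρ Y ++ stars ρ (x ∷ A) ++ blocks ρ Bs′ (dbl D)
       ≡∼⟨ cong (λ v → (ρ , x) ∷ (ρ , x) ∷ v) (sym (stars-++ ρ Y (x ∷ A) _)) ⟩
     (ρ , x) ∷ (ρ , x) ∷ stars ρ (Y ++ x ∷ A) ++ blocks ρ Bs′ (dbl D)
       ∼⟨ ∼sym (pair-comm (ρ , x) (stars ρ (Y ++ x ∷ A)) (blocks ρ Bs′ (dbl D)) ρ≢x) ⟩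
     stars ρ (Y ++ x ∷ A) ++ (ρ , x) ∷ (ρ , x) ∷ blocks ρ Bs′ (dbl D)
       ∼⟨ ∼-++ˡ (stars ρ (Y ++ x ∷ A)) (pair-blocks ρ (ρ , x) Bs′ (dbl D) ρ≢x) ⟩
     nf ρ (Y ++ x ∷ A) Bs′ ((ρ , x) ∷ D) ∎∼)
    (Unique-↭ perm (fρ ∷ un))
    ((ρ≢x , here refl , ↭ₚ.∈-resp-↭ perm (there (Memₚ.∈-++⁺ʳ A x∈Bs))) ∷ Good-mono (↭ₚ.∈-resp-↭ perm) g) , refl
  where
  pulled = pull-block Bs (Allₚ.++⁻ʳ A fρ ∷ proj₁ (proj₂ (Unique-++⁻ A un))) x∈Bs
  Y = proj₁ pulled
  Bs′ = proj₁ (proj₂ pulled)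
  moved = proj₁ (proj₂ (proj₂ pulled))
  perm₀ : A ++ lets Bs ↭ A ++ (x ∷ Y) ++ lets Bs′
  perm₀ = ↭ₚ.++⁺ˡ A (proj₂ (proj₂ (proj₂ pulled)))
  un₀ : Unique (ρ ∷ A ++ (x ∷ Y) ++ lets Bs′)
  un₀ = Unique-↭ (↭prep ρ perm₀) (fρ ∷ un)
  perm : ρ ∷ A ++ lets Bs ↭ ρ ∷ (Y ++ x ∷ A) ++ lets Bs′
  perm = ↭prep ρ (↭-trans perm₀ (subst (λ Z → Z ↭ (Y ++ x ∷ A) ++ lets Bs′) (Lₚ.++-assoc A (x ∷ Y) (lets Bs′))
    (↭ₚ.++⁺ʳ (lets Bs′) (↭-trans (↭ₚ.++-comm A (x ∷ Y)) (↭-sym (↭ₚ.shift x Y A))))))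
  un′ : Unique (A ++ (ρ ∷ x ∷ Y) ++ lets Bs′)
  un′ = Unique-↭ (↭-sym (↭ₚ.shift ρ A ((x ∷ Y) ++ lets Bs′))) un₀
  rest : Unique ((ρ ∷ x ∷ Y) ++ lets Bs′) × All (λ z → Fresh z ((ρ ∷ x ∷ Y) ++ lets Bs′)) A
  rest = proj₂ (Unique-++⁻ A un′)
  un₁ : Unique (ρ ∷ x ∷ Y)
  un₁ = proj₁ (Unique-++⁻ (ρ ∷ x ∷ Y) (proj₁ rest))
  fresh₂ : All (λ z → Fresh z (ρ ∷ x ∷ Y)) A
  fresh₂ = All.map (Allₚ.++⁻ˡ (ρ ∷ x ∷ Y)) (proj₂ rest)

normalise : ∀ ρ X → Fresh ρ X → Σ (NormalForm (stars ρ X)) λ N → NormalForm.ρ N ≡ ρ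
normalise ρ []      []       = mkNF ρ [] [] [] ∼refl ([] ∷ []) [] , refl
normalise ρ (x ∷ X) (p ∷ ps) with normalise ρ X ps
... | N , refl = insert x N p

-- Gathering all arrows at a root

absorb : ∀ {ρ} S {a b} r → Fresh ρ S → a ≢ b → a ∈ ρ ∷ S → Σ (List ℕ) λ S′ → Fresh ρ S′ × (stars ρ S ++ (a , b) ∷ r ∼ stars ρ S′ ++ r)
absorb {ρ} S {a} {b} r f a≢b (here refl) = S ++ [ b ] , Allₚ.++⁺ f (a≢b ∷ []) ,
  (_ ≡∼⟨ sym (stars-++ ρ S [ b ] r) ⟩ _ ∎∼)
absorb {ρ} S {a} {b} r f a≢b (there a∈S) with b ℕ.≟ ρ
... | yes refl = S ++ [ a ] , Allₚ.++⁺ f ((a≢b ∘ sym) ∷ []) ,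
  ∼trans (∼-++ˡ (stars ρ S) (∼flip a b)) (_ ≡∼⟨ sym (stars-++ ρ S [ a ] r) ⟩ _ ∎∼)
... | no b≢ρ with Memₚ.∈-∃++ a∈S
-- The arrow (a , b) moves left across S₂, conjugating it, until it meets (ρ , a); and (ρ a)(a b) is
-- what the braid move makes of (ρ b)(ρ a).
...   | S₁ , S₂ , refl = S₁ ++ b ∷ a ∷ map (τ a b) S₂ ,
    Allₚ.++⁺ (Allₚ.++⁻ˡ S₁ f) ((b≢ρ ∘ sym) ∷ ρ≢a ∷ Allₚ.map⁺ (All.map (λ {s} p → τ-resp {ρ ≢_} s ρ≢a (b≢ρ ∘ sym) p) f₂)) ,
    (_ ≡∼⟨ stars-++ ρ S₁ (a ∷ S₂) ((a , b) ∷ r) ⟩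
     stars ρ S₁ ++ (ρ , a) ∷ stars ρ S₂ ++ (a , b) ∷ r
       ∼⟨ ∼-++ˡ (stars ρ S₁) (∼cons _ (moveˡ (stars ρ S₂) (a , b) r a≢b (conj S₂))) ⟩
     stars ρ S₁ ++ (ρ , a) ∷ (a , b) ∷ stars ρ (map (τ a b) S₂) ++ r
       ∼⟨ ∼-++ˡ (stars ρ S₁) (∼sym (∼-braid (ρ , b) (ρ , a) ρ≢a (cong₂ _,_ (τ-l ρ a) (τ-o b≢ρ (a≢b ∘ sym))))) ⟩
     stars ρ S₁ ++ stars ρ (b ∷ a ∷ map (τ a b) S₂) ++ r
       ≡∼⟨ sym (stars-++ ρ S₁ (b ∷ a ∷ map (τ a b) S₂) r) ⟩ _ ∎∼)
  where
  f₂ : Fresh ρ S₂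
  f₂ = All.tail (Allₚ.++⁻ʳ S₁ f)
  ρ≢a : ρ ≢ a
  ρ≢a = All.head (Allₚ.++⁻ʳ S₁ f)
  conj : ∀ S → map (act (a , b)) (stars ρ S) ≡ stars ρ (map (τ a b) S)
  conj []      = refl
  conj (s ∷ S) = cong₂ _∷_ (cong (_, τ a b s) (τ-o ρ≢a (b≢ρ ∘ sym))) (conj S)

Touches : List ℕ → Arrow → Set
Touches L (a , b) = a ∈ L ⊎ b ∈ L

touches? : ∀ L x → Dec (Touches L x)
touches? L (a , b) = (a ∈? L) ⊎-dec (b ∈? L)

indicator : List ℕ → ℕ → ℤ
indicator L a with a ∈? L
... | yes _ = 1ℤ
... | no  _ = 0ℤ

indicator-∈ : ∀ {L a} → a ∈ L → indicator L a ≡ 1ℤ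
indicator-∈ {L} {a} p with a ∈? L
... | yes _ = refl
... | no  q = ⊥-elim (q p)

indicator-∉ : ∀ {L a} → ¬ (a ∈ L) → indicator L a ≡ 0ℤ
indicator-∉ {L} {a} p with a ∈? L
... | yes q = ⊥-elim (p q)
... | no  _ = refl

stars-constant : ∀ {ρ} L X → (∀ {x} → x ∈ X → x ∈ L) → ρ ∈ L → All (Constant (indicator L)) (stars ρ X)
stars-constant L []      h r = []
stars-constant L (x ∷ X) h r = trans (indicator-∈ r) (sym (indicator-∈ (h (here refl)))) ∷ stars-constant L X (h ∘ there) r

-- Induction on the number `k` of letters not yet at the root. Connectedness always provides one
-- that touches the vertices reached so far.
star-form : ∀ {m ρ w} → Vertex m ρ → All Proper w → All (Ends (Vertex m)) w → Connected m w →
  Σ (List ℕ) λ X → Fresh ρ X × w ∼ stars ρ X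
star-form {m} {ρ} {w} vρ pw ew cw = go (length w) [] w refl [] ∼refl
  where
  go : ∀ k S u → length u ≡ k → Fresh ρ S → w ∼ stars ρ S ++ u → Σ (List ℕ) λ X → Fresh ρ X × w ∼ stars ρ X
  go k S [] _ f e = S , f , (_ ∼⟨ e ⟩ _ ≡∼⟨ Lₚ.++-identityʳ (stars ρ S) ⟩ _ ∎∼)
  go k S u@(x ∷ u′) l f e with Any.any? (touches? (ρ ∷ S)) u
  -- If no remaining letter touches ρ ∷ S, the indicator of this set is constant along all arrows,
  -- yet it separates ρ from the ends of a remaining letter.
  go k S ((a , b) ∷ u′) l f e | no none = contradiction
    (trans (sym (indicator-∈ {ρ ∷ S} (here refl)))
      (trans (∼-Connected e cw (indicator (ρ ∷ S)) consts vρ (proj₁ (All.head (Allₚ.++⁻ʳ (stars ρ S) (∼-Ends e ew)))))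
             (indicator-∉ {ρ ∷ S} (λ a∈ → none (here (inj₁ a∈)))))) λ ()
    where
    consts : All (Constant (indicator (ρ ∷ S))) (stars ρ S ++ (a , b) ∷ u′)
    consts = Allₚ.++⁺ (stars-constant (ρ ∷ S) S there (here refl))
      (All.map (λ ¬t → trans (indicator-∉ (¬t ∘ inj₁)) (sym (indicator-∉ (¬t ∘ inj₂)))) (Allₚ.¬Any⇒All¬ _ none))
  go k S u@(_ ∷ _) l f e | yes some with find some
  ... | (a , b) , x∈u , t with Memₚ.∈-∃++ x∈u
  ...   | u₁ , u₂ , eq with k | l
  ...     | zero  | ()
  ...     | suc k | l′ = go k S′ v len f′
      (_ ∼⟨ e ⟩
       _ ≡∼⟨ cong (stars ρ S ++_) eq ⟩
       stars ρ S ++ u₁ ++ (a , b) ∷ u₂ ∼⟨ ∼-++ˡ (stars ρ S) (moveˡ u₁ (a , b) u₂ a≢b refl) ⟩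
       stars ρ S ++ (a , b) ∷ v ∼⟨ merge ⟩
       stars ρ S′ ++ v ∎∼)
    where
    v = map (act (a , b)) u₁ ++ u₂
    a≢b : a ≢ b
    a≢b = All.lookup (Allₚ.++⁻ʳ (stars ρ S) (∼-Proper e pw)) x∈u
    choose : Touches (ρ ∷ S) (a , b) → Σ (List ℕ) λ S′ → Fresh ρ S′ × (stars ρ S ++ (a , b) ∷ v ∼ stars ρ S′ ++ v)
    choose (inj₁ a∈) = absorb S v f a≢b a∈
    choose (inj₂ b∈) = let S′ , f′ , e′ = absorb S v f (a≢b ∘ sym) b∈ in
      S′ , f′ , ∼trans (∼-++ˡ (stars ρ S) (∼flip a b)) e′
    S′ = proj₁ (choose t)
    f′ = proj₁ (proj₂ (choose t))
    merge = proj₂ (proj₂ (choose t))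
    len : length v ≡ k
    len = begin
      length v                                              ≡⟨ Lₚ.length-++ (map (act (a , b)) u₁) ⟩
      length (map (act (a , b)) u₁) ℕ.+ length u₂           ≡⟨ cong (ℕ._+ length u₂) (Lₚ.length-map (act (a , b)) u₁) ⟩
      length u₁ ℕ.+ length u₂                               ≡⟨ ℕₚ.suc-injective (trans (sym (ℕₚ.+-suc (length u₁) (length u₂)))
                                                                (trans (sym (trans (cong length eq) (Lₚ.length-++ u₁))) l′)) ⟩
      k                                                     ∎

-- Change of root and reordering of cycles

conj-stars : ∀ {ρ y} Y → Fresh ρ Y → Fresh y Y → map (act (ρ , y)) (stars ρ Y) ≡ stars y Y
conj-stars []      []       []       = refl
conj-stars {ρ} {y} (z ∷ Y) (p ∷ ps) (q ∷ qs) = cong₂ _∷_ (cong₂ _,_ (τ-l ρ y) (τ-o (p ∘ sym) (q ∘ sym))) (conj-stars Y ps qs)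

-- The letter (ρ y) passes each block unchanged, then returns to the left and conjugates it. As y
-- occurs in no block, this only replaces the root.
reroot-blocks : ∀ {ρ y} Bs u → ρ ≢ y → Unique (ρ ∷ lets Bs) → Fresh y (lets Bs) →
  (ρ , y) ∷ blocks ρ Bs u ∼ (ρ , y) ∷ blocks y Bs u
reroot-blocks [] u _ _ _ = ∼refl
reroot-blocks {ρ} {y} ((z , Z) ∷ Bs) u ρ≢y (fρ ∷ un) fy =
  (ρ , y) ∷ block ρ (z , Z) (blocks ρ Bs u)
    ∼⟨ letter-block _ (fρZ ∷ proj₁ (Unique-++⁻ (z ∷ Z) un)) ((ρ≢y ∘ sym) ∷ fyZ) ⟩
  block ρ (z , Z) ((ρ , y) ∷ blocks ρ Bs u)
    ∼⟨ block-cong ρ (z , Z) (reroot-blocks Bs u ρ≢y (Allₚ.++⁻ʳ (z ∷ Z) fρ ∷ proj₁ (proj₂ (Unique-++⁻ (z ∷ Z) un))) (Allₚ.++⁻ʳ (z ∷ Z) fy)) ⟩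
  (ρ , z) ∷ stars ρ Z ++ (ρ , z) ∷ (ρ , y) ∷ blocks y Bs u
    ∼⟨ ∼cons _ (∼-++ˡ (stars ρ Z) hop) ⟩
  (ρ , z) ∷ stars ρ Z ++ (ρ , y) ∷ (y , z) ∷ blocks y Bs u
    ∼⟨ ∼cons _ (moveˡ (stars ρ Z) (ρ , y) _ ρ≢y (conj-stars Z (All.tail fρZ) (All.tail fyZ))) ⟩
  (ρ , z) ∷ (ρ , y) ∷ stars y Z ++ (y , z) ∷ blocks y Bs u
    ∼⟨ hop ⟩
  (ρ , y) ∷ block y (z , Z) (blocks y Bs u) ∎∼
  where
  fρZ = Allₚ.++⁻ˡ (z ∷ Z) fρ
  fyZ = Allₚ.++⁻ˡ (z ∷ Z) fy
  hop : ∀ {v} → (ρ , z) ∷ (ρ , y) ∷ v ∼ (ρ , y) ∷ (y , z) ∷ v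
  hop = ∼-braid (ρ , z) (ρ , y) ρ≢y (cong₂ _,_ (τ-l ρ y) (τ-o (All.head fρZ ∘ sym) (All.head fyZ ∘ sym)))

-- The closing letter (ρ y), moved left, re-roots Y at y; the opening letter, moved left, re-roots
-- A. The resulting (ρ y) A (ρ y) is a block for the root y: the old root cycle has become a block
-- and the block of y the root cycle.
swap-root : ∀ {ρ A y Y Bs} D → Unique (ρ ∷ A ++ (y ∷ Y) ++ lets Bs) → nf ρ A ((y , Y) ∷ Bs) D ∼ nf y Y ((ρ , A) ∷ Bs) D
swap-root {ρ} {A} {y} {Y} {Bs} D (fρ ∷ un) =
  stars ρ A ++ (ρ , y) ∷ stars ρ Y ++ (ρ , y) ∷ blocks ρ Bs (dbl D)
    ∼⟨ ∼-++ˡ (stars ρ A) (∼cons _ (∼-++ˡ (stars ρ Y) (reroot-blocks Bs (dbl D) ρ≢y (fρB ∷ uB) fyB))) ⟩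
  stars ρ A ++ (ρ , y) ∷ stars ρ Y ++ (ρ , y) ∷ u
    ∼⟨ ∼-++ˡ (stars ρ A) (∼cons _ (moveˡ (stars ρ Y) (ρ , y) u ρ≢y (conj-stars Y fρY fyY))) ⟩
  stars ρ A ++ (ρ , y) ∷ (ρ , y) ∷ stars y Y ++ u
    ∼⟨ moveˡ (stars ρ A) (ρ , y) _ ρ≢y (conj-stars A fρA fyA) ⟩
  (ρ , y) ∷ stars y A ++ (ρ , y) ∷ stars y Y ++ u
    ∼⟨ ∼trans (∼flip ρ y) (∼cons _ (∼-++ˡ (stars y A) (∼flip ρ y))) ⟩
  block y (ρ , A) (stars y Y ++ u)
    ∼⟨ ∼sym (letters-block Y u (((ρ≢y ∘ sym) ∷ fyA) ∷ fρA ∷ uA) freshY) ⟩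
  nf y Y ((ρ , A) ∷ Bs) D ∎∼
  where
  u = blocks y Bs (dbl D)
  sp₁ = Unique-++⁻ A un
  uA = proj₁ sp₁
  sp₂ = Unique-++⁻ (y ∷ Y) (proj₁ (proj₂ sp₁))
  uB = proj₁ (proj₂ sp₂)
  fρA = Allₚ.++⁻ˡ A fρ
  fρyY = Allₚ.++⁻ˡ (y ∷ Y) (Allₚ.++⁻ʳ A fρ)
  fρB = Allₚ.++⁻ʳ (y ∷ Y) (Allₚ.++⁻ʳ A fρ)
  ρ≢y = All.head fρyY
  fρY = All.tail fρyY
  fyB = All.head (proj₂ (proj₂ sp₂))
  headOf : ∀ {x xs} → Unique (x ∷ xs) → Fresh x xs
  headOf (p ∷ _) = p
  fyY = headOf (proj₁ sp₂)
  un′ : Unique (((y ∷ Y) ++ A) ++ lets Bs)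
  un′ = subst Unique (sym (Lₚ.++-assoc (y ∷ Y) A (lets Bs))) (Unique-↭ (↭ₚ.shifts A (y ∷ Y)) un)
  fromY : All (λ z → Fresh z A) (y ∷ Y)
  fromY = proj₂ (proj₂ (Unique-++⁻ (y ∷ Y) (proj₁ (Unique-++⁻ ((y ∷ Y) ++ A) un′))))
  fyA = All.head fromY
  freshY : All (λ z → Fresh z (y ∷ ρ ∷ A)) Y
  freshY = All.zipWith (λ { ((p , q) , r) → (p ∘ sym) ∷ (q ∘ sym) ∷ r }) (All.zip (fyY , fρY) , All.tail fromY)

lets-↭ : ∀ {Bs Bs′} → Bs ↭ Bs′ → lets Bs ↭ lets Bs′
lets-↭ ↭refl = ↭-refl
lets-↭ (↭prep (y , Y) p) = ↭ₚ.++⁺ˡ (y ∷ Y) (lets-↭ p)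
lets-↭ (↭swap (y , Y) (z , Z) p) = ↭-trans (↭ₚ.shifts (y ∷ Y) (z ∷ Z)) (↭ₚ.++⁺ˡ (z ∷ Z) (↭ₚ.++⁺ˡ (y ∷ Y) (lets-↭ p)))
lets-↭ (↭trans p q) = ↭-trans (lets-↭ p) (lets-↭ q)

blocks-↭ : ∀ {ρ Bs Bs′} → Bs ↭ Bs′ → Unique (ρ ∷ lets Bs) → ∀ u → blocks ρ Bs u ∼ blocks ρ Bs′ u
blocks-↭ ↭refl un u = ∼refl
blocks-↭ {ρ} (↭prep (y , Y) p) (fρ ∷ un) u =
  block-cong ρ (y , Y) (blocks-↭ p (Allₚ.++⁻ʳ (y ∷ Y) fρ ∷ proj₁ (proj₂ (Unique-++⁻ (y ∷ Y) un))) u)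
blocks-↭ {ρ} (↭swap {Bs} (y , Y) (z , Z) p) (fρ ∷ un) u = ∼trans
  (block-block (blocks ρ Bs u) (Allₚ.++⁻ˡ (z ∷ Z) fρ₂ ∷ proj₁ sp₂)
    (All.zipWith (λ { (q , r) → (q ∘ sym) ∷ Allₚ.++⁻ˡ (z ∷ Z) r }) (Allₚ.++⁻ˡ (y ∷ Y) fρ , proj₂ (proj₂ sp₁))))
  (block-cong ρ (z , Z) (block-cong ρ (y , Y) (blocks-↭ p (Allₚ.++⁻ʳ (z ∷ Z) fρ₂ ∷ proj₁ (proj₂ sp₂)) u)))
  where
  sp₁ = Unique-++⁻ (y ∷ Y) un
  sp₂ = Unique-++⁻ (z ∷ Z) (proj₁ (proj₂ sp₁))
  fρ₂ = Allₚ.++⁻ʳ (y ∷ Y) fρ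
blocks-↭ (↭trans p q) un u = ∼trans (blocks-↭ p un u) (blocks-↭ q (Unique-↭ (↭prep _ (lets-↭ p)) un) u)

sz : Block → ℕ
sz (y , Y) = suc (length Y)

sizes : ∀ {w} → NormalForm w → List ℕ
sizes N = suc (length (A N)) ∷ map sz (Bs N)

permute-tail : ∀ {w} (N : NormalForm w) {Bs′} → Bs N ↭ Bs′ →
  Σ (NormalForm w) λ N′ → (sizes N′ ≡ suc (length (A N)) ∷ map sz Bs′) × (length (D N′) ≡ length (D N))
permute-tail (mkNF ρ A Bs D e un g) {Bs′} p = mkNF ρ A Bs′ D
  (∼trans e (∼-++ˡ (stars ρ A) (blocks-↭ p (tailUnique un) (dbl D))))
  (Unique-↭ perm un) (Good-mono (↭ₚ.∈-resp-↭ perm) g) , refl , refl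
  where
  perm : ρ ∷ A ++ lets Bs ↭ ρ ∷ A ++ lets Bs′
  perm = ↭prep ρ (↭ₚ.++⁺ˡ A (lets-↭ p))
  tailUnique : Unique (ρ ∷ A ++ lets Bs) → Unique (ρ ∷ lets Bs)
  tailUnique (f ∷ u) = Allₚ.++⁻ʳ A f ∷ proj₁ (proj₂ (Unique-++⁻ A u))

swap-head : ∀ {w} ρ A y Y Bs D → w ∼ nf ρ A ((y , Y) ∷ Bs) D → Unique (ρ ∷ A ++ (y ∷ Y) ++ lets Bs) →
  All (Good (ρ ∷ A ++ (y ∷ Y) ++ lets Bs)) D → NormalForm w
swap-head ρ A y Y Bs D e un g = mkNF y Y ((ρ , A) ∷ Bs) D (∼trans e (swap-root D un))
  (Unique-↭ perm un) (Good-mono (↭ₚ.∈-resp-↭ perm) g)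
  where
  perm : ρ ∷ A ++ (y ∷ Y) ++ lets Bs ↭ y ∷ Y ++ (ρ ∷ A) ++ lets Bs
  perm = ↭ₚ.shifts (ρ ∷ A) (y ∷ Y)

-- Only a swap at the front involves the cycle of the root and needs `swap-head`; all other steps
-- permute commuting blocks.
permute : ∀ {w κ κ′} → κ ↭ κ′ → (N : NormalForm w) → sizes N ≡ κ →
  Σ (NormalForm w) λ N′ → (sizes N′ ≡ κ′) × (length (D N′) ≡ length (D N))
permute ↭refl N e = N , e , refl
permute (↭prep _ p) N refl =
  let Bs′ , e′ , q = ↭ₚ.↭-map-inv sz p
      N′ , s , d = permute-tail N q
  in N′ , trans s (cong (_ ∷_) (sym e′)) , d
permute (↭swap _ _ p) N@(mkNF ρ A ((y , Y) ∷ Bs) D e un g) refl =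
  let Bs′ , e′ , q = ↭ₚ.↭-map-inv sz p
      N′ , s , d = permute-tail (swap-head ρ A y Y Bs D e un g) (↭prep (ρ , A) q)
  in N′ , trans s (cong (λ z → _ ∷ _ ∷ z) (sym e′)) , d
permute (↭swap _ _ p) (mkNF ρ A [] D e un g) ()
permute (↭trans p q) N e =
  let N₁ , s₁ , d₁ = permute p N e
      N₂ , s₂ , d₂ = permute q N₁ s₁
  in N₂ , s₂ , trans d₂ d₁

-- Doubled arrows

pair-flip : ∀ R a b u → R ++ (a , b) ∷ (a , b) ∷ u ∼ R ++ (b , a) ∷ (b , a) ∷ u
pair-flip R a b u = ∼-++ˡ R (∼trans (∼flip a b) (∼cons _ (∼flip a b)))

-- The pair travels left to the letter y, is conjugated there and travels back, leaving all other
-- letters as they were.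
pair-conj-∈ : ∀ R {y t t′} u → y ∈ R → Proper y → Proper t → act y t ≡ t′ → R ++ t ∷ t ∷ u ∼ R ++ t′ ∷ t′ ∷ u
pair-conj-∈ R {y} {t} u y∈R py pt refl with Memₚ.∈-∃++ y∈R
... | R₁ , R₂ , refl =
  _ ≡∼⟨ Lₚ.++-assoc R₁ (y ∷ R₂) (t ∷ t ∷ u) ⟩
  R₁ ++ y ∷ R₂ ++ t ∷ t ∷ u                   ∼⟨ ∼-++ˡ R₁ (∼cons y (pair-comm t R₂ u pt)) ⟩
  R₁ ++ y ∷ t ∷ t ∷ R₂ ++ u                   ∼⟨ ∼-++ˡ R₁ (pair-conj t y (R₂ ++ u) pt py) ⟩
  R₁ ++ y ∷ act y t ∷ act y t ∷ R₂ ++ u       ∼⟨ ∼-++ˡ R₁ (∼cons y (∼sym (pair-comm (act y t) R₂ u (act-proper y pt)))) ⟩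
  R₁ ++ y ∷ R₂ ++ act y t ∷ act y t ∷ u       ≡∼⟨ sym (Lₚ.++-assoc R₁ (y ∷ R₂) (act y t ∷ act y t ∷ u)) ⟩
  _ ∎∼

module _ {ρ : ℕ} {L : List ℕ} (fρ : Fresh ρ L) {z : ℕ} (z∈L : z ∈ L) where

  private
    ≢ρ : ∀ {a} → a ∈ L → ρ ≢ a
    ≢ρ = All.lookup fρ

  -- Conjugation by (ρ z) turns (ρ b) into (z b), and conjugation by (ρ b) turns this into (z ρ).
  pair-star : ∀ R → (∀ {y} → y ∈ L → (ρ , y) ∈ R) → ∀ {b} u → b ∈ L → R ++ (ρ , b) ∷ (ρ , b) ∷ u ∼ R ++ (ρ , z) ∷ (ρ , z) ∷ u
  pair-star R all {b} u b∈L with b ℕ.≟ z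
  ... | yes refl = ∼refl
  ... | no  b≢z =
    _ ∼⟨ pair-conj-∈ R u (all z∈L) (≢ρ z∈L) (≢ρ b∈L) (cong₂ _,_ (τ-l ρ z) (τ-o (≢ρ b∈L ∘ sym) b≢z)) ⟩
    R ++ (z , b) ∷ (z , b) ∷ u
      ∼⟨ pair-conj-∈ R u (all b∈L) (≢ρ b∈L) (b≢z ∘ sym) (cong₂ _,_ (τ-o (≢ρ z∈L ∘ sym) (b≢z ∘ sym)) (τ-r ρ b)) ⟩
    R ++ (z , ρ) ∷ (z , ρ) ∷ u ∼⟨ pair-flip R z ρ u ⟩
    _ ∎∼

  pair-any : ∀ R → (∀ {y} → y ∈ L → (ρ , y) ∈ R) → ∀ t u → Good (ρ ∷ L) t → R ++ t ∷ t ∷ u ∼ R ++ (ρ , z) ∷ (ρ , z) ∷ u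
  pair-any R all (a , b) u (a≢b , here refl , here refl) = ⊥-elim (a≢b refl)
  pair-any R all (a , b) u (a≢b , here refl , there b∈) = pair-star R all u b∈
  pair-any R all (a , b) u (a≢b , there a∈ , here refl) = ∼trans (pair-flip R a b u) (pair-star R all u a∈)
  pair-any R all (a , b) u (a≢b , there a∈ , there b∈) = ∼trans
    (pair-conj-∈ R u (all a∈) (≢ρ a∈) a≢b (cong₂ _,_ (τ-r ρ a) (τ-o (≢ρ b∈ ∘ sym) (a≢b ∘ sym)))) (pair-star R all u b∈)

  -- `R` absorbs the pairs already treated, so all star letters stay to the left of the current
  -- pair.
  pairs-any : ∀ R → (∀ {y} → y ∈ L → (ρ , y) ∈ R) → ∀ {D} → All (Good (ρ ∷ L)) D →
    R ++ dbl D ∼ R ++ dbl (replicate (length D) (ρ , z))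
  pairs-any R all []              = ∼refl
  pairs-any R all {t ∷ D} (g ∷ gs) =
    R ++ t ∷ t ∷ dbl D                       ∼⟨ pair-any R all t (dbl D) g ⟩
    R ++ (ρ , z) ∷ (ρ , z) ∷ dbl D           ≡∼⟨ sym (Lₚ.++-assoc R ((ρ , z) ∷ (ρ , z) ∷ []) (dbl D)) ⟩
    (R ++ (ρ , z) ∷ (ρ , z) ∷ []) ++ dbl D   ∼⟨ pairs-any (R ++ (ρ , z) ∷ (ρ , z) ∷ []) (Memₚ.∈-++⁺ˡ ∘ all) gs ⟩
    _                                        ≡∼⟨ Lₚ.++-assoc R ((ρ , z) ∷ (ρ , z) ∷ []) _ ⟩
    _ ∎∼

blocks-++ : ∀ ρ Bs u → blocks ρ Bs u ≡ blocks ρ Bs [] ++ u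
blocks-++ ρ []             u = refl
blocks-++ ρ ((y , Y) ∷ Bs) u = cong ((ρ , y) ∷_) (trans (cong (λ v → stars ρ Y ++ (ρ , y) ∷ v) (blocks-++ ρ Bs u))
  (sym (Lₚ.++-assoc (stars ρ Y) ((ρ , y) ∷ blocks ρ Bs []) u)))

nf-++ : ∀ ρ A Bs D → nf ρ A Bs D ≡ nf ρ A Bs [] ++ dbl D
nf-++ ρ A Bs D = trans (cong (stars ρ A ++_) (blocks-++ ρ Bs (dbl D))) (sym (Lₚ.++-assoc (stars ρ A) (blocks ρ Bs []) (dbl D)))

stars-∈ : ∀ ρ {X y} → y ∈ X → (ρ , y) ∈ stars ρ X
stars-∈ ρ = Memₚ.∈-map⁺ (ρ ,_)

blocks-∈ : ∀ ρ Bs {y} u → y ∈ lets Bs → (ρ , y) ∈ blocks ρ Bs u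
blocks-∈ ρ ((y , Y) ∷ Bs) u i with Memₚ.∈-++⁻ (y ∷ Y) i
... | inj₁ (here refl) = here refl
... | inj₁ (there j) = there (Memₚ.∈-++⁺ˡ (stars-∈ ρ j))
... | inj₂ j = there (Memₚ.∈-++⁺ʳ (stars ρ Y) (there (blocks-∈ ρ Bs u j)))

nf-∈ : ∀ ρ A Bs D {y} → y ∈ A ++ lets Bs → (ρ , y) ∈ nf ρ A Bs D
nf-∈ ρ A Bs D i with Memₚ.∈-++⁻ A i
... | inj₁ j = Memₚ.∈-++⁺ˡ (stars-∈ ρ j)
... | inj₂ j = Memₚ.∈-++⁺ʳ (stars ρ A) (blocks-∈ ρ Bs (dbl D) j)

uniform-pairs : ∀ {ρ A Bs D z} → Unique (ρ ∷ A ++ lets Bs) → All (Good (ρ ∷ A ++ lets Bs)) D → z ∈ A ++ lets Bs →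
  nf ρ A Bs D ∼ nf ρ A Bs (replicate (length D) (ρ , z))
uniform-pairs {ρ} {A} {Bs} {D} {z} (fρ ∷ _) g z∈ =
  _ ≡∼⟨ nf-++ ρ A Bs D ⟩
  _ ∼⟨ pairs-any fρ z∈ (nf ρ A Bs []) (nf-∈ ρ A Bs []) g ⟩
  _ ≡∼⟨ sym (nf-++ ρ A Bs _) ⟩
  _ ∎∼

-- Canonical words and relabelling by position

range : ℕ → ℕ → List ℕ
range s zero    = []
range s (suc k) = s ∷ range (suc s) k

canonBlocks : ℕ → List ℕ → List Block
canonBlocks s []      = []
canonBlocks s (k ∷ κ) = (s , range (suc s) (k ∸ 1)) ∷ canonBlocks (s ℕ.+ k) κ

-- The cycles occupy consecutive intervals, the first one starting at the root 0. Vertex 1, which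
-- carries the doubled arrows, is the first one after the root, whether it lies on the root cycle or
-- in the first block.
canon : List ℕ → ℕ → Word
canon []      d = []
canon (k ∷ κ) d = nf 0 (range 1 (k ∸ 1)) (canonBlocks (1 ℕ.+ (k ∸ 1)) κ) (replicate d (0 , 1))

idx : List ℕ → ℕ → ℕ
idx []      z = 0
idx (x ∷ L) z with z ℕ.≟ x
... | yes _ = 0
... | no  _ = suc (idx L z)

idx-injective : ∀ L → InjectiveOn (_∈ L) (idx L)
idx-injective (x ∷ L) {a} {b} a∈ b∈ e with a ℕ.≟ x | b ℕ.≟ x
... | yes refl | yes refl = refl
idx-injective (x ∷ L) {a} {b} a∈ b∈ () | yes refl | no _
idx-injective (x ∷ L) {a} {b} a∈ b∈ () | no _ | yes refl
... | no p | no q = idx-injective L (tail a∈ p) (tail b∈ q) (ℕₚ.suc-injective e)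
  where
  tail : ∀ {c} → c ∈ x ∷ L → c ≢ x → c ∈ L
  tail (here e)  n = ⊥-elim (n e)
  tail (there i) n = i

idx-here : ∀ x L → idx (x ∷ L) x ≡ 0
idx-here x L with x ℕ.≟ x
... | yes _ = refl
... | no  p = ⊥-elim (p refl)

idx-there : ∀ {x z} L → x ≢ z → idx (x ∷ L) z ≡ suc (idx L z)
idx-there {x} {z} L p with z ℕ.≟ x
... | yes q = ⊥-elim (p (sym q))
... | no  _ = refl

map-suc-range : ∀ s k → map suc (range s k) ≡ range (suc s) k
map-suc-range s zero    = refl
map-suc-range s (suc k) = cong (suc s ∷_) (map-suc-range (suc s) k)

map-idx : ∀ {L} → Unique L → map (idx L) L ≡ range 0 (length L)
map-idx []                  = refl
map-idx {x ∷ L} (f ∷ un) = cong₂ _∷_ (idx-here x L) (begin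
  map (idx (x ∷ L)) L       ≡⟨ step L f ⟩
  map suc (map (idx L) L)   ≡⟨ cong (map suc) (map-idx un) ⟩
  map suc (range 0 (length L)) ≡⟨ map-suc-range 0 (length L) ⟩
  range 1 (length L) ∎)
  where
  step : ∀ Z → Fresh x Z → map (idx (x ∷ L)) Z ≡ map suc (map (idx L) Z)
  step []      []       = refl
  step (z ∷ Z) (p ∷ ps) = cong₂ _∷_ (idx-there L p) (step Z ps)

split-range : ∀ (f : ℕ → ℕ) s X {Y} → map f (X ++ Y) ≡ range s (length (X ++ Y)) →
  map f X ≡ range s (length X) × map f Y ≡ range (s ℕ.+ length X) (length Y)
split-range f s []      {Y} e = refl , trans e (cong (λ t → range t (length Y)) (sym (ℕₚ.+-identityʳ s)))
split-range f s (x ∷ X) {Y} e =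
  let h , t = Lₚ.∷-injective e
      p , q = split-range f (suc s) X t
  in cong₂ _∷_ h p , trans q (cong (λ t → range t (length Y)) (sym (ℕₚ.+-suc s (length X))))

mapBlock : (ℕ → ℕ) → Block → Block
mapBlock f (y , Y) = f y , map f Y

map-blocks : ∀ (f : ℕ → ℕ) s Bs → map f (lets Bs) ≡ range s (length (lets Bs)) → map (mapBlock f) Bs ≡ canonBlocks s (map sz Bs)
map-blocks f s []             e = refl
map-blocks f s ((y , Y) ∷ Bs) e =
  let p , q = split-range f s (y ∷ Y) e
      h , t = Lₚ.∷-injective p
  in cong₂ _∷_ (cong₂ _,_ h t) (map-blocks f (s ℕ.+ suc (length Y)) Bs q)

map-rename-stars : ∀ f ρ X → map (rename f) (stars ρ X) ≡ stars (f ρ) (map f X)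
map-rename-stars f ρ []      = refl
map-rename-stars f ρ (x ∷ X) = cong (_ ∷_) (map-rename-stars f ρ X)

map-rename-blocks : ∀ f ρ Bs u → map (rename f) (blocks ρ Bs u) ≡ blocks (f ρ) (map (mapBlock f) Bs) (map (rename f) u)
map-rename-blocks f ρ []             u = refl
map-rename-blocks f ρ ((y , Y) ∷ Bs) u = cong ((f ρ , f y) ∷_) (trans (Lₚ.map-++ (rename f) (stars ρ Y) _)
  (cong₂ (λ v w → v ++ (f ρ , f y) ∷ w) (map-rename-stars f ρ Y) (map-rename-blocks f ρ Bs u)))

map-rename-pairs : ∀ f d t → map (rename f) (dbl (replicate d t)) ≡ dbl (replicate d (rename f t))
map-rename-pairs f zero    t = refl
map-rename-pairs f (suc d) t = cong (λ v → rename f t ∷ rename f t ∷ v) (map-rename-pairs f d t)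

map-rename-nf : ∀ f ρ A Bs d t → map (rename f) (nf ρ A Bs (replicate d t)) ≡ nf (f ρ) (map f A) (map (mapBlock f) Bs) (replicate d (rename f t))
map-rename-nf f ρ A Bs d t = trans (Lₚ.map-++ (rename f) (stars ρ A) _)
  (cong₂ _++_ (map-rename-stars f ρ A) (trans (map-rename-blocks f ρ Bs _) (cong (blocks (f ρ) (map (mapBlock f) Bs)) (map-rename-pairs f d t))))

nf-All : ∀ {Q : Arrow → Set} {ρ} A Bs D → (∀ {y} → y ∈ A ++ lets Bs → Q (ρ , y)) → All Q D → All Q (nf ρ A Bs D)
nf-All {Q} {ρ} A Bs D q qD = Allₚ.++⁺ (st A (q ∘ Memₚ.∈-++⁺ˡ)) (bl Bs (q ∘ Memₚ.∈-++⁺ʳ A))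
  where
  st : ∀ X → (∀ {y} → y ∈ X → Q (ρ , y)) → All Q (stars ρ X)
  st []      h = []
  st (x ∷ X) h = h (here refl) ∷ st X (h ∘ there)
  db : ∀ {D} → All Q D → All Q (dbl D)
  db []       = []
  db (p ∷ ps) = p ∷ p ∷ db ps
  bl : ∀ Bs → (∀ {y} → y ∈ lets Bs → Q (ρ , y)) → All Q (blocks ρ Bs (dbl D))
  bl []             h = db qD
  bl ((y , Y) ∷ Bs) h = h (here refl) ∷ Allₚ.++⁺ (st Y (h ∘ there ∘ Memₚ.∈-++⁺ˡ)) (h (here refl) ∷ bl Bs (h ∘ Memₚ.∈-++⁺ʳ (y ∷ Y)))

replicate⁺ : ∀ {P : Arrow → Set} d {t} → P t → All P (replicate d t)
replicate⁺ zero    p = []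
replicate⁺ (suc d) p = p ∷ replicate⁺ d p

-- Numbering vertices by their position in ρ ∷ A ++ lets Bs sends every cycle to an interval, so
-- only the cycle lengths and d survive. The end z heads the list after ρ and so receives the number
-- 1.
nf≅canon : ∀ {ρ A Bs z L′} d → Unique (ρ ∷ A ++ lets Bs) → A ++ lets Bs ≡ z ∷ L′ →
  M (nf ρ A Bs (replicate d (ρ , z))) ≅ M (canon (suc (length A) ∷ map sz Bs) d)
nf≅canon {ρ} {A} {Bs} {z} {L′} d un eq = subst (λ w → M (nf ρ A Bs (replicate d (ρ , z))) ≅ M w) image
  (Renamed.riso (rename-≅ {P = _∈ L} (idx-injective L) (nf-All A Bs (replicate d (ρ , z)) (λ y∈ → here refl , there y∈)
    (replicate⁺ d (here refl , there (subst (z ∈_) (sym eq) (here refl)))))))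
  where
  L = ρ ∷ A ++ lets Bs
  f = idx L
  vals : f ρ ≡ 0 × map f (A ++ lets Bs) ≡ range 1 (length (A ++ lets Bs))
  vals = Lₚ.∷-injective (map-idx un)
  sp = split-range f 1 A (proj₂ vals)
  fz : f z ≡ 1
  fz = proj₁ (Lₚ.∷-injective (trans (sym (cong (map f) eq)) (trans (proj₂ vals) (cong (range 1 ∘ length) eq))))
  image : map (rename f) (nf ρ A Bs (replicate d (ρ , z))) ≡ canon (suc (length A) ∷ map sz Bs) d
  image = trans (map-rename-nf f ρ A Bs d (ρ , z))
    (trans (cong₂ (λ X Y → nf (f ρ) X Y (replicate d (f ρ , f z))) (proj₁ sp) (map-blocks f (1 ℕ.+ length A) Bs (proj₂ sp)))
      (cong₂ (λ r s → nf r (range 1 (length A)) (canonBlocks (1 ℕ.+ length A) (map sz Bs)) (replicate d (r , s))) (proj₁ vals) fz))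

normal≅canon : ∀ {w} (N : NormalForm w) → A N ++ lets (Bs N) ≢ [] → M w ≅ M (canon (sizes N) (length (D N)))
normal≅canon (mkNF ρ A Bs D e un g) ne with A ++ lets Bs in eq
... | [] = ⊥-elim (ne refl)
... | z ∷ L′ = ≅-trans (∼⇒≅ (∼trans e (uniform-pairs {A = A} {Bs} un′ g′ z∈))) (nf≅canon {A = A} {Bs} (length D) un′ eq)
  where
  un′ : Unique (ρ ∷ A ++ lets Bs)
  un′ = subst (λ L → Unique (ρ ∷ L)) (sym eq) un
  g′ : All (Good (ρ ∷ A ++ lets Bs)) D
  g′ = subst (λ L → All (Good (ρ ∷ L)) D) (sym eq) g
  z∈ : z ∈ A ++ lets Bs
  z∈ = subst (z ∈_) (sym eq) (here refl)

-- Standard quivers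

letter-blocks : ∀ {ρ y} Bs u → Unique (ρ ∷ lets Bs) → Fresh y (ρ ∷ lets Bs) → (ρ , y) ∷ blocks ρ Bs u ∼ blocks ρ Bs ((ρ , y) ∷ u)
letter-blocks []             u _ _ = ∼refl
letter-blocks {ρ} ((z , Z) ∷ Bs) u (fρ ∷ un) (y≢ρ ∷ fy) = ∼trans
  (letter-block _ (Allₚ.++⁻ˡ (z ∷ Z) fρ ∷ proj₁ (Unique-++⁻ (z ∷ Z) un)) (y≢ρ ∷ Allₚ.++⁻ˡ (z ∷ Z) fy))
  (block-cong ρ (z , Z) (letter-blocks Bs u (Allₚ.++⁻ʳ (z ∷ Z) fρ ∷ proj₁ (proj₂ (Unique-++⁻ (z ∷ Z) un))) (y≢ρ ∷ Allₚ.++⁻ʳ (z ∷ Z) fy)))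

stars-reverse-∷ : ∀ ρ y Y u → stars ρ (reverse (y ∷ Y)) ++ u ≡ stars ρ (reverse Y) ++ (ρ , y) ∷ u
stars-reverse-∷ ρ y Y u = trans (cong (λ Z → stars ρ Z ++ u) (Lₚ.unfold-reverse y Y)) (stars-++ ρ (reverse Y) [ y ] u)

heads : List Block → List ℕ
heads = map proj₁

-- Innermost block first, each closing letter commutes to the right of the blocks inside it.
unnest : ∀ {ρ} Bs u → Unique (ρ ∷ lets Bs) → stars ρ (lets Bs) ++ stars ρ (reverse (heads Bs)) ++ u ∼ blocks ρ Bs u
unnest []             u un = ∼refl
unnest {ρ} ((y , Y) ∷ Bs) u (fρ ∷ un) =
  stars ρ ((y ∷ Y) ++ lets Bs) ++ stars ρ (reverse (y ∷ heads Bs)) ++ u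
    ≡∼⟨ trans (cong (stars ρ ((y ∷ Y) ++ lets Bs) ++_) (stars-reverse-∷ ρ y (heads Bs) u)) (stars-++ ρ (y ∷ Y) (lets Bs) _) ⟩
  stars ρ (y ∷ Y) ++ stars ρ (lets Bs) ++ stars ρ (reverse (heads Bs)) ++ (ρ , y) ∷ u
    ∼⟨ ∼-++ˡ (stars ρ (y ∷ Y)) (unnest Bs ((ρ , y) ∷ u) (fρB ∷ proj₁ (proj₂ sp))) ⟩
  stars ρ (y ∷ Y) ++ blocks ρ Bs ((ρ , y) ∷ u)
    ∼⟨ ∼-++ˡ (stars ρ (y ∷ Y)) (∼sym (letter-blocks Bs u (fρB ∷ proj₁ (proj₂ sp)) ((All.head fρ ∘ sym) ∷ All.head (proj₂ (proj₂ sp))))) ⟩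
  blocks ρ ((y , Y) ∷ Bs) u ∎∼
  where
  sp = Unique-++⁻ (y ∷ Y) un
  fρB = Allₚ.++⁻ʳ (y ∷ Y) fρ

chain : ℕ → List ℕ → Word
chain c []       = []
chain c (d ∷ ds) = (c , d) ∷ chain d ds

Fresh-reverse : ∀ {x} Y → Fresh x Y → Fresh x (reverse Y)
Fresh-reverse Y = ↭ₚ.All-resp-↭ (↭-sym (↭ₚ.↭-reverse Y))

-- Moving (c , d) left across a star at c re-roots the star at d. Read backwards, this gathers a
-- path into a star at its starting point, in reverse order.
chain-stars : ∀ {c} ds u → Unique (c ∷ ds) → chain c ds ++ u ∼ stars c (reverse ds) ++ u
chain-stars []           u un = ∼refl
chain-stars {c} (d ∷ ds) u ((c≢d ∷ fc) ∷ fd ∷ un) =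
  (c , d) ∷ chain d ds ++ u                  ∼⟨ ∼cons _ (chain-stars ds u (fd ∷ un)) ⟩
  (c , d) ∷ stars d (reverse ds) ++ u        ∼⟨ ∼sym (moveˡ (stars c (reverse ds)) (c , d) u c≢d (conj-stars (reverse ds) (Fresh-reverse ds fc) (Fresh-reverse ds fd))) ⟩
  stars c (reverse ds) ++ (c , d) ∷ u        ≡∼⟨ sym (stars-reverse-∷ c d ds u) ⟩
  stars c (reverse (d ∷ ds)) ++ u            ∎∼

path : ℕ → ℕ → Word
path s zero    = []
path s (suc k) = (s , suc s) ∷ path (suc s) k

down : ℕ → ℕ → List ℕ
down s zero    = []
down s (suc k) = down (suc s) k ++ [ s ]

down-bounds : ∀ s k → All (λ x → s ℕ.≤ x × x ℕ.< s ℕ.+ k) (down s k)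
down-bounds s zero    = []
down-bounds s (suc k) = Allₚ.++⁺
  (All.map (λ { {x} (p , q) → ℕₚ.≤-trans (ℕₚ.n≤1+n s) p , subst (x ℕ.<_) (sym (ℕₚ.+-suc s k)) q }) (down-bounds (suc s) k))
  ((ℕₚ.≤-refl , ℕₚ.m<m+n s (ℕ.s≤s ℕ.z≤n)) ∷ [])

act*-++ : ∀ v v′ x → act* (v ++ v′) x ≡ act* v′ (act* v x)
act*-++ []      v′ x = refl
act*-++ (y ∷ v) v′ x = act*-++ v v′ (act y x)

-- With the later arrows already gathered at ρ, the arrow (s , s+1) crosses all their letters but
-- the last without change; the last one, (ρ , s+1), turns it into (s , ρ).
path-stars : ∀ {ρ} s k u → s ℕ.+ k ≡ ρ → path s k ++ u ∼ stars ρ (down s k) ++ u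
path-stars s zero u refl = ∼refl
path-stars {ρ} s (suc zero) u e = ∼trans (∼flip s (suc s)) (_ ≡∼⟨ cong (λ z → (z , s) ∷ u) (trans (ℕₚ.+-comm 1 s) e) ⟩ _ ∎∼)
path-stars {ρ} s (suc (suc k)) u e =
  (s , suc s) ∷ path (suc s) (suc k) ++ u
    ∼⟨ ∼cons _ (path-stars (suc s) (suc k) u (trans (sym (ℕₚ.+-suc s (suc k))) e)) ⟩
  (s , suc s) ∷ stars ρ X ++ u
    ∼⟨ moveʳ (s , suc s) (stars ρ X) u (stars-proper fρ) moved ⟩
  stars ρ X ++ (s , ρ) ∷ u
    ∼⟨ ∼-++ˡ (stars ρ X) (∼flip s ρ) ⟩
  stars ρ X ++ (ρ , s) ∷ u
    ≡∼⟨ sym (stars-++ ρ X [ s ] u) ⟩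
  stars ρ (down s (suc (suc k))) ++ u ∎∼
  where
  X = down (suc s) (suc k)
  Y = down (suc (suc s)) k
  ρ≡ : suc (suc s) ℕ.+ k ≡ ρ
  ρ≡ = trans (cong suc (sym (ℕₚ.+-suc s k))) (trans (sym (ℕₚ.+-suc s (suc k))) e)
  s<ρ : suc s ℕ.< ρ
  s<ρ = subst (suc s ℕ.<_) ρ≡ (ℕ.s≤s (ℕ.s≤s (ℕₚ.m≤m+n s k)))
  fρ : Fresh ρ X
  fρ = All.map (λ { (_ , q) → ℕₚ.<⇒≢ (subst (_ ℕ.<_) (trans (sym (ℕₚ.+-suc s (suc k))) e) q) ∘ sym }) (down-bounds (suc s) (suc k))
  moved : act* (stars ρ X) (s , suc s) ≡ (s , ρ)
  moved = begin
    act* (stars ρ (Y ++ [ suc s ])) (s , suc s)             ≡⟨ cong (λ v → act* v (s , suc s)) (Lₚ.map-++ (ρ ,_) Y [ suc s ]) ⟩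
    act* (stars ρ Y ++ stars ρ [ suc s ]) (s , suc s)       ≡⟨ act*-++ (stars ρ Y) (stars ρ [ suc s ]) (s , suc s) ⟩
    act (ρ , suc s) (act* (stars ρ Y) (s , suc s))          ≡⟨ cong (act (ρ , suc s)) (act*-fresh (ℕₚ.<⇒≢ (ℕₚ.<-trans (ℕₚ.n<1+n s) s<ρ)) (ℕₚ.<⇒≢ s<ρ)
                                                                 (All.map (λ (p , _) → ℕₚ.<⇒≢ (ℕₚ.<-trans (ℕₚ.n<1+n s) p)) (down-bounds (suc (suc s)) k))
                                                                 (All.map (λ (p , _) → ℕₚ.<⇒≢ p) (down-bounds (suc (suc s)) k))) ⟩
    act (ρ , suc s) (s , suc s)                             ≡⟨ cong₂ _,_ (τ-o (ℕₚ.<⇒≢ (ℕₚ.<-trans (ℕₚ.n<1+n s) s<ρ)) (ℕₚ.<⇒≢ (ℕₚ.n<1+n s))) (τ-r ρ (suc s)) ⟩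
    (s , ρ)                                                 ∎

dn : ℕ → ℕ → List ℕ
dn t zero    = []
dn t (suc k) = t ∷ dn (t ∸ 1) k

dn-+ : ∀ t a b → dn t (a ℕ.+ b) ≡ dn t a ++ dn (t ∸ a) b
dn-+ t zero    b = refl
dn-+ t (suc a) b = cong (t ∷_) (trans (dn-+ (t ∸ 1) a b) (cong (λ s → dn (t ∸ 1) a ++ dn s b) (ℕₚ.∸-+-assoc t 1 a)))

down≡dn : ∀ s k → down s k ≡ dn (s ℕ.+ k ∸ 1) k
down≡dn s zero    = refl
down≡dn s (suc k) = begin
  down (suc s) k ++ [ s ]                       ≡⟨ cong₂ (λ X t → X ++ [ t ]) (down≡dn (suc s) k) (sym (ℕₚ.m+n∸n≡m s k)) ⟩
  dn (s ℕ.+ k) k ++ dn (s ℕ.+ k ∸ k) 1          ≡⟨ sym (dn-+ (s ℕ.+ k) k 1) ⟩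
  dn (s ℕ.+ k) (k ℕ.+ 1)                        ≡⟨ cong₂ (λ a b → dn (a ∸ 1) b) (sym (ℕₚ.+-suc s k)) (ℕₚ.+-comm k 1) ⟩
  dn (s ℕ.+ suc k ∸ 1) (suc k)                  ∎

length-dn : ∀ t k → length (dn t k) ≡ k
length-dn t zero    = refl
length-dn t (suc k) = cong suc (length-dn (t ∸ 1) k)

dn-≤ : ∀ t k → All (ℕ._≤ t) (dn t k)
dn-≤ t zero    = []
dn-≤ t (suc k) = ℕₚ.≤-refl ∷ All.map (λ p → ℕₚ.≤-trans p (ℕₚ.m∸n≤m t 1)) (dn-≤ (t ∸ 1) k)

dn-unique : ∀ t k → k ℕ.≤ t → Unique (suc t ∷ dn t k)
dn-unique t       zero    _         = [] ∷ []
dn-unique (suc t) (suc k) (ℕ.s≤s p) = All.map (λ q e → ℕₚ.<⇒≢ (ℕ.s≤s q) (sym e)) (dn-≤ (suc t) (suc k)) ∷ dn-unique t k p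

dn-∈ : ∀ {x} t → 1 ℕ.≤ x → x ℕ.≤ suc t → x ∈ suc t ∷ dn t t
dn-∈ {suc x} zero    p (ℕ.s≤s ℕ.z≤n) = here refl
dn-∈ {x}     (suc t) p q with x ℕ.≟ suc (suc t)
... | yes e = here e
... | no  n = there (dn-∈ t p (ℕₚ.≤-pred (ℕₚ.≤∧≢⇒< q n)))

-- Started at m - π₁ with the remaining parts, the heads are the vertices v₁, v₂, ... of the quiver,
-- so the arrows j form the chain of heads issuing from v₀ = m.
stdBlocks : ℕ → List ℕ → List Block
stdBlocks t []      = []
stdBlocks t (k ∷ κ) = (t , dn (t ∸ 1) (k ∸ 1)) ∷ stdBlocks (t ∸ k) κ

lets-stdBlocks : ∀ t {κ} → All (0 ℕ.<_) κ → lets (stdBlocks t κ) ≡ dn t (sum κ)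
lets-stdBlocks t []                     = refl
lets-stdBlocks t {suc k ∷ κ} (p ∷ ps) = cong (t ∷_) (begin
  dn (t ∸ 1) k ++ lets (stdBlocks (t ∸ suc k) κ)   ≡⟨ cong (dn (t ∸ 1) k ++_) (lets-stdBlocks (t ∸ suc k) ps) ⟩
  dn (t ∸ 1) k ++ dn (t ∸ suc k) (sum κ)           ≡⟨ cong (λ s → dn (t ∸ 1) k ++ dn s (sum κ)) (sym (ℕₚ.∸-+-assoc t 1 k)) ⟩
  dn (t ∸ 1) k ++ dn (t ∸ 1 ∸ k) (sum κ)           ≡⟨ sym (dn-+ (t ∸ 1) k (sum κ)) ⟩
  dn (t ∸ 1) (k ℕ.+ sum κ)                         ∎)

sz-stdBlocks : ∀ t {κ} → All (0 ℕ.<_) κ → map sz (stdBlocks t κ) ≡ κ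
sz-stdBlocks t []                     = refl
sz-stdBlocks t {suc k ∷ κ} (p ∷ ps) = cong₂ _∷_ (cong suc (length-dn (t ∸ 1) k)) (sz-stdBlocks (t ∸ suc k) ps)

applyUpTo-cong : ∀ {f g : ℕ → Arrow} n → (∀ i → i ℕ.< n → f i ≡ g i) → applyUpTo f n ≡ applyUpTo g n
applyUpTo-cong zero    h = refl
applyUpTo-cong (suc n) h = cong₂ _∷_ (h 0 (ℕ.s≤s ℕ.z≤n)) (applyUpTo-cong n (λ i p → h (suc i) (ℕ.s≤s p)))

applyUpTo-+ : ∀ (f : ℕ → Arrow) a b → applyUpTo f (a ℕ.+ b) ≡ applyUpTo f a ++ applyUpTo (f ∘ (a ℕ.+_)) b
applyUpTo-+ f zero    b = refl
applyUpTo-+ f (suc a) b = cong (f 0 ∷_) (applyUpTo-+ (f ∘ suc) a b)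

tabulate-toℕ : ∀ (f : ℕ → Arrow) n → tabulate {n = n} (f ∘ toℕ) ≡ applyUpTo f n
tabulate-toℕ f zero    = refl
tabulate-toℕ f (suc n) = cong (f 0 ∷_) (tabulate-toℕ (f ∘ suc) n)

path-applyUpTo : ∀ (f : ℕ → Arrow) s k → (∀ i → f i ≡ (s ℕ.+ i , suc (s ℕ.+ i))) → applyUpTo f k ≡ path s k
path-applyUpTo f s zero    h = refl
path-applyUpTo f s (suc k) h = cong₂ _∷_ (trans (h 0) (cong (λ z → z , suc z) (ℕₚ.+-identityʳ s)))
  (path-applyUpTo (f ∘ suc) (suc s) k (λ i → trans (h (suc i)) (cong (λ z → z , suc z) (ℕₚ.+-suc s i))))

chain-applyUpTo : ∀ m k κ → applyUpTo (λ t → vtx m (k ∷ κ) t , vtx m (k ∷ κ) (suc t)) (length κ) ≡ chain m (heads (stdBlocks (m ∸ k) κ))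
chain-applyUpTo m k []       = refl
chain-applyUpTo m k (l ∷ κ) = cong₂ _∷_ (cong (λ z → m , m ∸ z) (ℕₚ.+-identityʳ k))
  (trans (applyUpTo-cong (length κ) (λ i _ → cong₂ _,_ (sym (ℕₚ.∸-+-assoc m k (sum (take i (l ∷ κ))))) (sym (ℕₚ.∸-+-assoc m k (sum (take (suc i) (l ∷ κ)))))))
    (chain-applyUpTo (m ∸ k) l κ))

<ᵇ-true : ∀ {a b} → a ℕ.< b → (a <ᵇ b) ≡ true
<ᵇ-true {zero}  {suc b} p         = refl
<ᵇ-true {suc a} {suc b} (ℕ.s≤s p) = <ᵇ-true p

<ᵇ-false : ∀ a b → (a ℕ.+ b <ᵇ a) ≡ false
<ᵇ-false zero    b = refl
<ᵇ-false (suc a) b = <ᵇ-false a b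

stdArrow : ℕ → List ℕ → ℕ → Arrow
stdArrow m π a = stdSrc m π a , stdTgt m π a

pairArrow : Arrow → ℕ → Arrow
pairArrow (s , t) u = (if even? (suc u) then s else t) , (if even? (suc u) then t else s)

α : ℕ → List ℕ → Arrow
α m π = αSrc m π , αTgt m π

stdArrow-i : ∀ m π a → a ℕ.< m ∸ 1 → stdArrow m π a ≡ (suc a , suc (suc a))
stdArrow-i m π a p rewrite <ᵇ-true p = refl

stdArrow-j : ∀ m π t → t ℕ.< length π ∸ 1 → stdArrow m π (m ∸ 1 ℕ.+ t) ≡ (vtx m π t , vtx m π (suc t))
stdArrow-j m π t p rewrite <ᵇ-false (m ∸ 1) t | <ᵇ-true (ℕₚ.+-monoʳ-< (m ∸ 1) p) | ℕₚ.m+n∸m≡n (m ∸ 1) t = refl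

stdArrow-k : ∀ m π u → stdArrow m π (m ∸ 1 ℕ.+ (length π ∸ 1) ℕ.+ u) ≡ pairArrow (α m π) u
stdArrow-k m π u
  rewrite trans (cong (_<ᵇ (m ∸ 1)) (ℕₚ.+-assoc (m ∸ 1) (length π ∸ 1) u)) (<ᵇ-false (m ∸ 1) (length π ∸ 1 ℕ.+ u))
        | <ᵇ-false (m ∸ 1 ℕ.+ (length π ∸ 1)) u | ℕₚ.m+n∸m≡n (m ∸ 1 ℕ.+ (length π ∸ 1)) u = refl

stdWord : (m : ℕ) → List ℕ → (n : ℕ) → Word
stdWord m π n = tabulate {n = n} (stdArrow m π ∘ toℕ)

stdWord-split : ∀ r k κ d → stdWord (suc r) (k ∷ κ) (stdArrows (suc r) (k ∷ κ) d) ≡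
  path 1 r ++ chain (suc r) (heads (stdBlocks (suc r ∸ k) κ)) ++ applyUpTo (pairArrow (α (suc r) (k ∷ κ))) (2 ℕ.* d)
stdWord-split r k κ d = begin
  stdWord m π (r ℕ.+ length κ ℕ.+ 2 ℕ.* d)
    ≡⟨ tabulate-toℕ f (r ℕ.+ length κ ℕ.+ 2 ℕ.* d) ⟩
  applyUpTo f (r ℕ.+ length κ ℕ.+ 2 ℕ.* d)
    ≡⟨ applyUpTo-+ f (r ℕ.+ length κ) (2 ℕ.* d) ⟩
  applyUpTo f (r ℕ.+ length κ) ++ applyUpTo (f ∘ (r ℕ.+ length κ ℕ.+_)) (2 ℕ.* d)
    ≡⟨ cong₂ _++_ (applyUpTo-+ f r (length κ)) (applyUpTo-cong (2 ℕ.* d) (λ u _ → stdArrow-k m π u)) ⟩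
  (applyUpTo f r ++ applyUpTo (f ∘ (r ℕ.+_)) (length κ)) ++ ks
    ≡⟨ cong (_++ ks) (cong₂ _++_ (trans (applyUpTo-cong r (stdArrow-i m π)) (path-applyUpTo (λ a → suc a , suc (suc a)) 1 r (λ _ → refl)))
         (trans (applyUpTo-cong (length κ) (stdArrow-j m π)) (chain-applyUpTo m k κ))) ⟩
  (path 1 r ++ chain m (heads (stdBlocks (m ∸ k) κ))) ++ ks
    ≡⟨ Lₚ.++-assoc (path 1 r) _ ks ⟩
  path 1 r ++ chain m (heads (stdBlocks (m ∸ k) κ)) ++ ks ∎
  where
  m = suc r
  π = k ∷ κ
  f = stdArrow m π
  ks = applyUpTo (pairArrow (α m π)) (2 ℕ.* d)

-- Reversing every other arrow makes the alternating arrows k parallel.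
pairs-dbl : ∀ t d → applyUpTo (pairArrow t) (2 ℕ.* d) ∼ dbl (replicate d t)
pairs-dbl t zero = ∼refl
pairs-dbl t@(a , b) (suc d) =
  applyUpTo (pairArrow t) (2 ℕ.* suc d)                     ≡∼⟨ cong (applyUpTo (pairArrow t)) (ℕₚ.*-suc 2 d) ⟩
  (b , a) ∷ (a , b) ∷ applyUpTo (pairArrow t) (2 ℕ.* d)     ∼⟨ ∼flip b a ⟩
  (a , b) ∷ (a , b) ∷ applyUpTo (pairArrow t) (2 ℕ.* d)     ∼⟨ ∼cons _ (∼cons _ (pairs-dbl t d)) ⟩
  dbl (replicate (suc d) t)                                 ∎∼

InRange : ℕ → ℕ → Set
InRange m x = 1 ℕ.≤ x × x ℕ.≤ m

sum-take-< : ∀ {π} t → All (0 ℕ.<_) π → t ℕ.< length π → sum (take t π) ℕ.< sum (take (suc t) π)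
sum-take-< {k ∷ π} zero    (p ∷ ps) q         = subst (0 ℕ.<_) (sym (ℕₚ.+-identityʳ k)) p
sum-take-< {k ∷ π} (suc t) (p ∷ ps) (ℕ.s≤s q) = ℕₚ.+-monoʳ-< k (sum-take-< t ps q)

sum-take-≤ : ∀ π t → sum (take t π) ℕ.≤ sum π
sum-take-≤ []      zero    = ℕ.z≤n
sum-take-≤ []      (suc t) = ℕ.z≤n
sum-take-≤ (k ∷ π) zero    = ℕ.z≤n
sum-take-≤ (k ∷ π) (suc t) = ℕₚ.+-monoʳ-≤ k (sum-take-≤ π t)

module StdVertices {m π} (pos : All (0 ℕ.<_) π) (total : sum π ≡ m) where

  vtx-range : ∀ {t} → t ℕ.< length π → InRange m (vtx m π t)
  vtx-range {t} p = ℕₚ.m<n⇒0<n∸m (ℕₚ.<-≤-trans (sum-take-< t pos p) (subst (sum (take (suc t) π) ℕ.≤_) total (sum-take-≤ π (suc t)))) , ℕₚ.m∸n≤m m (sum (take t π))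

  vtx-≢ : ∀ {t} → t ℕ.< length π → vtx m π t ≢ vtx m π (suc t)
  vtx-≢ {t} p e = ℕₚ.<⇒≢ (ℕₚ.∸-monoʳ-< (sum-take-< t pos p) (subst (sum (take (suc t) π) ℕ.≤_) total (sum-take-≤ π (suc t)))) (sym e)

Fine : ℕ → Arrow → Set
Fine m t = Proper t × Ends (InRange m) t

α-fine : ∀ r {π} → 1 ℕ.≤ r → All (0 ℕ.<_) π → sum π ≡ suc r → Fine (suc r) (α (suc r) π)
α-fine r {[]}          1≤r pos ()
α-fine r {k ∷ []}      1≤r pos total = (λ e → ℕₚ.<⇒≢ (ℕₚ.n<1+n r) e) , (1≤r , ℕₚ.n≤1+n r) , (ℕ.s≤s ℕ.z≤n , ℕₚ.≤-refl)
α-fine r {k ∷ l ∷ κ} 1≤r pos total = vtx-≢ p , vtx-range p , vtx-range (ℕₚ.n<1+n _)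
  where
  open StdVertices pos total
  p : length κ ℕ.< length (k ∷ l ∷ κ)
  p = ℕₚ.<-trans (ℕₚ.n<1+n _) (ℕₚ.n<1+n _)

path-fine : ∀ m s k → 1 ℕ.≤ s → s ℕ.+ k ℕ.≤ m → All (Fine m) (path s k)
path-fine m s zero    p q = []
path-fine m s (suc k) p q = (ℕₚ.<⇒≢ (ℕₚ.n<1+n s) , (p , ℕₚ.≤-trans (ℕₚ.m≤m+n s (suc k)) q) , (ℕ.s≤s ℕ.z≤n , ℕₚ.≤-trans (ℕₚ.m≤m+n (suc s) k) q′))
  ∷ path-fine m (suc s) k (ℕ.s≤s ℕ.z≤n) q′
  where
  q′ : suc s ℕ.+ k ℕ.≤ m
  q′ = subst (ℕ._≤ m) (ℕₚ.+-suc s k) q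

stdWord-fine : ∀ r {π} d → 1 ℕ.≤ r → All (0 ℕ.<_) π → sum π ≡ suc r → All (Fine (suc r)) (stdWord (suc r) π (stdArrows (suc r) π d))
stdWord-fine r {[]}    d 1≤r pos ()
stdWord-fine r {k ∷ κ} d 1≤r pos total = subst (All (Fine (suc r))) (sym (stdWord-split r k κ d))
  (Allₚ.++⁺ (path-fine (suc r) 1 r ℕₚ.≤-refl ℕₚ.≤-refl)
    (Allₚ.++⁺ (subst (All (Fine (suc r))) (chain-applyUpTo (suc r) k κ)
        (Allₚ.applyUpTo⁺₁ _ (length κ) (λ p → vtx-≢ (ℕₚ.<-trans p (ℕₚ.n<1+n _)) , vtx-range (ℕₚ.<-trans p (ℕₚ.n<1+n _)) , vtx-range (ℕ.s≤s p))))
      (Allₚ.applyUpTo⁺₁ _ (2 ℕ.* d) (λ {i} _ → pf (even? (suc i)) (α-fine r 1≤r pos total)))))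
  where
  open StdVertices pos total
  pf : ∀ b {s t} → Fine (suc r) (s , t) → Fine (suc r) ((if b then s else t) , (if b then t else s))
  pf true  f = f
  pf false (p , a , b) = (p ∘ sym) , b , a

-- The arrows i become a star at m through all other vertices in descending order. The arrows j
-- become star letters at the heads in reverse order, exactly the closing letters that `unnest`
-- hands to the blocks.
std-normal : ∀ r {π} d → 1 ℕ.≤ r → All (0 ℕ.<_) π → sum π ≡ suc r →
  Σ (NormalForm (stdWord (suc r) π (stdArrows (suc r) π d))) λ N → sizes N ≡ π × length (D N) ≡ d × A N ++ lets (Bs N) ≢ []
std-normal r {[]} d 1≤r pos ()
std-normal r {suc k ∷ κ} d 1≤r pos@(_ ∷ posκ) total =
  mkNF m X Bs₀ (replicate d (α m π))
    (_ ≡∼⟨ stdWord-split r (suc k) κ d ⟩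
     path 1 r ++ chain m (heads Bs₀) ++ ks
       ∼⟨ path-stars 1 r _ refl ⟩
     stars m (down 1 r) ++ chain m (heads Bs₀) ++ ks
       ≡∼⟨ trans (cong (λ Z → stars m Z ++ chain m (heads Bs₀) ++ ks) (trans (down≡dn 1 r) (sym letters))) (stars-++ m X (lets Bs₀) _) ⟩
     stars m X ++ stars m (lets Bs₀) ++ chain m (heads Bs₀) ++ ks
       ∼⟨ ∼-++ˡ (stars m X) (∼-++ˡ (stars m (lets Bs₀)) (∼trans (chain-stars (heads Bs₀) ks unH) (∼-++ˡ (stars m (reverse (heads Bs₀))) (pairs-dbl (α m π) d)))) ⟩
     stars m X ++ stars m (lets Bs₀) ++ stars m (reverse (heads Bs₀)) ++ dbl (replicate d (α m π))
       ∼⟨ ∼-++ˡ (stars m X) (unnest Bs₀ _ unB) ⟩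
     nf m X Bs₀ (replicate d (α m π)) ∎∼)
    un
    (replicate⁺ d (proj₁ fine , mem (proj₁ (proj₂ fine)) , mem (proj₂ (proj₂ fine)))) ,
  cong₂ _∷_ (cong suc (length-dn r k)) (sz-stdBlocks (r ∸ k) posκ) ,
  Lₚ.length-replicate d ,
  λ e → ne 1≤r (trans (sym letters) e)
  where
  m = suc r
  π = suc k ∷ κ
  X = dn r k
  Bs₀ = stdBlocks (r ∸ k) κ
  ks = applyUpTo (pairArrow (α m π)) (2 ℕ.* d)
  fine : Fine m (α m π)
  fine = α-fine r 1≤r pos total
  letters : X ++ lets Bs₀ ≡ dn r r
  letters = trans (cong (X ++_) (lets-stdBlocks (r ∸ k) posκ)) (trans (sym (dn-+ r k (sum κ))) (cong (dn r) (ℕₚ.suc-injective total)))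
  un : Unique (m ∷ X ++ lets Bs₀)
  un = subst (λ L → Unique (m ∷ L)) (sym letters) (dn-unique r r ℕₚ.≤-refl)
  tailU : Unique (m ∷ X ++ lets Bs₀) → Unique (m ∷ lets Bs₀)
  tailU (f ∷ u) = Allₚ.++⁻ʳ X f ∷ proj₁ (proj₂ (Unique-++⁻ X u))
  unB : Unique (m ∷ lets Bs₀)
  unB = tailU un
  freshHeads : ∀ {x} Bs → Fresh x (lets Bs) → Fresh x (heads Bs)
  freshHeads []             f = []
  freshHeads ((y , Y) ∷ Bs) (p ∷ f) = p ∷ freshHeads Bs (Allₚ.++⁻ʳ Y f)
  uniqueHeads : ∀ Bs → Unique (lets Bs) → Unique (heads Bs)
  uniqueHeads []             u = []
  uniqueHeads ((y , Y) ∷ Bs) (f ∷ u) = freshHeads Bs (Allₚ.++⁻ʳ Y f) ∷ uniqueHeads Bs (proj₁ (proj₂ (Unique-++⁻ Y u)))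
  headU : Unique (m ∷ lets Bs₀) → Unique (m ∷ heads Bs₀)
  headU (f ∷ u) = freshHeads Bs₀ f ∷ uniqueHeads Bs₀ u
  unH : Unique (m ∷ heads Bs₀)
  unH = headU unB
  mem : ∀ {x} → InRange m x → x ∈ m ∷ X ++ lets Bs₀
  mem {x} (p , q) = subst (λ L → x ∈ m ∷ L) (sym letters) (dn-∈ r p q)
  ne : ∀ {r} → 1 ℕ.≤ r → dn r r ≢ []
  ne (ℕ.s≤s _) ()

-- The Coxeter transformation and its traces

tr : ∀ {n} → (Vect n → Vect n) → ℤ
tr T = ∑ (λ i → T (𝐞 i) i)

tr-cong : ∀ {n} {T S : Vect n → Vect n} → (∀ x → T x ≗ᵥ S x) → tr T ≡ tr S
tr-cong e = ∑-cong λ i → e (𝐞 i) i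

-- The dimensions may differ. This serves in `tr-invariant`, for two words, and in `tr-sec`, where a
-- trace over arrows becomes one over vertices.
tr-comm : ∀ {a b} {T : Vect a → Vect b} {S : Vect b → Vect a} → Lin T → Lin S → tr (T ∘ S) ≡ tr (S ∘ T)
tr-comm {T = T} {S} t s = begin
  ∑ (λ i → T (S (𝐞 i)) i)                           ≡⟨ (∑-cong λ i → lin-expand t (S (𝐞 i)) i) ⟩
  ∑ (λ i → ∑ (λ j → S (𝐞 i) j * T (𝐞 j) i))         ≡⟨ ∑-swap (λ i j → S (𝐞 i) j * T (𝐞 j) i) ⟩
  ∑ (λ j → ∑ (λ i → S (𝐞 i) j * T (𝐞 j) i))         ≡⟨ (∑-cong λ j → trans (∑-cong λ i → ℤₚ.*-comm (S (𝐞 i) j) (T (𝐞 j) i)) (sym (lin-expand s (T (𝐞 j)) j))) ⟩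
  ∑ (λ j → S (T (𝐞 j)) j)                           ∎

iter : ∀ {A : Set} → (A → A) → ℕ → A → A
iter f zero    x = x
iter f (suc k) x = f (iter f k x)

iter-lin : ∀ {n} {T : Vect n → Vect n} → Lin T → ∀ k → Lin (iter T k)
iter-lin t zero    = id-lin
iter-lin t (suc k) = ∘-lin t (iter-lin t k)

-- cox w c x solves A y = − Aᵀ x − (pairing with c), with A the matrix of M w: the context c collects
-- the arrows to the left of w. In particular cox w 0 is the Coxeter transformation − A⁻¹ Aᵀ.
cox : (w : Word) → (ℕ → ℤ) → Vect (length w) → Vect (length w)
cox []      c x = x
cox (v ∷ w) c x = vcons (- x fzero - br v (λ a → c a + V w ys a)) ys
  where ys = cox w (λ a → c a + x fzero * ar v a) (vtl x)

Φ : (w : Word) → Vect (length w) → Vect (length w)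
Φ w = cox w (λ _ → 0ℤ)

V-add : ∀ w x y c → V w (x +ᵥ y) c ≡ V w x c + V w y c
V-add []      x y c = refl
V-add (v ∷ w) x y c = trans (cong₂ _+_ (ℤₚ.*-distribʳ-+ (ar v c) (x fzero) (y fzero)) (V-add w (vtl x) (vtl y) c))
  (+-interchange (x fzero * ar v c) (y fzero * ar v c) _ _)

V-scale : ∀ w k x c → V w (k ·ˢ x) c ≡ k * V w x c
V-scale []      k x c = sym (ℤₚ.*-zeroʳ k)
V-scale (v ∷ w) k x c = trans (cong₂ _+_ (ℤₚ.*-assoc k (x fzero) (ar v c)) (V-scale w k (vtl x) c))
  (sym (ℤₚ.*-distribˡ-+ k (x fzero * ar v c) _))

cox-ext : ∀ w {c d x y} → (∀ a → c a ≡ d a) → x ≗ᵥ y → cox w c x ≗ᵥ cox w d y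
cox-ext (v ∷ w) {c} {d} {x} {y} e h = λ
  { fzero    → cong₂ (λ p q → - p - q) (h fzero) (br-cong v λ a → cong₂ _+_ (e a) (V-ext w rec a))
  ; (fsuc i) → rec i }
  where
  rec = cox-ext w (λ a → cong₂ (λ p q → p + q * ar v a) (e a) (h fzero)) (h ∘ fsuc)

cox-add : ∀ w c d x y → cox w (λ a → c a + d a) (x +ᵥ y) ≗ᵥ (cox w c x +ᵥ cox w d y)
cox-add (v@(s , t) ∷ w) c d x y = λ
  { fzero    → trans (cong (λ q → - (x fzero + y fzero) - q) (br-cong v λ a → trans (cong (c a + d a +_) (trans (V-ext w rec a) (V-add w X Y a))) (+-interchange (c a) (d a) (V w X a) (V w Y a))))
      (lem₂ (x fzero) (y fzero) (c s + V w X s) (d s + V w Y s) (c t + V w X t) (d t + V w Y t))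
  ; (fsuc i) → rec i }
  where
  lem₁ : ∀ c d x y r → c + d + (x + y) * r ≡ (c + x * r) + (d + y * r)
  lem₁ = solve-∀
  lem₂ : ∀ x y p q r s → - (x + y) - ((p + q) - (r + s)) ≡ (- x - (p - r)) + (- y - (q - s))
  lem₂ = solve-∀
  X = cox w (λ a → c a + x fzero * ar v a) (vtl x)
  Y = cox w (λ a → d a + y fzero * ar v a) (vtl y)
  rec : cox w (λ a → c a + d a + (x fzero + y fzero) * ar v a) (vtl x +ᵥ vtl y) ≗ᵥ (X +ᵥ Y)
  rec i = trans (cox-ext w (λ a → lem₁ (c a) (d a) (x fzero) (y fzero) (ar v a)) (λ _ → refl) i)
    (cox-add w (λ a → c a + x fzero * ar v a) (λ a → d a + y fzero * ar v a) (vtl x) (vtl y) i)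

cox-scale : ∀ w k c x → cox w (λ a → k * c a) (k ·ˢ x) ≗ᵥ (k ·ˢ cox w c x)
cox-scale (v@(s , t) ∷ w) k c x = λ
  { fzero    → trans (cong (λ q → - (k * x fzero) - q) (br-cong v λ a → trans (cong (k * c a +_) (trans (V-ext w rec a) (V-scale w k X a))) (sym (ℤₚ.*-distribˡ-+ k (c a) (V w X a)))))
      (lem₂ k (x fzero) (c s + V w X s) (c t + V w X t))
  ; (fsuc i) → rec i }
  where
  lem₁ : ∀ k c x r → k * c + k * x * r ≡ k * (c + x * r)
  lem₁ = solve-∀
  lem₂ : ∀ k x p q → - (k * x) - (k * p - k * q) ≡ k * (- x - (p - q))
  lem₂ = solve-∀
  X = cox w (λ a → c a + x fzero * ar v a) (vtl x)
  rec : cox w (λ a → k * c a + k * x fzero * ar v a) (k ·ˢ vtl x) ≗ᵥ (k ·ˢ X)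
  rec i = trans (cox-ext w (λ a → lem₁ k (c a) (x fzero) (ar v a)) (λ _ → refl) i)
    (cox-scale w k (λ a → c a + x fzero * ar v a) (vtl x) i)

Φ-lin : ∀ w → Lin (Φ w)
Φ-lin w = record
  { ext   = cox-ext w (λ _ → refl)
  ; add   = cox-add w (λ _ → 0ℤ) (λ _ → 0ℤ)
  ; scale = λ k x i → trans (cox-ext w {y = k ·ˢ x} (λ _ → sym (ℤₚ.*-zeroʳ k)) (λ _ → refl) i) (cox-scale w k (λ _ → 0ℤ) x i) }

perm : Word → ℕ → ℕ
perm []            a = a
perm ((c , d) ∷ w) a = perm w (τ c d a)

-- Each letter contributes one reflection, that is one transposition. The context `c` is general
-- because the recursion adds the first arrow to it.
cox-perm : ∀ w → All Proper w → ∀ c x a → c a + V w (cox w c x) a ≡ c (perm w a) + V w x (perm w a)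
cox-perm []                  []       c x a = refl
cox-perm (v@(s , t) ∷ w) (p ∷ ps) c x a = begin
  c a + ((- x₀ - (c s + Y s - (c t + Y t))) * ar v a + Y a)
    -- The new first coordinate makes the vector the reflection of `h` in v; the two sides differ by
    -- a multiple of ⟨v , v⟩ - 2 = 0.
    ≡⟨ lem₁ x₀ (c a) (c s) (c t) (Y a) (Y s) (Y t) (ar v a) (ar v s) (ar v t) (br-self v p) ⟩
  h a - ar v a * (h s - h t)
    ≡⟨ sym (τ-reflection p h a) ⟩
  h (τ s t a)
    ≡⟨ cox-perm w ps (λ b → c b + x₀ * ar v b) (vtl x) (τ s t a) ⟩
  c b + x₀ * ar v b + V w (vtl x) b
    ≡⟨ ℤₚ.+-assoc (c b) (x₀ * ar v b) (V w (vtl x) b) ⟩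
  c b + (x₀ * ar v b + V w (vtl x) b) ∎
  where
  x₀ = x fzero
  Y = V w (cox w (λ b → c b + x₀ * ar v b) (vtl x))
  b = perm w (τ s t a)
  h : ℕ → ℤ
  h b = c b + x₀ * ar v b + Y b
  lem₀ : ∀ x ca cs ct ya ys yt va vs vt →
    ca + ((- x - (cs + ys - (ct + yt))) * va + ya) ≡
    (ca + x * va + ya - va * ((cs + x * vs + ys) - (ct + x * vt + yt))) + x * va * ((vs - vt) - (ℤ.+ 2))
  lem₀ = solve-∀
  lem₁ : ∀ x ca cs ct ya ys yt va vs vt → vs - vt ≡ ℤ.+ 2 →
    ca + ((- x - (cs + ys - (ct + yt))) * va + ya) ≡ ca + x * va + ya - va * ((cs + x * vs + ys) - (ct + x * vt + yt))
  lem₁ x ca cs ct ya ys yt va vs vt e = trans (lem₀ x ca cs ct ya ys yt va vs vt)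
    (trans (cong (λ z → ca + x * va + ya - va * ((cs + x * vs + ys) - (ct + x * vt + yt)) + x * va * (z - (ℤ.+ 2))) e)
      (trans (cong (ca + x * va + ya - va * ((cs + x * vs + ys) - (ct + x * vt + yt)) +_) (ℤₚ.*-zeroʳ (x * va))) (ℤₚ.+-identityʳ _)))

Φ-perm : ∀ w → All Proper w → ∀ x a → V w (Φ w x) a ≡ V w x (perm w a)
Φ-perm w p x a = trans (sym (ℤₚ.+-identityˡ _)) (trans (cox-perm w p (λ _ → 0ℤ) x a) (ℤₚ.+-identityˡ _))

-- By hypothesis the context and the tail together contribute - x₀ v, whose pairing with v is - 2
-- x₀; the first coordinate is then - x₀ + 2 x₀. With c = 0 this covers the kernel of `V`.
cox-fixed : ∀ w → All Proper w → ∀ c x → (∀ a → c a + V w x a ≡ 0ℤ) → cox w c x ≗ᵥ x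
cox-fixed []                  []       c x h = λ ()
cox-fixed (v@(s , t) ∷ w) (p ∷ ps) c x h = λ
  { fzero    → trans (cong (λ q → - x₀ - q) (br-cong v λ a → cong (c a +_) (V-ext w rec a)))
      (lem₁ x₀ (c s + V w (vtl x) s) (c t + V w (vtl x) t) (ar v s) (ar v t) (trans (re (c s) (x₀ * ar v s) (V w (vtl x) s)) (h s)) (trans (re (c t) (x₀ * ar v t) (V w (vtl x) t)) (h t)) (br-self v p))
  ; (fsuc i) → rec i }
  where
  x₀ = x fzero
  rec : cox w (λ a → c a + x₀ * ar v a) (vtl x) ≗ᵥ vtl x
  rec = cox-fixed w ps (λ a → c a + x₀ * ar v a) (vtl x) (λ a → trans (ℤₚ.+-assoc (c a) (x₀ * ar v a) (V w (vtl x) a)) (h a))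
  re : ∀ a b c → (a + c) + b ≡ a + (b + c)
  re = solve-∀
  lem₀ : ∀ x p q vs vt → - x - (p - q) ≡ x + (- (p + x * vs) + (q + x * vt)) + x * ((vs - vt) - (ℤ.+ 2))
  lem₀ = solve-∀
  lem₁ : ∀ x p q vs vt → p + x * vs ≡ 0ℤ → q + x * vt ≡ 0ℤ → vs - vt ≡ ℤ.+ 2 → - x - (p - q) ≡ x
  lem₁ x p q vs vt e f g = trans (lem₀ x p q vs vt)
    (trans (cong₂ (λ a b → x + (- a + b) + x * ((vs - vt) - (ℤ.+ 2))) e f)
      (trans (cong (λ z → x + 0ℤ + x * (z - (ℤ.+ 2))) g) (lem₂ x)))
    where
    lem₂ : ∀ x → x + 0ℤ + x * 0ℤ ≡ x
    lem₂ = solve-∀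

pairing : (w : Word) → Vect (length w) → (ℕ → ℤ) → ℤ
pairing []      z c = 0ℤ
pairing (v ∷ w) z c = z fzero * br v c + pairing w (vtl z) c

pairing-0 : ∀ w z → pairing w z (λ _ → 0ℤ) ≡ 0ℤ
pairing-0 []            z = refl
pairing-0 ((a , b) ∷ w) z = cong₂ _+_ (ℤₚ.*-zeroʳ (z fzero)) (pairing-0 w (vtl z))

pairing-+ar : ∀ w z c k v → pairing w z (λ a → c a + k * ar v a) ≡ pairing w z c + k * br v (V w z)
pairing-+ar [] z c k (s , t) = sym (trans (ℤₚ.+-identityˡ _) (ℤₚ.*-zeroʳ k))
pairing-+ar (u@(a , b) ∷ w) z c k v@(s , t) =
  trans (cong (z fzero * ((c a + k * ar v a) - (c b + k * ar v b)) +_) (pairing-+ar w (vtl z) c k v))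
    (trans (lem (z fzero) k (c a) (c b) (ar v a) (ar v b) (pairing w (vtl z) c) (br v (V w (vtl z))))
      (cong (λ q → z fzero * (c a - c b) + pairing w (vtl z) c + k * q)
        (trans (cong (λ q → z fzero * q + br v (V w (vtl z))) (br-ar-sym u v)) (lem′ (z fzero) (ar u s) (ar u t) (V w (vtl z) s) (V w (vtl z) t)))))
  where
  lem : ∀ z k ca cb va vb p r → z * ((ca + k * va) - (cb + k * vb)) + (p + k * r) ≡ z * (ca - cb) + p + k * (z * (va - vb) + r)
  lem = solve-∀
  lem′ : ∀ z p q r s → z * (p - q) + (r - s) ≡ (z * p + r) - (z * q + s)
  lem′ = solve-∀

cox-adjoint : ∀ w c x z → M w z (cox w c x) ≡ - M w x z - pairing w z c
cox-adjoint [] c x z = refl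
cox-adjoint (v@(s , t) ∷ w) c x z =
  trans (cong (z₀ * (- x₀ - (c s + V w Y s - (c t + V w Y t))) + z₀ * (V w Y s - V w Y t) +_)
    (trans (cox-adjoint w c′ (vtl x) (vtl z)) (cong (λ q → - M w (vtl x) (vtl z) - q) (pairing-+ar w (vtl z) c x₀ v))))
  (lem z₀ x₀ (c s) (c t) (V w Y s) (V w Y t) (M w (vtl x) (vtl z)) (pairing w (vtl z) c) (br v (V w (vtl z))))
  where
  x₀ = x fzero
  z₀ = z fzero
  c′ : ℕ → ℤ
  c′ a = c a + x₀ * ar v a
  Y = cox w c′ (vtl x)
  lem : ∀ z x cs ct ys yt m p r → z * (- x - (cs + ys - (ct + yt))) + z * (ys - yt) + (- m - (p + x * r)) ≡
    - (x * z + x * r + m) - (z * (cs - ct) + p)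
  lem = solve-∀

Φ-adjoint : ∀ w x z → M w z (Φ w x) ≡ - M w x z
Φ-adjoint w x z = trans (cox-adjoint w (λ _ → 0ℤ) x z) (trans (cong (λ q → - M w x z - q) (pairing-0 w z)) (ℤₚ.+-identityʳ _))

M-zeroˡ : ∀ w {x} y → (∀ i → x i ≡ 0ℤ) → M w x y ≡ 0ℤ
M-zeroˡ []      y e = refl
M-zeroˡ (v ∷ w) {x} y e = cong₂ _+_
  (cong₂ _+_ (trans (cong (_* y fzero) (e fzero)) (ℤₚ.*-zeroˡ (y fzero))) (trans (cong (_* br v (V w (vtl y))) (e fzero)) (ℤₚ.*-zeroˡ (br v (V w (vtl y))))))
  (M-zeroˡ w (vtl y) (e ∘ fsuc))

-- The matrix is unitriangular: vectors with first coordinate 0 determine the tail, and then the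
-- first basis vector determines the first coordinate.
M-nondegenerate : ∀ w {y y′} → (∀ z → M w z y ≡ M w z y′) → y ≗ᵥ y′
M-nondegenerate [] h = λ ()
M-nondegenerate (v ∷ w) {y} {y′} h = λ { fzero → first ; (fsuc i) → rec i }
  where
  low : ∀ z q → M (v ∷ w) (vcons 0ℤ z) q ≡ M w z (vtl q)
  low z q = lem (q fzero) (br v (V w (vtl q))) (M w z (vtl q))
    where
    lem : ∀ a b c → 0ℤ * a + 0ℤ * b + c ≡ c
    lem = solve-∀
  high : ∀ q → M (v ∷ w) (vcons 1ℤ (λ _ → 0ℤ)) q ≡ q fzero + br v (V w (vtl q))
  high q = trans (cong (1ℤ * q fzero + 1ℤ * br v (V w (vtl q)) +_) (M-zeroˡ w {λ _ → 0ℤ} (vtl q) (λ _ → refl))) (lem (q fzero) (br v (V w (vtl q))))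
    where
    lem : ∀ a b → 1ℤ * a + 1ℤ * b + 0ℤ ≡ a + b
    lem = solve-∀
  rec : vtl y ≗ᵥ vtl y′
  rec = M-nondegenerate w (λ z → trans (sym (low z y)) (trans (h (vcons 0ℤ z)) (low z y′)))
  B = br v (V w (vtl y))
  first : y fzero ≡ y′ fzero
  first = +-cancelˡ B (y fzero) (y′ fzero) (begin
    B + y fzero                                       ≡⟨ ℤₚ.+-comm B (y fzero) ⟩
    y fzero + B                                       ≡⟨ sym (high y) ⟩
    M (v ∷ w) (vcons 1ℤ (λ _ → 0ℤ)) y                 ≡⟨ h (vcons 1ℤ (λ _ → 0ℤ)) ⟩
    M (v ∷ w) (vcons 1ℤ (λ _ → 0ℤ)) y′                ≡⟨ high y′ ⟩
    y′ fzero + br v (V w (vtl y′))                    ≡⟨ cong (y′ fzero +_) (br-cong v (λ a → sym (V-ext w rec a))) ⟩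
    y′ fzero + B                                      ≡⟨ ℤₚ.+-comm (y′ fzero) B ⟩
    B + y′ fzero                                      ∎)

-- By nondegeneracy Φ is determined by `Φ-adjoint`, which mentions nothing but the form; hence every
-- isometry commutes with it.
Φ-natural : ∀ w w′ (g : M w ≅ M w′) x → to g (Φ w′ x) ≗ᵥ Φ w (to g x)
Φ-natural w w′ g x = M-nondegenerate w λ z → begin
  M w z (to g (Φ w′ x))                         ≡⟨ M-ext w {y = to g (Φ w′ x)} (λ i → sym (to-from g z i)) (λ _ → refl) ⟩
  M w (to g (from g z)) (to g (Φ w′ x))         ≡⟨ sym (isom g (from g z) (Φ w′ x)) ⟩
  M w′ (from g z) (Φ w′ x)                      ≡⟨ Φ-adjoint w′ x (from g z) ⟩
  - M w′ x (from g z)                           ≡⟨ cong -_ (isom g x (from g z)) ⟩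
  - M w (to g x) (to g (from g z))              ≡⟨ cong -_ (M-ext w {x = to g x} (λ _ → refl) (to-from g z)) ⟩
  - M w (to g x) z                              ≡⟨ sym (Φ-adjoint w (to g x) z) ⟩
  M w z (Φ w (to g x))                          ∎

iter-natural : ∀ w w′ (g : M w ≅ M w′) k x → to g (iter (Φ w′) k x) ≗ᵥ iter (Φ w) k (to g x)
iter-natural _ _ g zero    x i = refl
iter-natural w w′ g (suc k) x i = trans (Φ-natural w w′ g (iter (Φ w′) k x) i) (ext (Φ-lin w) (iter-natural w w′ g k x) i)

tr-invariant : ∀ w w′ → M w ≅ M w′ → ∀ k → tr (iter (Φ w) k) ≡ tr (iter (Φ w′) k)
tr-invariant w w′ g k = begin
  tr (iter (Φ w) k)                        ≡⟨ (tr-cong λ x i → ext (iter-lin (Φ-lin w) k) (λ j → sym (to-from g x j)) i) ⟩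
  tr ((iter (Φ w) k ∘ to g) ∘ from g)      ≡⟨ tr-comm (∘-lin (iter-lin (Φ-lin w) k) (to-lin g)) (from-lin g) ⟩
  tr (from g ∘ iter (Φ w) k ∘ to g)        ≡⟨ (tr-cong λ x i → trans (ext (from-lin g) (λ j → sym (iter-natural w w′ g k x j)) i) (from-to g (iter (Φ w′) k x) i)) ⟩
  tr (iter (Φ w′) k)                       ∎

-- The trace of the powers of Φ

iter-comm : ∀ {A : Set} (f : A → A) k x → iter f k (f x) ≡ f (iter f k x)
iter-comm f zero    x = refl
iter-comm f (suc k) x = cong f (iter-comm f k x)

permInv : Word → ℕ → ℕ
permInv []            a = a
permInv ((c , d) ∷ w) a = τ c d (permInv w a)

perm-permInv : ∀ w a → perm w (permInv w a) ≡ a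
perm-permInv []            a = refl
perm-permInv ((c , d) ∷ w) a = trans (cong (perm w) (τ-invol c d (permInv w a))) (perm-permInv w a)

permInv-perm : ∀ w a → permInv w (perm w a) ≡ a
permInv-perm []            a = refl
permInv-perm ((c , d) ∷ w) a = trans (cong (τ c d) (permInv-perm w (τ c d a))) (τ-invol c d a)

permInv-resp : ∀ {P : ℕ → Set} {w} → All (Ends P) w → ∀ {a} → P a → P (permInv w a)
permInv-resp []                           pa = pa
permInv-resp {P} {(c , d) ∷ w} ((pc , pd) ∷ ps) {a} pa = τ-resp {P} (permInv w a) pc pd (permInv-resp ps pa)

iter-resp : ∀ {P : ℕ → Set} {f} → (∀ {a} → P a → P (f a)) → ∀ k {a} → P a → P (iter f k a)
iter-resp h zero    p = p
iter-resp {P} {f} h (suc k) p = h (iter-resp {P} {f} h k p)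

iter-inverse : ∀ {f g : ℕ → ℕ} → (∀ a → f (g a) ≡ a) → ∀ k a → iter f k (iter g k a) ≡ a
iter-inverse h zero    a = refl
iter-inverse {f} {g} h (suc k) a = trans (sym (iter-comm f k (g (iter g k a)))) (trans (cong (iter f k) (h (iter g k a))) (iter-inverse h k a))

dl-iff : ∀ {a b c d} → (a ≡ b → c ≡ d) → (c ≡ d → a ≡ b) → dl a b ≡ dl c d
dl-iff {a} {b} {c} {d} f g with a ℕ.≟ b
... | yes refl = trans (dl-refl a) (sym (trans (cong (dl c) (sym (f refl))) (dl-refl c)))
... | no  a≢b  = trans (dl-≢ a≢b) (sym (dl-≢ (a≢b ∘ g)))

-- The vectors e_a - e_0 generate the sum-zero lattice on the vertices 0, ..., m, so `reach` says
-- that the arrows generate it.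
record Spanning (m : ℕ) (w : Word) : Set where
  field
    sproper  : All Proper w
    sends    : All (Ends (Vertex₀ (suc m))) w
    reach    : Fin (suc m) → Vect (length w)
    V-reach  : ∀ a c → V w (reach a) c ≡ dl c (toℕ a) - dl c 0

module Trace {m w} (sp : Spanning m w) where
  open Spanning sp

  p : ℕ → ℕ
  p = perm w

  n : ℕ
  n = length w

  Φᵏ : ℕ → Vect n → Vect n
  Φᵏ = iter (Φ w)

  V-iter : ∀ k x a → V w (Φᵏ k x) a ≡ V w x (iter p k a)
  V-iter zero    x a = refl
  V-iter (suc k) x a = trans (Φ-perm w sproper (Φᵏ k x) a) (trans (V-iter k x (p a)) (cong (V w x) (iter-comm p k a)))

  Vₘ : Vect n → Vect (suc m)
  Vₘ x a = V w x (toℕ a)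

  Vₘ-lin : Lin Vₘ
  Vₘ-lin = record { ext = λ e a → V-ext w e (toℕ a) ; add = λ x y a → V-add w x y (toℕ a) ; scale = λ k x a → V-scale w k x (toℕ a) }

  -- Sends e_a to a preimage of e_a - e_0. On sum-zero vectors, in particular on the image of `Vₘ`,
  -- it is a right inverse of `Vₘ`.
  sec : Vect (suc m) → Vect n
  sec = (λ i a → reach a i) ·ᵥ_

  sec-lin : Lin sec
  sec-lin = ·ᵥ-lin (λ i a → reach a i)

  V-sec-𝐞 : ∀ a c → V w (sec (𝐞 a)) c ≡ dl c (toℕ a) - dl c 0
  V-sec-𝐞 a c = trans (V-ext w (·ᵥ-𝐞 (λ i a → reach a i) a) c) (V-reach a c)

  V-sec : ∀ y c → V w (sec y) c ≡ ∑ (λ a → y a * (dl c (toℕ a) - dl c 0))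
  V-sec y c = trans (lin-expand functional y fzero) (∑-cong λ a → cong (y a *_) (V-sec-𝐞 a c))
    where
    functional : Lin {suc m} {1} (λ y _ → V w (sec y) c)
    functional = record
      { ext = λ e _ → V-ext w (ext sec-lin e) c
      ; add = λ x y _ → trans (V-ext w (add sec-lin x y) c) (V-add w (sec x) (sec y) c)
      ; scale = λ k x _ → trans (V-ext w (scale sec-lin k x) c) (V-scale w k (sec x) c) }

  -- A combination of arrows has coordinate sum zero and is supported on the vertices, so the terms
  -- in e_0 cancel.
  V-expand : ∀ u → All (Ends (Vertex₀ (suc m))) u → ∀ x c → V u x c ≡ ∑ {suc m} (λ a → V u x (toℕ a) * (dl c (toℕ a) - dl c 0))
  V-expand []            []       x c = sym (∑-zero {suc m} (λ a → ℤₚ.*-zeroˡ (dl c (toℕ a) - dl c 0)))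
  V-expand (v@(s , t) ∷ u) (e ∷ es) x c = sym (begin
    ∑ {suc m} (λ a → (x₀ * ar v (toℕ a) + V u (vtl x) (toℕ a)) * h (toℕ a))
      ≡⟨ (∑-cong {suc m} λ a → lem₁ x₀ (ar v (toℕ a)) (V u (vtl x) (toℕ a)) (h (toℕ a))) ⟩
    ∑ {suc m} (λ a → x₀ * (ar v (toℕ a) * h (toℕ a)) + V u (vtl x) (toℕ a) * h (toℕ a))
      ≡⟨ ∑-+ {suc m} (λ a → x₀ * (ar v (toℕ a) * h (toℕ a))) (λ a → V u (vtl x) (toℕ a) * h (toℕ a)) ⟩
    ∑ {suc m} (λ a → x₀ * (ar v (toℕ a) * h (toℕ a))) + ∑ {suc m} (λ a → V u (vtl x) (toℕ a) * h (toℕ a))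
      ≡⟨ cong₂ _+_ (trans (∑-*ˡ {suc m} x₀ (λ a → ar v (toℕ a) * h (toℕ a))) (cong (x₀ *_) (trans (∑-ar₀ v e h) (lem₂ (dl c s) (dl c t) (dl c 0))))) (sym (V-expand u es (vtl x) c)) ⟩
    x₀ * ar v c + V u (vtl x) c ∎)
    where
    x₀ = x fzero
    h : ℕ → ℤ
    h a = dl c a - dl c 0
    lem₁ : ∀ x a v h → (x * a + v) * h ≡ x * (a * h) + v * h
    lem₁ = solve-∀
    lem₂ : ∀ a b z → (a - z) - (b - z) ≡ a - b
    lem₂ = solve-∀

  -- In the splitting x = sec (Vₘ x) + residue x the second summand lies in the kernel of `V`, where
  -- Φ is the identity.
  residue : Vect n → Vect n
  residue x i = x i - sec (Vₘ x) i

  residue-fixed : ∀ k x → Φᵏ k (residue x) ≗ᵥ residue x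
  residue-fixed zero    x i = refl
  residue-fixed (suc k) x i = trans (ext (Φ-lin w) (residue-fixed k x) i) (cox-fixed w sproper (λ _ → 0ℤ) (residue x) vanishes i)
    where
    lem : ∀ a b → a - b ≡ a + (- 1ℤ) * b
    lem = solve-∀
    vanishes : ∀ a → 0ℤ + V w (residue x) a ≡ 0ℤ
    vanishes a = begin
      0ℤ + V w (residue x) a                                      ≡⟨ ℤₚ.+-identityˡ _ ⟩
      V w (residue x) a                                           ≡⟨ V-ext w (λ i → lem (x i) (sec (Vₘ x) i)) a ⟩
      V w (x +ᵥ ((- 1ℤ) ·ˢ sec (Vₘ x))) a                         ≡⟨ V-add w x ((- 1ℤ) ·ˢ sec (Vₘ x)) a ⟩
      V w x a + V w ((- 1ℤ) ·ˢ sec (Vₘ x)) a                      ≡⟨ cong (V w x a +_) (V-scale w (- 1ℤ) (sec (Vₘ x)) a) ⟩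
      V w x a + (- 1ℤ) * V w (sec (Vₘ x)) a                       ≡⟨ cong (λ z → V w x a + (- 1ℤ) * z) (trans (V-sec (Vₘ x) a) (sym (V-expand w sends x a))) ⟩
      V w x a + (- 1ℤ) * V w x a                                  ≡⟨ sym (lem (V w x a) (V w x a)) ⟩
      V w x a - V w x a                                           ≡⟨ ℤₚ.+-inverseʳ (V w x a) ⟩
      0ℤ                                                          ∎

  fix : ℕ → ℤ
  fix k = ∑ {suc m} (λ a → dl (iter p k (toℕ a)) (toℕ a))

  -- The k-th power of p permutes the vertices, so exactly one of them goes to 0: the image of 0
  -- under the inverse power.
  returns : ∀ k → ∑ {suc m} (λ a → dl (iter p k (toℕ a)) 0) ≡ 1ℤ
  returns k with iter-resp {Vertex₀ (suc m)} {permInv w} (permInv-resp sends) k (fzero , refl)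
  ... | b , e = trans (∑-cong {suc m} λ a → trans (dl-iff
      (λ h → trans (sym (iter-inverse (permInv-perm w) k (toℕ a))) (cong (iter (permInv w) k) h))
      (λ h → trans (cong (iter p k) h) (iter-inverse (perm-permInv w) k 0))) (cong (dl (toℕ a)) e)) (∑-ones b)

  -- Turned around, the trace runs over vertices, and its term at a is the coordinate of e_a - e_0
  -- at the k-th image of a.
  tr-sec : ∀ k → tr (Φᵏ k ∘ sec ∘ Vₘ) ≡ fix k - 1ℤ
  tr-sec k = begin
    tr ((Φᵏ k ∘ sec) ∘ Vₘ)       ≡⟨ tr-comm (∘-lin (iter-lin (Φ-lin w) k) sec-lin) Vₘ-lin ⟩
    tr (Vₘ ∘ Φᵏ k ∘ sec)         ≡⟨ (∑-cong {suc m} λ a → trans (V-iter k (sec (𝐞 a)) (toℕ a)) (V-sec-𝐞 a (iter p k (toℕ a)))) ⟩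
    ∑ {suc m} (λ a → dl (iter p k (toℕ a)) (toℕ a) - dl (iter p k (toℕ a)) 0)
      ≡⟨ ∑-- {suc m} (λ a → dl (iter p k (toℕ a)) (toℕ a)) (λ a → dl (iter p k (toℕ a)) 0) ⟩
    fix k - ∑ {suc m} (λ a → dl (iter p k (toℕ a)) 0)   ≡⟨ cong (λ z → fix k - z) (returns k) ⟩
    fix k - 1ℤ                   ∎

  tr-id : tr {n} id ≡ ℤ.+ n
  tr-id = trans (∑-cong {n} λ i → dl-refl (toℕ i)) (∑-const1 n)

  fix-0 : fix 0 ≡ ℤ.+ (suc m)
  fix-0 = trans (∑-cong {suc m} λ a → dl-refl (toℕ a)) (∑-const1 (suc m))

  trace-formula : ∀ k → tr (Φᵏ k) ≡ fix k + (ℤ.+ n - ℤ.+ (suc m))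
  trace-formula k = begin
    tr (Φᵏ k)                                                        ≡⟨ (∑-cong λ i → decompose (𝐞 i) i) ⟩
    ∑ (λ i → Φᵏ k (sec (Vₘ (𝐞 i))) i + (𝐞 i i - sec (Vₘ (𝐞 i)) i))   ≡⟨ ∑-+ (λ i → Φᵏ k (sec (Vₘ (𝐞 i))) i) (λ i → 𝐞 i i - sec (Vₘ (𝐞 i)) i) ⟩
    tr (Φᵏ k ∘ sec ∘ Vₘ) + ∑ (λ i → 𝐞 i i - sec (Vₘ (𝐞 i)) i)        ≡⟨ cong₂ _+_ (tr-sec k) (∑-- (λ i → 𝐞 i i) (λ i → sec (Vₘ (𝐞 i)) i)) ⟩
    -- The residue contributes the trace of id - sec ∘ Vₘ; the case of power 0 of `tr-sec` evaluates
    -- the second term.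
    (fix k - 1ℤ) + (tr {n} id - tr (sec ∘ Vₘ))                       ≡⟨ cong₂ (λ a b → (fix k - 1ℤ) + (a - b)) tr-id (tr-sec 0) ⟩
    (fix k - 1ℤ) + (ℤ.+ n - (fix 0 - 1ℤ))                            ≡⟨ cong (λ z → (fix k - 1ℤ) + (ℤ.+ n - (z - 1ℤ))) fix-0 ⟩
    (fix k - 1ℤ) + (ℤ.+ n - (ℤ.+ (suc m) - 1ℤ))                      ≡⟨ lem (fix k) (ℤ.+ n) (ℤ.+ (suc m)) ⟩
    fix k + (ℤ.+ n - ℤ.+ (suc m))                                    ∎
    where
    lem : ∀ f n m → (f - 1ℤ) + (n - (m - 1ℤ)) ≡ f + (n - m)
    lem = solve-∀
    lem′ : ∀ a b → a ≡ b + (a - b)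
    lem′ = solve-∀
    decompose : ∀ x i → Φᵏ k x i ≡ Φᵏ k (sec (Vₘ x)) i + residue x i
    decompose x i = trans (ext (iter-lin (Φ-lin w) k) (λ j → lem′ (x j) (sec (Vₘ x) j)) i)
      (trans (add (iter-lin (Φ-lin w) k) (sec (Vₘ x)) (residue x) i) (cong (Φᵏ k (sec (Vₘ x)) i +_) (residue-fixed k x i)))

fix-invariant : ∀ m w w′ (s : Spanning m w) (s′ : Spanning m w′) → M w ≅ M w′ → ∀ k → Trace.fix s k ≡ Trace.fix s′ k
fix-invariant m w w′ s s′ g k = +-cancelˡ shift (Trace.fix s k) (Trace.fix s′ k) (begin
  shift + Trace.fix s k      ≡⟨ ℤₚ.+-comm shift (Trace.fix s k) ⟩
  Trace.fix s k + shift      ≡⟨ sym (Trace.trace-formula s k) ⟩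
  tr (iter (Φ w) k)          ≡⟨ tr-invariant w w′ g k ⟩
  tr (iter (Φ w′) k)         ≡⟨ Trace.trace-formula s′ k ⟩
  -- At power 0 the invariant is the trace of the identity, so isometric words have equal length.
  Trace.fix s′ k + (ℤ.+ (length w′) - ℤ.+ (suc m)) ≡⟨ cong (λ z → Trace.fix s′ k + (z - ℤ.+ (suc m))) (trans (sym (Trace.tr-id s′)) (trans (sym (tr-invariant w w′ g 0)) (Trace.tr-id s))) ⟩
  Trace.fix s′ k + shift     ≡⟨ ℤₚ.+-comm (Trace.fix s′ k) shift ⟩
  shift + Trace.fix s′ k     ∎)
  where shift = ℤ.+ (length w) - ℤ.+ (suc m)

-- Cycle type of the canonical words

range-≥ : ∀ s k → All (s ℕ.≤_) (range s k)
range-≥ s zero    = []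
range-≥ s (suc k) = ℕₚ.≤-refl ∷ All.map (ℕₚ.≤-trans (ℕₚ.n≤1+n s)) (range-≥ (suc s) k)

range-< : ∀ s k → All (ℕ._< s ℕ.+ k) (range s k)
range-< s zero    = []
range-< s (suc k) = ℕₚ.m<m+n s (ℕ.s≤s ℕ.z≤n) ∷ subst (λ t → All (ℕ._< t) (range (suc s) k)) (sym (ℕₚ.+-suc s k)) (range-< (suc s) k)

range-below : ∀ {a} s k → a ℕ.< s → Fresh a (range s k)
range-below s k p = All.map (λ q → ℕₚ.<⇒≢ (ℕₚ.<-≤-trans p q)) (range-≥ s k)

range-above : ∀ {a} s k → s ℕ.+ k ℕ.≤ a → Fresh a (range s k)
range-above s k p = All.map (λ q e → ℕₚ.<⇒≢ (ℕₚ.<-≤-trans q p) (sym e)) (range-< s k)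

range-++ : ∀ s a b → range s (a ℕ.+ b) ≡ range s a ++ range (s ℕ.+ a) b
range-++ s zero    b = cong (λ t → range t b) (sym (ℕₚ.+-identityʳ s))
range-++ s (suc a) b = cong (s ∷_) (trans (range-++ (suc s) a b) (cong (λ t → range (suc s) a ++ range t b) (sym (ℕₚ.+-suc s a))))

range-∈ : ∀ {a} s k → s ℕ.≤ a → a ℕ.< s ℕ.+ k → a ∈ range s k
range-∈ {a} s zero    p q = ⊥-elim (ℕₚ.<⇒≱ (subst (a ℕ.<_) (ℕₚ.+-identityʳ s) q) p)
range-∈ {a} s (suc k) p q with a ℕ.≟ s
... | yes e = here e
... | no  n = there (range-∈ (suc s) k (ℕₚ.≤∧≢⇒< p (n ∘ sym)) (subst (a ℕ.<_) (ℕₚ.+-suc s k) q))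

lets-canonBlocks : ∀ s {κ} → All (0 ℕ.<_) κ → lets (canonBlocks s κ) ≡ range s (sum κ)
lets-canonBlocks s []                     = refl
lets-canonBlocks s {suc k ∷ κ} (p ∷ ps) = trans (cong (range s (suc k) ++_) (lets-canonBlocks (s ℕ.+ suc k) ps)) (sym (range-++ s (suc k) (sum κ)))

reach-arrow : ∀ {v w} → v ∈ w → Σ (Vect (length w)) λ x → ∀ c → V w x c ≡ ar v c
reach-arrow {v} {.v ∷ w} (here refl) = 𝐞 fzero , λ c → trans (cong₂ _+_ (ℤₚ.*-identityˡ (ar v c)) (V-0 w c)) (ℤₚ.+-identityʳ (ar v c))
  where
  V-0 : ∀ w c → V w (λ _ → 0ℤ) c ≡ 0ℤ
  V-0 []      c = refl
  V-0 (u ∷ w) c = cong₂ _+_ (ℤₚ.*-zeroˡ (ar u c)) (V-0 w c)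
reach-arrow {v} {u ∷ w} (there i) = let x , h = reach-arrow i in
  vcons 0ℤ x , λ c → trans (cong₂ _+_ (ℤₚ.*-zeroˡ (ar u c)) (h c)) (ℤₚ.+-identityˡ (ar v c))

canon-spanning : ∀ r {κ} d → 1 ℕ.≤ r → All (0 ℕ.<_) κ → sum κ ≡ suc r → Spanning r (canon κ d)
canon-spanning r {[]} d 1≤r pos ()
canon-spanning r {suc k ∷ κ} d 1≤r (_ ∷ pos) total = record
  { sproper = nf-All X Bs₀ Ds (λ y∈ e → ℕₚ.<⇒≢ (proj₁ (bounds y∈)) e) (replicate⁺ d (λ ()))
  ; sends   = nf-All X Bs₀ Ds (λ y∈ → (fzero , refl) , vertex (proj₂ (bounds y∈))) (replicate⁺ d ((fzero , refl) , vertex (ℕ.s≤s 1≤r)))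
  ; reach   = λ a → proj₁ (path-to a)
  ; V-reach = λ a → proj₂ (path-to a) }
  where
  X = range 1 k
  Bs₀ = canonBlocks (suc k) κ
  Ds = replicate d (0 , 1)
  w = canon (suc k ∷ κ) d
  letters : X ++ lets Bs₀ ≡ range 1 r
  letters = trans (cong (X ++_) (lets-canonBlocks (suc k) pos)) (trans (sym (range-++ 1 k (sum κ))) (cong (range 1) (ℕₚ.suc-injective total)))
  bounds : ∀ {y} → y ∈ X ++ lets Bs₀ → 1 ℕ.≤ y × y ℕ.< suc r
  bounds {y} i = let j = subst (y ∈_) letters i in All.lookup (range-≥ 1 r) j , All.lookup (range-< 1 r) j
  vertex : ∀ {y} → y ℕ.< suc r → Vertex₀ (suc r) y
  vertex p = fromℕ< p , sym (Finₚ.toℕ-fromℕ< p)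
  path-to : ∀ (a : Fin (suc r)) → Σ (Vect (length w)) λ x → ∀ c → V w x c ≡ dl c (toℕ a) - dl c 0
  -- The zero vector appears as a multiple by 0 so that `V-scale` evaluates it.
  path-to fzero = (λ i → 0ℤ * 0ℤ) , λ c → trans (V-scale w 0ℤ (λ _ → 0ℤ) c) (trans (ℤₚ.*-zeroˡ (V w (λ _ → 0ℤ) c)) (sym (ℤₚ.+-inverseʳ (dl c 0))))
  path-to a@(fsuc a′) =
    let x , h = reach-arrow (nf-∈ 0 X Bs₀ Ds (subst (toℕ a ∈_) (sym letters) (range-∈ 1 r (ℕ.s≤s ℕ.z≤n) (Finₚ.toℕ<n a))))
    in ((- 1ℤ) ·ˢ x) , λ c → trans (V-scale w (- 1ℤ) x c) (trans (cong ((- 1ℤ) *_) (h c)) (lem (dl c 0) (dl c (toℕ a))))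
    where
    lem : ∀ p q → (- 1ℤ) * (p - q) ≡ q - p
    lem = solve-∀

perm-++ : ∀ v w a → perm (v ++ w) a ≡ perm w (perm v a)
perm-++ []            w a = refl
perm-++ ((c , d) ∷ v) w a = perm-++ v w (τ c d a)

perm-fresh : ∀ {ρ a} X → a ≢ ρ → Fresh a X → perm (stars ρ X) a ≡ a
perm-fresh []      p []       = refl
perm-fresh (x ∷ X) p (q ∷ qs) = trans (cong (perm (stars _ X)) (τ-o p q)) (perm-fresh X p qs)

-- For k ≥ 1 this is the cycle 0 → s → s+1 → ... → s+k-1 → 0, since `perm` applies the leftmost
-- letter first.
run : ℕ → ℕ → ℕ → ℕ
run s k = perm (stars 0 (range s k))

pos⇒≢0 : ∀ {s} → 0 ℕ.< s → s ≢ 0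
pos⇒≢0 p e = ℕₚ.<⇒≢ p (sym e)

run-root : ∀ s k → 0 ℕ.< s → run s (suc k) 0 ≡ s
run-root s k p = trans (cong (run (suc s) k) (τ-l 0 s)) (perm-fresh (range (suc s) k) (pos⇒≢0 p) (range-below (suc s) k (ℕₚ.n<1+n s)))

run-step : ∀ s k i → 0 ℕ.< s → run s (suc k) (s ℕ.+ suc i) ≡ run (suc s) k (suc s ℕ.+ i)
run-step s k i p = cong (run (suc s) k) (trans (τ-o (pos⇒≢0 (ℕₚ.<-≤-trans p (ℕₚ.m≤m+n s (suc i)))) (λ e → ℕₚ.<⇒≢ (ℕₚ.m<m+n s (ℕ.s≤s ℕ.z≤n)) (sym e))) (ℕₚ.+-suc s i))

run-first : ∀ s k → run s (suc k) (s ℕ.+ 0) ≡ run (suc s) k 0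
run-first s k = cong (run (suc s) k) (trans (cong (τ 0 s) (ℕₚ.+-identityʳ s)) (τ-r 0 s))

run-mid : ∀ s k i → 0 ℕ.< s → i ℕ.< k → run s (suc k) (s ℕ.+ i) ≡ s ℕ.+ suc i
run-mid s (suc k) zero    p q         = trans (run-first s (suc k)) (trans (run-root (suc s) k (ℕ.s≤s ℕ.z≤n)) (ℕₚ.+-comm 1 s))
run-mid s (suc k) (suc i) p (ℕ.s≤s q) = trans (run-step s (suc k) i p) (trans (run-mid (suc s) k i (ℕ.s≤s ℕ.z≤n) q) (sym (ℕₚ.+-suc s (suc i))))

run-last : ∀ s k → 0 ℕ.< s → run s (suc k) (s ℕ.+ k) ≡ 0
run-last s zero    p = run-first s zero
run-last s (suc k) p = trans (run-step s (suc k) k p) (run-last (suc s) k (ℕ.s≤s ℕ.z≤n))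

record Cycle (p : ℕ → ℕ) (s k : ℕ) : Set where
  field
    next : ∀ i → suc i ℕ.< k → p (s ℕ.+ i) ≡ s ℕ.+ suc i
    back : ∀ i → suc i ≡ k → p (s ℕ.+ i) ≡ s
open Cycle

Cycles : (ℕ → ℕ) → ℕ → List ℕ → Set
Cycles p s []      = ⊤
Cycles p s (k ∷ κ) = Cycle p s k × Cycles p (s ℕ.+ k) κ

Cycle-cong : ∀ {p q s k} → (∀ i → i ℕ.< k → p (s ℕ.+ i) ≡ q (s ℕ.+ i)) → Cycle q s k → Cycle p s k
Cycle-cong e c = record { next = λ i h → trans (e i (ℕₚ.<-trans (ℕₚ.n<1+n i) h)) (next c i h) ; back = λ { i refl → trans (e i (ℕₚ.n<1+n i)) (back c i refl) } }

Cycles-cong : ∀ {p q} s κ → (∀ a → s ℕ.≤ a → p a ≡ q a) → Cycles q s κ → Cycles p s κ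
Cycles-cong s []      e c       = tt
Cycles-cong {p} {q} s (k ∷ κ) e (c , cs) = Cycle-cong {p} {q} (λ i _ → e (s ℕ.+ i) (ℕₚ.m≤m+n s i)) c , Cycles-cong (s ℕ.+ k) κ (λ a h → e a (ℕₚ.≤-trans (ℕₚ.m≤m+n s k) h)) cs

-- The closing letter returns 0 to itself and sends the last element to s: it cuts 0 out of the
-- cycle of `run`.
blockPerm : ℕ → ℕ → ℕ → ℕ
blockPerm s k a = τ 0 s (run s (suc k) a)

blockPerm-low : ∀ s k a → 0 ℕ.< s → a ℕ.< s → blockPerm s k a ≡ a
blockPerm-low s k zero    p q = trans (cong (τ 0 s) (run-root s k p)) (τ-r 0 s)
blockPerm-low s k (suc a) p q = trans (cong (τ 0 s) (perm-fresh (range s (suc k)) (λ ()) (range-below s (suc k) q))) (τ-o {0} (λ ()) (ℕₚ.<⇒≢ q))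

blockPerm-high : ∀ s k a → 0 ℕ.< s → s ℕ.+ suc k ℕ.≤ a → blockPerm s k a ≡ a
blockPerm-high s k a p q = trans (cong (τ 0 s) (perm-fresh (range s (suc k)) (pos⇒≢0 0<a) (range-above s (suc k) q))) (τ-o (pos⇒≢0 0<a) (λ e → ℕₚ.<⇒≢ s<a (sym e)))
  where
  s<a : s ℕ.< a
  s<a = ℕₚ.<-≤-trans (ℕₚ.m<m+n s (ℕ.s≤s ℕ.z≤n)) q
  0<a : 0 ℕ.< a
  0<a = ℕₚ.<-trans p s<a

blockPerm-cycle : ∀ s k → 0 ℕ.< s → Cycle (blockPerm s k) s (suc k)
blockPerm-cycle s k p = record
  { next = λ { i (ℕ.s≤s q) → trans (cong (τ 0 s) (run-mid s k i p q)) (τ-o (pos⇒≢0 (ℕₚ.<-≤-trans p (ℕₚ.m≤m+n s (suc i)))) (λ e → ℕₚ.<⇒≢ (ℕₚ.m<m+n s (ℕ.s≤s ℕ.z≤n)) (sym e))) }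
  ; back = λ { i refl → trans (cong (τ 0 s) (run-last s i p)) (τ-l 0 s) } }

Cycle-< : ∀ {p s k} → Cycle p s k → ∀ i → i ℕ.< k → p (s ℕ.+ i) ℕ.< s ℕ.+ k
Cycle-< {p} {s} {k} c i h with suc i ℕ.≟ k
... | yes refl = subst (ℕ._< s ℕ.+ suc i) (sym (back c i refl)) (ℕₚ.m<m+n s (ℕ.s≤s ℕ.z≤n))
... | no  n    = subst (ℕ._< s ℕ.+ k) (sym (next c i (ℕₚ.≤∧≢⇒< h n))) (ℕₚ.+-monoʳ-< s (ℕₚ.≤∧≢⇒< h n))

-- Later blocks fix everything below their start, so the cycle of the first block survives; the
-- first block fixes everything above its interval, so the later cycles survive too.
blocks-perm : ∀ s {κ} u → 0 ℕ.< s → All (0 ℕ.<_) κ → (∀ a → perm u a ≡ a) →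
  (∀ a → a ℕ.< s → perm (blocks 0 (canonBlocks s κ) u) a ≡ a) × Cycles (perm (blocks 0 (canonBlocks s κ) u)) s κ
blocks-perm s u p [] triv = (λ a _ → triv a) , tt
blocks-perm s {suc k ∷ κ} u p (_ ∷ ps) triv = low , cyc , cycs
  where
  W = blocks 0 (canonBlocks (s ℕ.+ suc k) κ) u
  p′ : 0 ℕ.< s ℕ.+ suc k
  p′ = ℕₚ.<-≤-trans p (ℕₚ.m≤m+n s (suc k))
  rec = blocks-perm (s ℕ.+ suc k) u p′ ps triv
  split : ∀ a → perm (block 0 (s , range (suc s) k) W) a ≡ perm W (blockPerm s k a)
  split a = perm-++ (stars 0 (range s (suc k))) ((0 , s) ∷ W) a
  low : ∀ a → a ℕ.< s → perm (block 0 (s , range (suc s) k) W) a ≡ a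
  low a h = trans (split a) (trans (cong (perm W) (blockPerm-low s k a p h)) (proj₁ rec a (ℕₚ.<-≤-trans h (ℕₚ.m≤m+n s (suc k)))))
  cyc : Cycle (perm (block 0 (s , range (suc s) k) W)) s (suc k)
  cyc = Cycle-cong (λ i h → trans (split (s ℕ.+ i)) (proj₁ rec (blockPerm s k (s ℕ.+ i)) (Cycle-< (blockPerm-cycle s k p) i h))) (blockPerm-cycle s k p)
  cycs : Cycles (perm (block 0 (s , range (suc s) k) W)) (s ℕ.+ suc k) κ
  cycs = Cycles-cong (s ℕ.+ suc k) κ (λ a h → trans (split a) (cong (perm W) (blockPerm-high s k a p h))) (proj₂ rec)

perm-pairs : ∀ d c e a → perm (dbl (replicate d (c , e))) a ≡ a
perm-pairs zero    c e a = refl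
perm-pairs (suc d) c e a = trans (cong (perm (dbl (replicate d (c , e)))) (τ-invol c e a)) (perm-pairs d c e a)

canon-cycles : ∀ {κ} d → All (0 ℕ.<_) κ → Cycles (perm (canon κ d)) 0 κ
canon-cycles d [] = tt
canon-cycles {suc k ∷ κ} d (_ ∷ ps) = Cycle-cong (λ i h → trans (split i) (proj₁ rec (run 1 k i) (Cycle-< first i h))) first ,
  Cycles-cong (suc k) κ (λ a h → trans (split a) (cong (perm W) (perm-fresh (range 1 k) (pos⇒≢0 (ℕₚ.<-≤-trans (ℕ.s≤s ℕ.z≤n) h)) (range-above 1 k h)))) (proj₂ rec)
  where
  W = blocks 0 (canonBlocks (suc k) κ) (dbl (replicate d (0 , 1)))
  rec = blocks-perm (suc k) (dbl (replicate d (0 , 1))) (ℕ.s≤s ℕ.z≤n) ps (perm-pairs d 0 1)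
  split : ∀ a → perm (canon (suc k ∷ κ) d) a ≡ perm W (run 1 k a)
  split a = perm-++ (stars 0 (range 1 k)) W a
  firstNext : ∀ k i → suc i ℕ.< suc k → run 1 k i ≡ suc i
  firstNext zero    i       (ℕ.s≤s ())
  firstNext (suc k) zero    h         = run-root 1 k (ℕ.s≤s ℕ.z≤n)
  firstNext (suc k) (suc i) (ℕ.s≤s (ℕ.s≤s h)) = run-mid 1 k i (ℕ.s≤s ℕ.z≤n) h
  firstBack : ∀ k → run 1 k k ≡ 0
  firstBack zero    = refl
  firstBack (suc k) = run-last 1 k (ℕ.s≤s ℕ.z≤n)
  first : Cycle (run 1 k) 0 (suc k)
  first = record { next = firstNext k ; back = λ { i refl → firstBack k } }

suc-% : ∀ n k → suc n % suc k ≡ suc (n % suc k) % suc k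
suc-% n k = trans (cong (λ z → suc z % suc k) (m≡m%n+[m/n]*n n (suc k))) ([m+kn]%n≡m%n (suc (n % suc k)) (n / suc k) (suc k))

Cycle-iter : ∀ {p s k} → Cycle p s (suc k) → ∀ j i → i ℕ.< suc k → iter p j (s ℕ.+ i) ≡ s ℕ.+ (j ℕ.+ i) % suc k
Cycle-iter {s = s} c zero    i h = cong (s ℕ.+_) (sym (m<n⇒m%n≡m h))
Cycle-iter {p} {s} {k} c (suc j) i h = trans (cong p (Cycle-iter c j i h)) (trans step (cong (s ℕ.+_) (sym (suc-% (j ℕ.+ i) k))))
  where
  x = (j ℕ.+ i) % suc k
  step : p (s ℕ.+ x) ≡ s ℕ.+ suc x % suc k
  step with suc x ℕ.≟ suc k
  ... | yes e = trans (back c x e) (trans (sym (ℕₚ.+-identityʳ s)) (cong (s ℕ.+_) (sym (trans (cong (_% suc k) e) (n%n≡0 (suc k))))))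
  ... | no  n = let lt = ℕₚ.≤∧≢⇒< (m%n<n (j ℕ.+ i) (suc k)) n in trans (next c x lt) (cong (s ℕ.+_) (sym (m<n⇒m%n≡m lt)))

%-return : ∀ j i k → i ℕ.< suc k → dl ((j ℕ.+ i) % suc k) i ≡ dl (j % suc k) 0
%-return j i k h = dl-iff forth back′
  where
  x = j % suc k
  reduce-% : (j ℕ.+ i) % suc k ≡ (x ℕ.+ i) % suc k
  reduce-% = trans (cong (_% suc k) (trans (cong (ℕ._+ i) (m≡m%n+[m/n]*n j (suc k))) (re x (j / suc k ℕ.* suc k) i))) ([m+kn]%n≡m%n (x ℕ.+ i) (j / suc k) (suc k))
    where
    re : ∀ a b c → a ℕ.+ b ℕ.+ c ≡ a ℕ.+ c ℕ.+ b
    re a b c = trans (ℕₚ.+-assoc a b c) (trans (cong (a ℕ.+_) (ℕₚ.+-comm b c)) (sym (ℕₚ.+-assoc a c b)))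
  back′ : x ≡ 0 → (j ℕ.+ i) % suc k ≡ i
  back′ e = trans reduce-% (trans (cong (λ z → (z ℕ.+ i) % suc k) e) (m<n⇒m%n≡m h))
  forth : (j ℕ.+ i) % suc k ≡ i → x ≡ 0
  forth e with ℕₚ.<-≤-connex (x ℕ.+ i) (suc k)
  ... | inj₁ lt = ℕₚ.+-cancelʳ-≡ i x 0 (trans (sym (m<n⇒m%n≡m lt)) (trans (sym reduce-%) e))
  -- After a wrap-around the residue is x + i - (k + 1). Equality with i would force x = k + 1,
  -- which is too large for a remainder.
  ... | inj₂ ge = ⊥-elim (ℕₚ.<⇒≢ (m%n<n j (suc k)) (ℕₚ.+-cancelʳ-≡ i x (suc k) x+i))
    where
    t = x ℕ.+ i ∸ suc k
    t+k : t ℕ.+ suc k ≡ x ℕ.+ i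
    t+k = ℕₚ.m∸n+n≡m ge
    t<k : t ℕ.< suc k
    t<k = ℕₚ.+-cancelʳ-< (suc k) t (suc k) (subst (ℕ._< suc k ℕ.+ suc k) (sym t+k) (ℕₚ.+-mono-< (m%n<n j (suc k)) h))
    t≡i : t ≡ i
    t≡i = trans (sym (m<n⇒m%n≡m t<k)) (trans (m≤n⇒[n∸m]%m≡n%m ge) (trans (sym reduce-%) e))
    x+i : x ℕ.+ i ≡ suc k ℕ.+ i
    x+i = trans (sym t+k) (trans (cong (ℕ._+ suc k) t≡i) (ℕₚ.+-comm i (suc k)))

-- The contribution of a cycle of length k to the number of fixed points of the j-th power.
part : ℕ → ℕ → ℕ
part j zero    = 0
part j (suc k) = if j % suc k ≡ᵇ 0 then suc k else 0

fixed : List ℕ → ℕ → ℕ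
fixed κ j = sum (map (part j) κ)

∑-split : ∀ (f : ℕ → ℤ) a b → ∑ {a ℕ.+ b} (f ∘ toℕ) ≡ ∑ {a} (f ∘ toℕ) + ∑ {b} (λ i → f (a ℕ.+ toℕ i))
∑-split f zero    b = sym (ℤₚ.+-identityˡ _)
∑-split f (suc a) b = trans (cong (f 0 +_) (∑-split (f ∘ suc) a b)) (sym (ℤₚ.+-assoc (f 0) _ _))

dl-+ : ∀ s a b → dl (s ℕ.+ a) (s ℕ.+ b) ≡ dl a b
dl-+ zero    a b = refl
dl-+ (suc s) a b = dl-+ s a b

count-cycle : ∀ {p s} k j → Cycle p s k → ∑ {k} (λ a → dl (iter p j (s ℕ.+ toℕ a)) (s ℕ.+ toℕ a)) ≡ ℤ.+ part j k
count-cycle zero j c = refl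
count-cycle {p} {s} (suc k) j c = trans (∑-cong {suc k} λ a → begin
  dl (iter p j (s ℕ.+ toℕ a)) (s ℕ.+ toℕ a)                ≡⟨ cong (λ z → dl z (s ℕ.+ toℕ a)) (Cycle-iter c j (toℕ a) (Finₚ.toℕ<n a)) ⟩
  dl (s ℕ.+ (j ℕ.+ toℕ a) % suc k) (s ℕ.+ toℕ a)           ≡⟨ dl-+ s _ (toℕ a) ⟩
  dl ((j ℕ.+ toℕ a) % suc k) (toℕ a)                       ≡⟨ %-return j (toℕ a) k (Finₚ.toℕ<n a) ⟩
  dl (j % suc k) 0                                         ∎) total
  where
  total : ∑ {suc k} (λ _ → dl (j % suc k) 0) ≡ ℤ.+ part j (suc k)
  total with j % suc k ≡ᵇ 0
  ... | true  = ∑-const1 (suc k)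
  ... | false = ∑-0 {suc k}

count-cycles : ∀ {p} s κ j → Cycles p s κ → ∑ {sum κ} (λ a → dl (iter p j (s ℕ.+ toℕ a)) (s ℕ.+ toℕ a)) ≡ ℤ.+ fixed κ j
count-cycles s []      j c        = refl
count-cycles {p} s (k ∷ κ) j (c , cs) = trans (∑-split (λ a → dl (iter p j (s ℕ.+ a)) (s ℕ.+ a)) k (sum κ))
  (cong₂ _+_ (count-cycle k j c)
    (trans (∑-cong {sum κ} λ a → cong (λ z → dl (iter p j z) z) (sym (ℕₚ.+-assoc s k (toℕ a)))) (count-cycles (s ℕ.+ k) κ j cs)))

fix-canon : ∀ r {κ} d (sp : Spanning r (canon κ d)) → All (0 ℕ.<_) κ → sum κ ≡ suc r → ∀ j → Trace.fix sp j ≡ ℤ.+ fixed κ j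
fix-canon r {κ} d sp pos total j = trans (cong (λ m → ∑ {m} (λ a → dl (iter (perm (canon κ d)) j (toℕ a)) (toℕ a))) (sym total))
  (count-cycles 0 κ j (canon-cycles d pos))

-- Recovering the partition from fixed points

≥-order = Flip.decTotalOrder ℕₚ.≤-decTotalOrder

open Sort ≥-order using () renaming (sort to sort↓; sort-↭ to sort↓-↭; sort-↗ to sort↓-sorted)
open Sort ℕₚ.≤-decTotalOrder using () renaming (sort to sort↑; sort-↭ to sort↑-↭; sort-↗ to sort↑-sorted)

part-> : ∀ {a c} → 0 ℕ.< a → a ℕ.< c → part a c ≡ 0
part-> {suc a} {suc c} p q rewrite m<n⇒m%n≡m q = refl

part-self : ∀ {a} → 0 ℕ.< a → part a a ≡ a
part-self {suc a} p rewrite n%n≡0 (suc a) {{_}} = refl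

fixed-> : ∀ {a xs} → 0 ℕ.< a → All (a ℕ.<_) xs → fixed xs a ≡ 0
fixed-> p []       = refl
fixed-> p (q ∷ qs) = cong₂ ℕ._+_ (part-> p q) (fixed-> p qs)

fixed-∷≢0 : ∀ {a} xs → 0 ℕ.< a → fixed (a ∷ xs) a ≢ 0
fixed-∷≢0 {a} xs p e = pos⇒≢0 p (trans (sym (part-self p)) (ℕₚ.m+n≡0⇒m≡0 (part a a) e))

-- The smallest part is the smallest j ≥ 1 whose power has a fixed point.
fixed-injective-↑ : ∀ {xs ys} → AllPairs ℕ._≤_ xs → AllPairs ℕ._≤_ ys → All (0 ℕ.<_) xs → All (0 ℕ.<_) ys →
  (∀ j → fixed xs j ≡ fixed ys j) → xs ≡ ys
fixed-injective-↑ []         []         _        _        h = refl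
fixed-injective-↑ []         (_∷_ {b} {ys} _ _) _  (q ∷ _)  h = ⊥-elim (fixed-∷≢0 ys q (sym (h b)))
fixed-injective-↑ (_∷_ {a} {xs} _ _) [] (p ∷ _)  _        h = ⊥-elim (fixed-∷≢0 xs p (h a))
fixed-injective-↑ (_∷_ {a} {xs} la lx) (_∷_ {b} {ys} lb ly) (p ∷ px) (q ∷ qy) h with ℕₚ.<-cmp a b
... | tri< a<b _ _ = ⊥-elim (fixed-∷≢0 xs p (trans (h a) (fixed-> p (a<b ∷ All.map (ℕₚ.<-≤-trans a<b) lb))))
... | tri> _ _ b<a = ⊥-elim (fixed-∷≢0 ys q (trans (sym (h b)) (fixed-> q (b<a ∷ All.map (ℕₚ.<-≤-trans b<a) la))))
... | tri≈ _ refl _ = cong (a ∷_) (fixed-injective-↑ lx ly px qy (λ j → ℕₚ.+-cancelˡ-≡ (part j a) _ _ (h j)))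

fixed-↭ : ∀ {xs ys} → xs ↭ ys → ∀ j → fixed xs j ≡ fixed ys j
fixed-↭ p j = sum-↭ (↭ₚ.map⁺ (part j) p)

-- The comparison starts from the smallest part, whereas partitions descend. Both lists are sorted
-- upwards and compared; being descending permutations of each other, they then coincide.
fixed-injective : ∀ {xs ys} → Linked _≥_ xs → Linked _≥_ ys → All (0 ℕ.<_) xs → All (0 ℕ.<_) ys →
  (∀ j → fixed xs j ≡ fixed ys j) → xs ≡ ys
fixed-injective {xs} {ys} lx ly px py h = Pointwise-≡⇒≡ (↗↭↗⇒≋ (DecTotalOrder.totalOrder ≥-order) lx ly (↭⇒↭ₛ
  (↭-trans (↭-sym (sort↑-↭ xs)) (subst (_↭ ys) (sym same) (sort↑-↭ ys)))))
  where
  same : sort↑ xs ≡ sort↑ ys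
  same = fixed-injective-↑ (Linked⇒AllPairs ℕₚ.≤-trans (sort↑-sorted xs)) (Linked⇒AllPairs ℕₚ.≤-trans (sort↑-sorted ys))
    (↭ₚ.All-resp-↭ (↭-sym (sort↑-↭ xs)) px) (↭ₚ.All-resp-↭ (↭-sym (sort↑-↭ ys)) py)
    (λ j → trans (fixed-↭ (sort↑-↭ xs) j) (trans (h j) (sym (fixed-↭ (sort↑-↭ ys) j))))

canon-injective : ∀ {r π π′ d d′} → 1 ℕ.≤ r → IsPartition (suc r) π → IsPartition (suc r) π′ → M (canon π d) ≅ M (canon π′ d′) → π ≡ π′
canon-injective {r} {π} {π′} {d} {d′} 1≤r (l , pos , total) (l′ , pos′ , total′) g =
  fixed-injective l l′ pos pos′ λ j → ℤₚ.+-injective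
    (trans (sym (fix-canon r {π} d sp pos total j)) (trans (fix-invariant r (canon π d) (canon π′ d′) sp sp′ g j) (fix-canon r {π′} d′ sp′ pos′ total′ j)))
  where
  sp : Spanning r (canon π d)
  sp = canon-spanning r d 1≤r pos total
  sp′ : Spanning r (canon π′ d′)
  sp′ = canon-spanning r d′ 1≤r pos′ total′

-- Existence and uniqueness

range⇒vertex : ∀ {m x} → InRange m x → Vertex m x
range⇒vertex {x = suc x} (_ , q) = fromℕ< q , cong suc (sym (Finₚ.toℕ-fromℕ< q))

std≅canon : ∀ {r π n} d → 1 ℕ.≤ r → IsPartition (suc r) π → n ≡ stdArrows (suc r) π d → β (ǦStd (suc r) π d n) ≅ M (canon π d)
std≅canon {r} {π} d 1≤r (_ , pos , total) refl = ≅-trans (entry⇒≅ Q.arrows Q.quiver-entry) (canonical (std-normal r d 1≤r pos total))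
  where
  W : Word
  W = stdWord (suc r) π (stdArrows (suc r) π d)
  fine : All (Fine (suc r)) W
  fine = stdWord-fine r d 1≤r pos total
  ends : ∀ (i : Fin (stdArrows (suc r) π d)) → Ends (Vertex (suc r)) (stdArrow (suc r) π (toℕ i))
  ends i = let _ , a , b = Allₚ.tabulate⁻ fine i in range⇒vertex a , range⇒vertex b
  noloop : ∀ (i : Fin (stdArrows (suc r) π d)) → Proper (stdArrow (suc r) π (toℕ i))
  noloop i = proj₁ (Allₚ.tabulate⁻ fine i)
  module Q = QuiverEntries (stdSrc (suc r) π) (stdTgt (suc r) π) ends noloop
  canonical : (Σ (NormalForm W) λ N → sizes N ≡ π × length (D N) ≡ d × A N ++ lets (Bs N) ≢ []) → M W ≅ M (canon π d)
  canonical (N , e , e′ , ne) = subst (λ κ → M W ≅ M (canon κ d)) e (subst (λ d → M W ≅ M (canon (sizes N) d)) e′ (normal≅canon N ne))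

length-⊆ : ∀ {xs ys : List ℕ} → Unique xs → (∀ {x} → x ∈ xs → x ∈ ys) → length xs ℕ.≤ length ys
length-⊆ []                        h = ℕ.z≤n
length-⊆ {x ∷ xs} (f ∷ u) h with Memₚ.∈-∃++ (h (here refl))
... | ys₁ , ys₂ , refl = subst (suc (length xs) ℕ.≤_) (sym (↭ₚ.↭-length (↭ₚ.shift x ys₁ ys₂))) (ℕ.s≤s (length-⊆ u sub))
  where
  sub : ∀ {z} → z ∈ xs → z ∈ ys₁ ++ ys₂
  sub {z} i with ↭ₚ.∈-resp-↭ (↭ₚ.shift x ys₁ ys₂) (h (there i))
  ... | here refl = ⊥-elim (All.lookup f i refl)
  ... | there j   = j

range-unique : ∀ s k → Unique (range s k)
range-unique s zero    = []
range-unique s (suc k) = range-below (suc s) k (ℕₚ.n<1+n s) ∷ range-unique (suc s) k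

length-range : ∀ s k → length (range s k) ≡ k
length-range s zero    = refl
length-range s (suc k) = cong suc (length-range (suc s) k)

length-stars : ∀ ρ X u → length (stars ρ X ++ u) ≡ length X ℕ.+ length u
length-stars ρ X u = trans (Lₚ.length-++ (stars ρ X)) (cong (ℕ._+ length u) (Lₚ.length-map (ρ ,_) X))

sum-sz : ∀ Bs → sum (map sz Bs) ≡ length (lets Bs)
sum-sz []             = refl
sum-sz ((y , Y) ∷ Bs) = cong suc (trans (cong (length Y ℕ.+_) (sum-sz Bs)) (sym (Lₚ.length-++ Y)))

sum-sizes : ∀ {w} (N : NormalForm w) → sum (sizes N) ≡ suc (length (A N ++ lets (Bs N)))
sum-sizes N = cong suc (trans (cong (length (A N) ℕ.+_) (sum-sz (Bs N))) (sym (Lₚ.length-++ (A N))))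

length-blocks : ∀ ρ Bs u → length (blocks ρ Bs u) ≡ sum (map sz Bs) ℕ.+ length Bs ℕ.+ length u
length-blocks ρ []             u = refl
length-blocks ρ ((y , Y) ∷ Bs) u = cong suc (trans (length-stars ρ Y _) (trans (cong (λ z → length Y ℕ.+ suc z) (length-blocks ρ Bs u))
  (lem (length Y) (sum (map sz Bs)) (length Bs) (length u))))
  where
  lem : ∀ a b c d → a ℕ.+ suc (b ℕ.+ c ℕ.+ d) ≡ a ℕ.+ b ℕ.+ suc c ℕ.+ d
  lem = ℕRing.solve-∀

length-dbl : ∀ D → length (dbl D) ≡ 2 ℕ.* length D
length-dbl []      = refl
length-dbl (t ∷ D) = trans (cong (suc ∘ suc) (length-dbl D)) (sym (ℕₚ.*-suc 2 (length D)))

-- A block takes one letter more than its size, since its first letter recurs at the end. With ℓ - 1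
-- blocks this gives (m - 1) + (ℓ - 1) + 2d.
length-nf : ∀ {w} (N : NormalForm w) → length w ≡ stdArrows (sum (sizes N)) (sizes N) (length (D N))
length-nf (mkNF ρ A Bs D e _ _) = trans (∼-length e) (trans (length-stars ρ A _) (trans (cong (length A ℕ.+_) (trans (length-blocks ρ Bs (dbl D))
  (cong (sum (map sz Bs) ℕ.+ length Bs ℕ.+_) (length-dbl D))))
  (trans (lem (length A) (sum (map sz Bs)) (length Bs) (2 ℕ.* length D)) (cong (λ z → length A ℕ.+ sum (map sz Bs) ℕ.+ z ℕ.+ 2 ℕ.* length D) (sym (Lₚ.length-map sz Bs))))))
  where
  lem : ∀ a b c d → a ℕ.+ (b ℕ.+ c ℕ.+ d) ≡ a ℕ.+ b ℕ.+ c ℕ.+ d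
  lem = ℕRing.solve-∀

-- Moves keep the ends within 1, ..., r + 1, and a missing vertex would be separated by the
-- indicator of the vertices of the normal form. Two repetition-free lists with the same members
-- have the same length.
spanning-sum : ∀ {r w} (N : NormalForm w) → Vertex (suc r) (ρ N) → All (Ends (Vertex (suc r))) w → Connected (suc r) w → sum (sizes N) ≡ suc r
spanning-sum {r} N@(mkNF ρ A Bs D e un g) vρ ew cw = trans (sum-sizes N)
  (ℕₚ.≤-antisym (subst (length L ℕ.≤_) (length-range 1 (suc r)) (length-⊆ un below))
    (subst (ℕ._≤ length L) (length-range 1 (suc r)) (length-⊆ (range-unique 1 (suc r)) above)))
  where
  L = ρ ∷ A ++ lets Bs
  vertex⇒range : ∀ {x} → Vertex (suc r) x → x ∈ range 1 (suc r)
  vertex⇒range (v , refl) = range-∈ 1 (suc r) (ℕ.s≤s ℕ.z≤n) (ℕ.s≤s (Finₚ.toℕ<n v))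
  below : ∀ {x} → x ∈ L → x ∈ range 1 (suc r)
  below (here refl) = vertex⇒range vρ
  below (there i)   = vertex⇒range (proj₂ (All.lookup (∼-Ends e ew) (nf-∈ ρ A Bs D i)))
  constant : All (Constant (indicator L)) (nf ρ A Bs D)
  constant = nf-All A Bs D (λ i → trans (indicator-∈ {L} (here refl)) (sym (indicator-∈ {L} (there i))))
    (All.map (λ { {a , b} (_ , p , q) → trans (indicator-∈ {L} p) (sym (indicator-∈ {L} q)) }) g)
  above : ∀ {x} → x ∈ range 1 (suc r) → x ∈ L
  above {x} i with x ∈? L
  ... | yes p = p
  ... | no  n = contradiction (trans (sym (indicator-∈ {L} (here refl))) (trans (∼-Connected e cw (indicator L) constant vρ
    (range⇒vertex (All.lookup (range-≥ 1 (suc r)) i , ℕₚ.≤-pred (All.lookup (range-< 1 (suc r)) i)))) (indicator-∉ {L} n))) λ ()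

sorted-normal-form : ∀ {r w} → All Proper w → All (Ends (Vertex (suc r))) w → Connected (suc r) w →
  Σ (NormalForm w) λ N → IsPartition (suc r) (sizes N)
sorted-normal-form {r} {w} pw ew cw with star-form (fzero , refl) pw ew cw
... | X , f , e with normalise 1 X f
... | mkNF .1 A Bs D e₀ un g , refl = N , subst (λ κ → Linked _≥_ κ × All (0 ℕ.<_) κ × sum κ ≡ suc r) (sym s)
    (sort↓-sorted (sizes N₀) , ↭ₚ.All-resp-↭ (↭-sym (sort↓-↭ (sizes N₀))) positive ,
     trans (sum-↭ (sort↓-↭ (sizes N₀))) (spanning-sum N₀ (fzero , refl) ew cw))
  where
  N₀ : NormalForm w
  N₀ = mkNF 1 A Bs D (∼trans e e₀) un g
  positive : All (0 ℕ.<_) (sizes N₀)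
  positive = ℕ.s≤s ℕ.z≤n ∷ Allₚ.map⁺ (All.universal (λ _ → ℕ.s≤s ℕ.z≤n) Bs)
  permuted = permute (↭-sym (sort↓-↭ (sizes N₀))) N₀ refl
  N = proj₁ permuted
  s = proj₁ (proj₂ permuted)

theoremA : (r : ℕ) → r ≥ 1 → (n : ℕ) → (C : Mat n n)
    → IsUnitForm C → IsConnected C → IsNonNegative C → HasDynkinTypeA C r
    → Σ (List ℕ) λ π → Σ ℕ λ d →
    (IsPartition (suc r) π × CongToStd C (suc r) π d)
    × (∀ (π' : List ℕ) (d' : ℕ) → IsPartition (suc r) π' → CongToStd C (suc r) π' d'
    → π' ≡ π × d' ≡ d)
theoremA r 1≤r n C unit _ _ dynkin = π , d , (part-π , n≡ , ≅⇒SGC (≅-trans C≅canon (≅-sym (β-ext (ǦStd (suc r) π d n)) (std≅canon d 1≤r part-π n≡)))) , unique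
  where
  open Realisation (realisation C r unit dynkin)
  w : Word
  w = tabulate arrow
  normal : Σ (NormalForm w) λ N → IsPartition (suc r) (sizes N)
  normal = sorted-normal-form (Allₚ.tabulate⁺ proper) (Allₚ.tabulate⁺ ends) conn
  N : NormalForm w
  N = proj₁ normal
  π : List ℕ
  π = sizes N
  d : ℕ
  d = length (D N)
  part-π : IsPartition (suc r) π
  part-π = proj₂ normal
  n≡ : n ≡ stdArrows (suc r) π d
  n≡ = trans (sym (Lₚ.length-tabulate arrow)) (trans (length-nf N) (cong (λ m → stdArrows m π d) (proj₂ (proj₂ part-π))))
  -- By r ≥ 1 there is a vertex besides the root, at which `normal≅canon` places the doubled arrows.
  nonempty : A N ++ lets (Bs N) ≢ []
  nonempty e = ℕₚ.<⇒≢ 1≤r (sym (ℕₚ.suc-injective (trans (sym (proj₂ (proj₂ part-π))) (trans (sum-sizes N) (cong (suc ∘ length) e)))))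
  C≅canon : β (Ǧ C) ≅ M (canon π d)
  C≅canon = ≅-trans (entry⇒≅ arrow entries) (normal≅canon N nonempty)
  unique : ∀ (π' : List ℕ) (d' : ℕ) → IsPartition (suc r) π' → CongToStd C (suc r) π' d' → π' ≡ π × d' ≡ d
  -- Once the partitions agree, both counts of the n arrows agree; cancelling r + (ℓ - 1) and the
  -- factor 2 identifies the numbers of doubled arrows.
  unique π' d' part-π' (n≡' , sgc) = π'≡π , ℕₚ.*-cancelˡ-≡ d' d 2 (ℕₚ.+-cancelˡ-≡ (r ℕ.+ (length π ∸ 1)) _ _
      (trans (cong (λ κ → r ℕ.+ (length κ ∸ 1) ℕ.+ 2 ℕ.* d') (sym π'≡π)) (trans (sym n≡') n≡)))
    where
    π'≡π : π' ≡ π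
    π'≡π = sym (canon-injective {d = d} {d'} 1≤r part-π part-π'
      (≅-trans (≅-sym (β-ext (Ǧ C)) C≅canon) (≅-trans (SGC⇒≅ sgc) (std≅canon d' 1≤r part-π' n≡'))))
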